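{- Min-Sum Cycle Packing and Min-Sum Edge-Disjoint Cycle Packing can be solved in $n^{\mathcal{O}(k^6)}$ time, where $n$ is the number of vertices in the input graph and $k$ is the number of cycles requested.
   Context: Graphs are finite, undirected and simple. For a graph $G$ with edge weights $w\colon E(G)\to\mathbb{Z}_{>0}$, the length of a cycle is the sum of the weights of its edges. Min-Sum Cycle Packing: the input is a graph $G$ with a weight function $w\colon E(G)\to\mathbb{Z}_{>0}$, an integer $k\ge 1$, and $\ell\in\mathbb{Z}_{\ge 0}$. The task is to decide whether there is a family of $k$ pairwise vertex-disjoint cycles in $G$ whose total length is at most $\ell$. Min-Sum Edge-Disjoint Cycle Packing: the same input; the task is to decide whether there is a family of $k$ pairwise edge-disjoint cycles in $G$ whose total length is at most $\ell$. Running times count arithmetic operations on weights (additions, comparisons) as unit cost; the bound does not depend on the magnitude of the weights. -}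

module Defs where

open import Data.Bool.Base using (if_then_else_)
open import Data.Fin.Base using (Fin; toℕ; fromℕ<; remQuot)
open import Data.Nat.Base using (ℕ; suc; _+_; _*_; _∸_; _⊔_; _^_; _≤_; _<_)
open import Data.Nat.DivMod using (_mod_)
open import Data.Nat.Properties using (_≟_; _≤?_; _<?_; +-0-commutativeMonoid)
open import Data.Product.Base using (Σ-syntax; ∃-syntax; _×_; _,_)
open import Data.Sum.Base using (_⊎_)
open import Function.Base using (const)
open import Function.Bundles using (_⇔_)
open import Function.Definitions using (Injective)
open import Level using (0ℓ)
open import Relation.Binary.Core using (Rel)
open import Relation.Binary.Definitions using (Decidable; Irreflexive; Symmetric)
open import Relation.Binary.PropositionalEquality.Core using (_≡_; _≢_)
open import Relation.Nullary.Decidable.Core using (Dec; yes; no; does)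
open import Relation.Nullary.Negation.Core using (¬_)

open import Algebra.Properties.CommutativeMonoid.Sum +-0-commutativeMonoid using (sum)

------------------------------------------------------------------------
-- Weighted graphs and cycles

record Graph (n : ℕ) : Set₁ where
  field
    Adj        : Rel (Fin n) 0ℓ
    adj?       : Decidable Adj
    adj-sym    : Symmetric Adj
    adj-irrefl : Irreflexive _≡_ Adj

-- A function on the edges: the weight of the ordered pair (u , v) is
-- independent of the proof of adjacency and of the order of u and v.
record Weighting {n : ℕ} (G : Graph n) : Set where
  open Graph G
  field
    weight     : ∀ u v → .(Adj u v) → ℕ
    weight-sym : ∀ {u v} (e : Adj u v) → weight u v e ≡ weight v u (adj-sym e)
    weight-pos : ∀ {u v} (e : Adj u v) → 0 < weight u v e

-- A cyclic sequence of 3 + extra ≥ 3 distinct vertices.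
record Cycle {n : ℕ} (G : Graph n) : Set where
  open Graph G
  field
    extra : ℕ

  order : ℕ
  order = 3 + extra

  next : Fin order → Fin order
  next i = suc (toℕ i) mod order

  field
    vertex    : Fin order → Fin n
    injective : Injective _≡_ _≡_ vertex
    adjacent  : ∀ i → Adj (vertex i) (vertex (next i))

module _ {n : ℕ} {G : Graph n} where
  open Cycle

  cycleLength : Weighting G → Cycle G → ℕ
  cycleLength w C =
    sum (λ i → weight (vertex C i) (vertex C (next C i)) (adjacent C i))
    where open Weighting w

  VertexDisjoint : Rel (Cycle G) 0ℓ
  VertexDisjoint C D = ∀ i j → vertex C i ≢ vertex D j

  SameEdge : Rel (Fin n × Fin n) 0ℓ
  SameEdge (a , b) (c , d) = (a ≡ c × b ≡ d) ⊎ (a ≡ d × b ≡ c)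

  EdgeDisjoint : Rel (Cycle G) 0ℓ
  EdgeDisjoint C D = ∀ i j →
    ¬ SameEdge (vertex C i , vertex C (next C i)) (vertex D j , vertex D (next D j))

------------------------------------------------------------------------
-- The two decision problems

record Instance : Set₁ where
  field
    n   : ℕ
    G   : Graph n
    w   : Weighting G
    k   : ℕ
    1≤k : 1 ≤ k
    ℓ   : ℕ

module _ (I : Instance) where
  open Instance I

  CyclePacking : Rel (Cycle G) 0ℓ → Set
  CyclePacking Disjoint =
    Σ[ C ∈ (Fin k → Cycle G) ]
      (∀ i j → i ≢ j → Disjoint (C i) (C j)) ×
      sum (λ i → cycleLength w (C i)) ≤ ℓ

  MinSumCyclePacking : Set
  MinSumCyclePacking = CyclePacking VertexDisjoint

  MinSumEdgeDisjointCyclePacking : Set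
  MinSumEdgeDisjointCyclePacking = CyclePacking EdgeDisjoint

------------------------------------------------------------------------
-- Machine model: a structured unit-cost random access machine.
--
-- Memory is split into two sorts, indices and weights, each with scalar
-- variables and arrays named by numerals.  Weights can only be moved, added
-- and compared, and reach the index sort only as outcomes of comparisons.
-- Indices have addition and truncated subtraction but no unit-cost
-- multiplication, which would make the machine unreasonably powerful.

record State : Set where
  constructor mkState
  field
    var  : ℕ → ℕ
    arr  : ℕ → ℕ → ℕ
    wvar : ℕ → ℕ
    warr : ℕ → ℕ → ℕ

open State

infixl 9 _[_↦_]

_[_↦_] : {A : Set} → (ℕ → A) → ℕ → A → (ℕ → A)
(f [ i ↦ x ]) j = if does (j ≟ i) then x else f j

data Instr : Set where
  const!               : (x c : ℕ) → Instr
  add! monus!          : (x y z : ℕ) → Instr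
  load! store!         : (x a y : ℕ) → Instr
  wmove!               : (u v : ℕ) → Instr
  wadd!                : (u v w : ℕ) → Instr
  wleq!                : (x u v : ℕ) → Instr
  wload! wstore!       : (u a y : ℕ) → Instr

bit : {P : Set} → Dec P → ℕ
bit p = if does p then 1 else 0

setVar : ℕ → ℕ → State → State
setVar x c s = record s { var = var s [ x ↦ c ] }

setWVar : ℕ → ℕ → State → State
setWVar u c s = record s { wvar = wvar s [ u ↦ c ] }

exec : Instr → State → State
exec (const! x c)    s = setVar x c s
exec (add! x y z)    s = setVar x (var s y + var s z) s
exec (monus! x y z)  s = setVar x (var s y ∸ var s z) s
exec (load! x a y)   s = setVar x (arr s a (var s y)) s
exec (store! x a y)  s = record s { arr = arr s [ a ↦ arr s a [ var s y ↦ var s x ] ] }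
exec (wmove! u v)    s = setWVar u (wvar s v) s
exec (wadd! u v w)   s = setWVar u (wvar s v + wvar s w) s
exec (wleq! x u v)   s = setVar x (bit (wvar s u ≤? wvar s v)) s
exec (wload! u a y)  s = setWVar u (warr s a (var s y)) s
exec (wstore! u a y) s = record s { warr = warr s [ a ↦ warr s a [ var s y ↦ wvar s u ] ] }

infixr 5 _⨾_

data Program : Set where
  instr : Instr → Program
  skip  : Program
  _⨾_   : Program → Program → Program
  ifnz  : (x : ℕ) → Program → Program → Program
  while : (x : ℕ) → Program → Program

-- ⟨ p , s ⟩⇓[ t ] s′ : started in s, p halts in s′ after t steps, where every
-- instruction and every test counts as one step.
data ⟨_,_⟩⇓[_]_ : Program → State → ℕ → State → Set where
  ⇓instr : ∀ {ι s} → ⟨ instr ι , s ⟩⇓[ 1 ] exec ι s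
  ⇓skip  : ∀ {s} → ⟨ skip , s ⟩⇓[ 1 ] s
  ⇓seq   : ∀ {p q s s′ s″ t t′} →
           ⟨ p , s ⟩⇓[ t ] s′ → ⟨ q , s′ ⟩⇓[ t′ ] s″ →
           ⟨ p ⨾ q , s ⟩⇓[ t + t′ ] s″
  ⇓then  : ∀ {x p q s s′ t} → var s x ≢ 0 →
           ⟨ p , s ⟩⇓[ t ] s′ → ⟨ ifnz x p q , s ⟩⇓[ suc t ] s′
  ⇓else  : ∀ {x p q s s′ t} → var s x ≡ 0 →
           ⟨ q , s ⟩⇓[ t ] s′ → ⟨ ifnz x p q , s ⟩⇓[ suc t ] s′
  ⇓done  : ∀ {x p s} → var s x ≡ 0 → ⟨ while x p , s ⟩⇓[ 1 ] s
  ⇓loop  : ∀ {x p s s′ s″ t t′} → var s x ≢ 0 →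
           ⟨ p , s ⟩⇓[ t ] s′ → ⟨ while x p , s′ ⟩⇓[ t′ ] s″ →
           ⟨ while x p , s ⟩⇓[ suc (t + t′) ] s″

------------------------------------------------------------------------
-- Input, output and running time

-- Row-major layout of an n × n matrix: entry (u , v) is at address u * n + v.
flatten : (n : ℕ) → (Fin n → Fin n → ℕ) → ℕ → ℕ
flatten n M a with a <? n * n
... | no  _  = 0
... | yes lt with remQuot {n} n (fromℕ< lt)
...   | u , v = M u v

module _ (I : Instance) where
  open Instance I
  open Graph G
  open Weighting w

  adjacencyMatrix : Fin n → Fin n → ℕ
  adjacencyMatrix u v = bit (adj? u v)

  weightMatrix : Fin n → Fin n → ℕ
  weightMatrix u v with adj? u v
  ... | yes e = weight u v e
  ... | no  _ = 0

  -- Everything not holding part of the input is initially 0.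
  input : State
  input = mkState
    (const 0 [ 0 ↦ n ] [ 1 ↦ k ])
    (const (const 0) [ 0 ↦ flatten n adjacencyMatrix ])
    (const 0 [ 0 ↦ ℓ ])
    (const (const 0) [ 0 ↦ flatten n weightMatrix ])

accepts : State → Set
accepts s = var s 0 ≢ 0

DecidesWithin : Program → (Instance → Set) → (Instance → ℕ) → Set₁
DecidesWithin p Problem time =
  ∀ I → ∃[ t ] ∃[ s ]
    ⟨ p , input I ⟩⇓[ t ] s × t ≤ time I × (accepts s ⇔ Problem I)

-- Running time n^O(f k), for one program serving all n and k.  The base is
-- max(n, 2), since n ^ e would allow at most one step when n ≤ 1.
SolvableInTime-n^O[_] : (ℕ → ℕ) → (Instance → Set) → Set₁
SolvableInTime-n^O[ f ] Problem =
  ∃[ p ] ∃[ c ] DecidesWithin p Problem (λ I → (2 ⊔ n I) ^ (c * f (k I)))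
  where
    open Instance

{-# OPTIONS --safe #-}
module Submission where

-- Call a cycle short if its length is at most L, a fraction 1 / poly(k) of the weight W of an optimal packing.
-- Some set X of O(k²) vertices meets all short cycles.  Otherwise short cycles that avoid the vertices used so far
-- as ends of ears yield, ear by ear, a forest together with 1280 k² extra edges in which all degrees are bounded.
-- Cut the forest into at most 21 k connected pieces with O(k) ends of extra edges each.  By the pigeonhole principle
-- two extra edges join the same two pieces and so lie on a cycle there; deleting the extra edges at these pieces
-- and repeating gives k disjoint cycles of total weight less than W.
--
-- In G - X a path of length at most L / 2 is the only shortest path between its ends, for two would form a short
-- cycle.  So every optimal cycle splits into poly(k) single edges and such paths.  The machine enumerates X and the
-- ends of these paths as the digits of an n-ary number, recovers the paths by Bellman–Ford in G - X, and checks the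
-- cycles obtained.  The two problems differ only in whether visited vertices are unmarked after each cycle.

open import Data.Bool.Base as Bool using (Bool; _∨_; false; if_then_else_; true)
open import Data.Bool.Properties using (∨-conicalʳ; ∨-conicalˡ)
open import Data.Empty using (⊥; ⊥-elim)
open import Data.Fin.Base as Fin using (Fin; combine; fromℕ; fromℕ<; inject₁; remQuot; suc; toℕ; zero)
import Data.Fin.Properties as Fin
open import Data.Fin.Relation.Unary.Top using (view; ‵fromℕ; ‵inject₁)
open import Data.List.Base using (List; []; [_]; _++_; _ʳ++_; _∷_; cartesianProduct; filter; length; lookup; map; replicate; reverse; tabulate)
open import Data.List.Membership.Propositional using (_∈_; _∉_; find; lose)
open import Data.List.Membership.Propositional.Properties using (∈-++⁺ʳ; ∈-++⁺ˡ; ∈-++⁻; ∈-allFin; ∈-cartesianProduct⁺; ∈-filter⁻; ∈-lookup; ∈-map⁻; ∈-tabulate⁻)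
open import Data.List.Properties using (++-assoc; ++-identityʳ; ++-ʳ++; filter-accept; filter-reject; length-++; length-map; length-replicate; length-reverse; length-tabulate; map-cong; map-∘; reverse-involutive; unfold-reverse)
open import Data.List.Relation.Binary.Disjoint.Propositional using (Disjoint)
open import Data.List.Relation.Binary.Subset.Propositional using (_⊆_)
open import Data.List.Relation.Unary.All as All using (All; []; _∷_)
import Data.List.Relation.Unary.All.Properties as All
open import Data.List.Relation.Unary.AllPairs as AllPairs using (AllPairs; []; _∷_)
import Data.List.Relation.Unary.AllPairs.Properties as AllPairs
open import Data.List.Relation.Unary.Any as Any using (Any; any?; here; there)
import Data.List.Relation.Unary.Any.Properties as Any
open import Data.List.Relation.Unary.Unique.Propositional using (Unique)
import Data.List.Relation.Unary.Unique.Propositional.Properties as Unique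
open import Data.Nat.Base
open import Data.Nat.DivMod using (_%_; _/_; m%n<n; m/n*n≤m; m<n⇒m%n≡m; m≡m%n+[m/n]*n; n%n≡0)
open import Data.Nat.Properties
open import Data.Nat.Tactic.RingSolver using (solve-∀)
open import Data.Product.Base using (_,_; _×_; proj₁; proj₂; Σ-syntax; ∃; ∃-syntax)
open import Data.Product.Properties using (≡-dec)
open import Data.Sum.Base using ([_,_]′; _⊎_; inj₁; inj₂)
open import Data.Unit.Base using (tt; ⊤)
open import Defs
open import Function.Base using (_∘_; case_of_; const; id)
open import Function.Bundles using (_⇔_; mk⇔)
open import Level using (0ℓ)
open import Relation.Binary.Core using (Rel)
open import Relation.Binary.PropositionalEquality using (_≡_; _≢_; cong; cong₂; module ≡-Reasoning; refl; subst; subst₂; sym; trans)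
open import Relation.Nullary using (Dec; contradiction; does; no; yes; ¬_)
open import Relation.Nullary.Decidable using (_×-dec_; _⊎-dec_; dec-false; dec-true; ¬?)
open import Algebra.Properties.CommutativeMonoid.Sum +-0-commutativeMonoid using (sum; sum-cong-≗; sum-init-last)

open State

-- Walks and tours

-- Uniqueness of shortest paths protects disjointness: if a path of an optimal cycle could be
-- replaced by another one of the same length, the new path might run into other cycles. Forced
-- paths are recovered exactly, so the checks are applied to the optimal packing itself. The machine
-- never learns `W` or `L`, nor whether its `X` meets all short cycles. It counts only cycles that
-- it has traced and checked, so soundness rests on the checks alone; the hitting set matters only
-- for the existence of a successful guess. Neither this set nor an optimal packing is computed:
-- both are shown to exist under double negation, which suffices because `accepts` is itself a
-- negated equation. Sizes: `k` cycles built in the pieces weigh at most a multiple of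
-- `k * (k * k) * L`, so `L` may be chosen of order `W` over `k ^ 3`, and a cycle splits into a
-- number of pairs of order `k ^ 3`. For each of the `k` cycles `M` pairs are reserved, with `M` of
-- order `k ^ 4`; hence `n ^ K` guesses with `K` of order `k ^ 5`.

AllPairs-++⁻ : ∀ {A : Set} {R : A → A → Set} (xs {ys} : List A) → AllPairs R (xs ++ ys) →
  AllPairs R xs × AllPairs R ys × All (λ x → All (R x) ys) xs
AllPairs-++⁻ []       p        = [] , p , []
AllPairs-++⁻ (x ∷ xs) (px ∷ p) with AllPairs-++⁻ xs p
... | a , b , c = (All.++⁻ˡ xs px ∷ a) , b , (All.++⁻ʳ xs px ∷ c)

Unique-++-comm : ∀ {A : Set} (xs {ys} : List A) → Unique (xs ++ ys) → Unique (ys ++ xs)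
Unique-++-comm xs u with AllPairs-++⁻ xs u
... | a , b , c = Unique.++⁺ b a λ (v∈ys , v∈xs) → All.lookup (All.lookup c v∈xs) v∈ys refl

Unique-∉ : ∀ {A : Set} {x : A} {xs} → Unique (x ∷ xs) → x ∉ xs
Unique-∉ (px ∷ _) x∈ = All.lookup px x∈ refl

∉-Unique : ∀ {A : Set} {x : A} {xs} → x ∉ xs → Unique xs → Unique (x ∷ xs)
∉-Unique x∉ u = All.tabulate (λ y∈ eq → x∉ (subst (_∈ _) (sym eq) y∈)) ∷ u

∈-split : ∀ {A : Set} {x : A} {xs} → x ∈ xs → ∃[ ys ] ∃[ zs ] xs ≡ ys ++ x ∷ zs
∈-split (here refl) = [] , _ , refl
∈-split (there x∈) with ∈-split x∈
... | ys , zs , refl = _ ∷ ys , zs , refl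

Unique-last : ∀ {A : Set} {x : A} (xs : List A) {ys} → Unique (xs ++ x ∷ ys) → x ∈ ys → ⊥
Unique-last xs u x∈ with AllPairs-++⁻ xs u
... | _ , u′ , _ = Unique-∉ u′ x∈

-- The start is not listed, so appending lists composes walks, and a closed walk can list every
-- vertex of a cycle exactly once.
data Walk {V : Set} (R : V → V → Set) : V → List V → V → Set where
  nil  : ∀ {s} → Walk R s [] s
  cons : ∀ {s x ms t} → R s x → Walk R x ms t → Walk R s (x ∷ ms) t

module _ {V : Set} {R : V → V → Set} where

  walk-++ : ∀ {s ms t ms′ u} → Walk R s ms t → Walk R t ms′ u → Walk R s (ms ++ ms′) u
  walk-++ nil        w′ = w′
  walk-++ (cons r w) w′ = cons r (walk-++ w w′)

  walk-split : ∀ ms {s ms′ u} → Walk R s (ms ++ ms′) u → ∃[ t ] Walk R s ms t × Walk R t ms′ u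
  walk-split []       w          = _ , nil , w
  walk-split (x ∷ ms) (cons r w) with walk-split ms w
  ... | t , w₁ , w₂ = t , cons r w₁ , w₂

  walk-last : ∀ {s ms t} → Walk R s ms t → t ∈ s ∷ ms
  walk-last nil        = here refl
  walk-last (cons r w) = there (walk-last w)

  walk-last⁺ : ∀ {s x ms t} → Walk R s (x ∷ ms) t → t ∈ x ∷ ms
  walk-last⁺ (cons r w) = walk-last w

  walk-map : ∀ {R′ : V → V → Set} → (∀ {u v} → R u v → R′ u v) → ∀ {s ms t} → Walk R s ms t → Walk R′ s ms t
  walk-map f nil        = nil
  walk-map f (cons r w) = cons (f r) (walk-map f w)

  walk-All : ∀ {P : V → Set} → (∀ {u v} → R u v → P v) → ∀ {s ms t} → Walk R s ms t → All P ms
  walk-All f nil        = []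
  walk-All f (cons r w) = f r ∷ walk-All f w

  walk-snoc⁻ : ∀ ms {s x t} → Walk R s (ms ++ [ x ]) t → t ≡ x
  walk-snoc⁻ []       (cons r nil) = refl
  walk-snoc⁻ (_ ∷ ms) (cons r w)   = walk-snoc⁻ ms w

  walk-unsnoc : ∀ {s x ms t} → Walk R s (x ∷ ms) t → ∃[ ys ] ∃[ y ] x ∷ ms ≡ ys ++ [ t ] × Walk R s ys y × R y t
  walk-unsnoc (cons r nil) = [] , _ , refl , nil , r
  walk-unsnoc (cons r w@(cons _ _)) with walk-unsnoc w
  ... | ys , y , eq , w′ , r′ = _ ∷ ys , y , cong (_ ∷_) eq , cons r w′ , r′

module Base (I : Instance) where

  open Instance I public using (n; G; w; k; 1≤k; ℓ)
  open Graph G public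
  open Weighting w public

  V : Set
  V = Fin n

  _≟ᵛ_ : (u v : V) → Dec (u ≡ v)
  _≟ᵛ_ = Fin._≟_

  open import Data.List.Membership.DecPropositional _≟ᵛ_ public using (_∈?_)

  wt : V → V → ℕ
  wt = weightMatrix I

  weight≡wt : ∀ {u v} .(e : Adj u v) → weight u v e ≡ wt u v
  weight≡wt {u} {v} e with adj? u v
  ... | yes _ = refl
  ... | no ¬e = ⊥-elim-irr (¬e e)
    where
    ⊥-elim-irr : ∀ {A : Set} → .⊥ → A
    ⊥-elim-irr ()

  wt-pos : ∀ {u v} → Adj u v → 0 < wt u v
  wt-pos e = subst (0 <_) (weight≡wt e) (weight-pos e)

  wt-sym : ∀ u v → wt u v ≡ wt v u
  wt-sym u v with adj? u v | adj? v u
  ... | yes e | yes _  = weight-sym e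
  ... | yes e | no ¬e  = contradiction (adj-sym e) ¬e
  ... | no ¬e | yes e  = contradiction (adj-sym e) ¬e
  ... | no _  | no _   = refl

  len : V → List V → ℕ
  len s []       = 0
  len s (x ∷ ms) = wt s x + len x ms

  len-++ : ∀ {R : V → V → Set} {s ms t} ms′ → Walk R s ms t → len s (ms ++ ms′) ≡ len s ms + len t ms′
  len-++ ms′ nil                          = refl
  len-++ {s = s} ms′ (cons {x = x} {ms} {t} r p) = trans (cong (wt s x +_) (len-++ ms′ p)) (sym (+-assoc (wt s x) (len x ms) (len t ms′)))

  walk-reverse : ∀ {R : V → V → Set} → (∀ {u v} → R u v → R v u) → ∀ {s ms t} → Walk R s ms t →
    ∃[ ms′ ] Walk R t ms′ s × len t ms′ ≡ len s ms
  walk-reverse R-sym nil = [] , nil , refl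
  walk-reverse R-sym {s} (cons {x = x} {ms} {t} r p) with walk-reverse R-sym p
  ... | ms′ , p′ , eq = ms′ ++ [ s ] , walk-++ p′ (cons (R-sym r) nil) ,
    (begin
      len t (ms′ ++ [ s ])        ≡⟨ len-++ [ s ] p′ ⟩
      len t ms′ + (wt x s + 0)    ≡⟨ cong₂ _+_ eq (trans (+-identityʳ _) (wt-sym x s)) ⟩
      len x ms + wt s x           ≡⟨ +-comm (len x ms) (wt s x) ⟩
      wt s x + len x ms           ∎)
    where open ≡-Reasoning

  -- Loop erasure.
  simplify : ∀ {R : V → V → Set} {s ms t} → Walk R s ms t →
    ∃[ ms′ ] Walk R s ms′ t × Unique (s ∷ ms′) × len s ms′ ≤ len s ms
  simplify nil = [] , nil , ([] ∷ []) , z≤n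
  simplify {R} {s} (cons {x = x} {ms} {t} r p) with simplify p
  ... | ms′ , p′ , u , le with s ∈? (x ∷ ms′)
  ... | no s∉  = x ∷ ms′ , cons r p′ , ∉-Unique s∉ u , +-monoʳ-≤ (wt s x) le
  ... | yes s∈ with cut p′ u s∈
    where
    cut : ∀ {x ms t} → Walk R x ms t → Unique (x ∷ ms) → s ∈ x ∷ ms →
      ∃[ ms′ ] Walk R s ms′ t × Unique (s ∷ ms′) × len s ms′ ≤ len x ms
    cut p u (here refl) = _ , p , u , ≤-refl
    cut {x = x} (cons {x = y} r p) (_ ∷ u) (there s∈) with cut p u s∈
    ... | ms′ , p′ , u′ , le = ms′ , p′ , u′ , ≤-trans le (m≤n+m _ (wt x y))
  ... | ms″ , p″ , u″ , le″ = ms″ , p″ , u″ , ≤-trans le″ (≤-trans le (m≤n+m _ (wt s x)))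

  -- The start reappears as the last move. Hence `Unique ms` says that the cycle is simple,
  -- `length ms` is its number of vertices, and rotating it only swaps two parts of the list.
  record Tour (R : V → V → Set) (s : V) (ms : List V) : Set where
    constructor tour
    field
      walk   : Walk R s ms s
      unique : Unique ms
      long   : 3 ≤ length ms
  open Tour public

  tour-start : ∀ {R s ms} → Tour R s ms → s ∈ ms
  tour-start {ms = _ ∷ _} B = walk-last⁺ (walk B)
  tour-start {ms = []} (tour _ _ ())

  rotate : ∀ {R s} ms₁ ms₂ {m} → Tour R s (ms₁ ++ ms₂) → Walk R s ms₁ m → Walk R m ms₂ s →
    Tour R m (ms₂ ++ ms₁) × len m (ms₂ ++ ms₁) ≡ len s (ms₁ ++ ms₂)
  rotate {_} {s} ms₁ ms₂ {m} B p₁ p₂ =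
    tour (walk-++ p₂ p₁) (Unique-++-comm ms₁ (unique B)) (subst (3 ≤_) leneq (long B)) ,
    trans (len-++ ms₁ p₂) (trans (+-comm (len m ms₂) (len s ms₁)) (sym (len-++ ms₂ p₁)))
    where
    leneq : length (ms₁ ++ ms₂) ≡ length (ms₂ ++ ms₁)
    leneq = trans (length-++ ms₁) (trans (+-comm (length ms₁) _) (sym (length-++ ms₂)))

  ++-swap-∈ : ∀ (ms₁ ms₂ : List V) → (ms₂ ++ ms₁) ⊆ (ms₁ ++ ms₂)
  ++-swap-∈ ms₁ ms₂ x∈ with ∈-++⁻ ms₂ x∈
  ... | inj₁ x∈₂ = ∈-++⁺ʳ ms₁ x∈₂
  ... | inj₂ x∈₁ = ∈-++⁺ˡ x∈₁

  rotate-to : ∀ {R s ms x} → Tour R s ms → x ∈ ms →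
    ∃[ ms′ ] Tour R x ms′ × len x ms′ ≡ len s ms × ms′ ⊆ ms
  rotate-to {R} {s} {x = x} B x∈ with ∈-split x∈
  ... | ys , zs , refl with subst (Tour R s) (sym (++-assoc ys [ x ] zs)) B
  ... | B′ with walk-split (ys ++ [ x ]) (walk B′)
  ... | m , p₁ , p₂ with walk-snoc⁻ ys p₁
  ... | refl with rotate (ys ++ [ x ]) zs B′ p₁ p₂
  ... | B″ , eq = zs ++ (ys ++ [ x ]) , B″ , trans eq (cong (len s) (++-assoc ys [ x ] zs)) ,
                  λ z∈ → subst (_ ∈_) (++-assoc ys [ x ] zs) (++-swap-∈ (ys ++ [ x ]) zs z∈)

  close : ∀ {a ms b} → Walk Adj a ms b → Unique (a ∷ ms) → Adj b a → 2 ≤ length ms →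
    Tour Adj a (ms ++ [ a ]) × len a (ms ++ [ a ]) ≡ len a ms + wt b a
  close {a} {ms} {b} p u e 2≤ =
    tour (walk-++ p (cons e nil)) (Unique-++-comm [ a ] u) (subst (3 ≤_) leneq (s≤s 2≤)) ,
    trans (len-++ [ a ] p) (cong (len a ms +_) (+-identityʳ _))
    where
    leneq : suc (length ms) ≡ length (ms ++ [ a ])
    leneq = trans (+-comm 1 _) (sym (length-++ ms))

-- Growing a forest by ears

module Forest (I : Instance) where
  open Base I

  -- Vertices are listed newest first and a parent is always older, so the newest vertex has no
  -- child: structural induction strips a leaf or an isolated root.
  data Tree : List V → Set where
    empty : Tree []
    root  : ∀ v {vs} → v ∉ vs → Tree vs → Tree (v ∷ vs)
    child : ∀ v p {vs} → v ∉ vs → p ∈ vs → Adj v p → Tree vs → Tree (v ∷ vs)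

  TreeEdge : ∀ {vs} → Tree vs → V → V → Set
  TreeEdge empty               a b = ⊥
  TreeEdge (root _ _ T)        a b = TreeEdge T a b
  TreeEdge (child v p _ _ _ T) a b = (a ≡ v × b ≡ p) ⊎ (a ≡ p × b ≡ v) ⊎ TreeEdge T a b

  total : ∀ {vs} → Tree vs → ℕ
  total empty               = 0
  total (root _ _ T)        = total T
  total (child v p _ _ _ T) = wt v p + total T

  roots : ∀ {vs} → Tree vs → ℕ
  roots empty               = 0
  roots (root _ _ T)        = suc (roots T)
  roots (child _ _ _ _ _ T) = roots T

  children : ∀ {vs} → Tree vs → V → ℕ
  children empty               u = 0
  children (root _ _ T)        u = children T u
  children (child v p _ _ _ T) u = bit (p ≟ᵛ u) + children T u

  bit-yes : ∀ {P : Set} (d : Dec P) → P → bit d ≡ 1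
  bit-yes (yes _) _ = refl
  bit-yes (no ¬p) p = contradiction p ¬p

  bit-no : ∀ {P : Set} (d : Dec P) → ¬ P → bit d ≡ 0
  bit-no (yes p) ¬p = contradiction p ¬p
  bit-no (no _)  _  = refl

  bit≤1 : ∀ {P : Set} (d : Dec P) → bit d ≤ 1
  bit≤1 (yes _) = ≤-refl
  bit≤1 (no _)  = z≤n

  treeEdge? : ∀ {vs} (T : Tree vs) a b → Dec (TreeEdge T a b)
  treeEdge? empty               a b = no id
  treeEdge? (root _ _ T)        a b = treeEdge? T a b
  treeEdge? (child v p _ _ _ T) a b =
    (a ≟ᵛ v ×-dec b ≟ᵛ p) ⊎-dec ((a ≟ᵛ p ×-dec b ≟ᵛ v) ⊎-dec treeEdge? T a b)

  treeEdge-sym : ∀ {vs} (T : Tree vs) {a b} → TreeEdge T a b → TreeEdge T b a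
  treeEdge-sym (root _ _ T)        e                  = treeEdge-sym T e
  treeEdge-sym (child _ _ _ _ _ T) (inj₁ (p , q))     = inj₂ (inj₁ (q , p))
  treeEdge-sym (child _ _ _ _ _ T) (inj₂ (inj₁ (p , q))) = inj₁ (q , p)
  treeEdge-sym (child _ _ _ _ _ T) (inj₂ (inj₂ e))    = inj₂ (inj₂ (treeEdge-sym T e))

  treeEdge-adj : ∀ {vs} (T : Tree vs) {a b} → TreeEdge T a b → Adj a b
  treeEdge-adj (root _ _ T)        e                           = treeEdge-adj T e
  treeEdge-adj (child _ _ _ _ e T) (inj₁ (refl , refl))        = e
  treeEdge-adj (child _ _ _ _ e T) (inj₂ (inj₁ (refl , refl))) = adj-sym e
  treeEdge-adj (child _ _ _ _ _ T) (inj₂ (inj₂ e))             = treeEdge-adj T e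

  treeEdge-∈ʳ : ∀ {vs} (T : Tree vs) {a b} → TreeEdge T a b → b ∈ vs
  treeEdge-∈ʳ (root _ _ T)         e                           = there (treeEdge-∈ʳ T e)
  treeEdge-∈ʳ (child _ _ _ p∈ _ T) (inj₁ (refl , refl))        = there p∈
  treeEdge-∈ʳ (child _ _ _ p∈ _ T) (inj₂ (inj₁ (refl , refl))) = here refl
  treeEdge-∈ʳ (child _ _ _ _ _ T)  (inj₂ (inj₂ e))             = there (treeEdge-∈ʳ T e)

  treeEdge-∈ˡ : ∀ {vs} (T : Tree vs) {a b} → TreeEdge T a b → a ∈ vs
  treeEdge-∈ˡ T e = treeEdge-∈ʳ T (treeEdge-sym T e)

  children-∉ : ∀ {vs} (T : Tree vs) {u} → u ∉ vs → children T u ≡ 0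
  children-∉ empty                u∉ = refl
  children-∉ (root _ _ T)         u∉ = children-∉ T (u∉ ∘ there)
  children-∉ (child v p _ p∈ _ T) {u} u∉ =
    cong₂ _+_ (bit-no (p ≟ᵛ u) λ { refl → u∉ (there p∈) }) (children-∉ T (u∉ ∘ there))

  -- At the most recently inserted vertex of a tour of tree edges, both neighbours would be its parent.
  acyclic : ∀ {vs} (T : Tree vs) {s ms} → ¬ Tour (TreeEdge T) s ms
  acyclic empty (tour (cons () _) _ _)
  acyclic (root _ _ T) (tour p u l) = acyclic T (tour p u l)
  acyclic T₀@(child v p v∉ p∈ e T) {s} {ms} B with v ∈? ms
  ... | no v∉ms = acyclic T (tour (restrict (walk B) (λ { refl → v∉ms (tour-start B) }) v∉ms) (unique B) (long B))
    where
    restrict : ∀ {a ns b} → Walk (TreeEdge T₀) a ns b → a ≢ v → v ∉ ns → Walk (TreeEdge T) a ns b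
    restrict nil _ _ = nil
    restrict (cons (inj₁ (refl , _)) _)        a≢v _  = contradiction refl a≢v
    restrict (cons (inj₂ (inj₁ (_ , refl))) _) _   v∉ = contradiction (here refl) v∉
    restrict (cons (inj₂ (inj₂ r)) q)          _   v∉ = cons r (restrict q (λ { refl → v∉ (here refl) }) (v∉ ∘ there))
  ... | yes v∈ with rotate-to B v∈
  ...   | _ , tour (cons r q) u l , _ = impossible (cons r q) u l
    where
    parent : ∀ {y} → TreeEdge T₀ v y → y ≡ p
    parent (inj₁ (_ , eq))            = eq
    parent (inj₂ (inj₁ (refl , _)))   = contradiction p∈ v∉
    parent (inj₂ (inj₂ r))            = contradiction (treeEdge-∈ˡ T r) v∉
    impossible : ∀ {x ns} → Walk (TreeEdge T₀) v (x ∷ ns) v → Unique (x ∷ ns) → 3 ≤ length (x ∷ ns) → ⊥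
    impossible q@(cons r _) u l with walk-unsnoc q
    ... | [] , y , refl , q′ , r′ = contradiction l λ { (s≤s ()) }
    ... | _ ∷ [] , y , refl , q′ , r′ = contradiction l λ { (s≤s (s≤s ())) }
    ... | x ∷ z ∷ ys , y , refl , cons _ q′ , r′ = Unique-∉ u
            (subst (_∈ z ∷ ys ++ [ v ]) (trans (parent (treeEdge-sym T₀ r′)) (sym (parent r))) (∈-++⁺ˡ (walk-last⁺ q′)))

  -- `d` counts the ends of extra edges. `degrees` already charges `tip′` one unit for the extra
  -- edge that will leave the end of the path, and `tip-edge` serves to show that this extra edge is
  -- not a tree edge.
  record Extension {vs} (T : Tree vs) (tip : V) (P : List V) (tip′ : V) (d cap : V → ℕ) : Set where
    field
      {vs′}    : List V
      T′       : Tree vs′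
      vs⊆      : vs ⊆ vs′
      P⊆       : P ⊆ vs′
      tip′∈    : tip′ ∈ vs′
      total-≡  : total T′ ≡ total T + len tip P
      roots-≡  : roots T′ ≡ roots T
      degrees  : ∀ u → d u + (children T′ u + bit (tip′ ≟ᵛ u)) ≤ cap u
      old-edge : ∀ {a b} → a ∈ vs → b ∈ vs → TreeEdge T′ a b → TreeEdge T a b
      tip-edge : ∀ {y} → y ∈ vs → TreeEdge T′ tip′ y → (P ≡ [] × TreeEdge T tip′ y) ⊎ (P ≡ [ tip′ ] × y ≡ tip)

  -- The unit charged to `tip` becomes its new child when the next vertex is attached, and that
  -- vertex is charged in turn. New vertices carry no other load, so a capacity of 1 is enough for
  -- them.
  extend : ∀ {vs} (T : Tree vs) {tip P tip′} → tip ∈ vs → Walk Adj tip P tip′ → Unique P → All (_∉ vs) P →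
    (d cap : V → ℕ) → All (λ v → d v ≡ 0) P → (∀ u → 1 ≤ cap u) →
    (∀ u → d u + (children T u + bit (tip ≟ᵛ u)) ≤ cap u) → Extension T tip P tip′ d cap
  extend T tip∈ nil _ _ d cap _ _ deg = record
    { T′ = T ; vs⊆ = id ; P⊆ = λ () ; tip′∈ = tip∈ ; total-≡ = sym (+-identityʳ _) ; roots-≡ = refl
    ; degrees = deg ; old-edge = λ _ _ e → e ; tip-edge = λ _ e → inj₁ (refl , e) }
  extend {vs} T {tip} {v ∷ P} {tip′} tip∈ (cons e p) (v≢ ∷ u) (v∉ ∷ ∉s) d cap (dv≡0 ∷ d≡0) cap≥1 deg = record
    { T′ = X.T′ ; vs⊆ = X.vs⊆ ∘ there
    ; P⊆ = λ { (here refl) → X.vs⊆ (here refl) ; (there x∈) → X.P⊆ x∈ }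
    ; tip′∈ = X.tip′∈
    ; total-≡ = trans X.total-≡ total-eq
    ; roots-≡ = X.roots-≡ ; degrees = X.degrees
    ; old-edge = λ a∈ b∈ e → old a∈ b∈ (X.old-edge (there a∈) (there b∈) e)
    ; tip-edge = tip-edge′ }
    where
    T₁ = child v tip v∉ tip∈ (adj-sym e) T
    deg₁ : ∀ u → d u + (children T₁ u + bit (v ≟ᵛ u)) ≤ cap u
    deg₁ u with v ≟ᵛ u
    ... | yes refl rewrite dv≡0 | bit-no (tip ≟ᵛ v) (λ { refl → v∉ tip∈ }) | children-∉ T v∉ = cap≥1 v
    ... | no _ = subst (λ z → d u + z ≤ cap u) (trans (+-comm (children T u) _) (sym (+-identityʳ _))) (deg u)
    rest : Extension T₁ v P tip′ d cap
    rest = extend T₁ (here refl) p u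
             (All.zipWith (λ { (v≢x , x∉) → λ { (here refl) → v≢x refl ; (there x∈) → x∉ x∈ } }) (v≢ , ∉s))
             d cap d≡0 cap≥1 deg₁
    module X = Extension rest
    total-eq : wt v tip + total T + len v P ≡ total T + (wt tip v + len v P)
    total-eq = trans (cong (_+ len v P) (trans (+-comm (wt v tip) _) (cong (total T +_) (wt-sym v tip))))
                     (+-assoc (total T) (wt tip v) (len v P))
    old : ∀ {a b} → a ∈ vs → b ∈ vs → TreeEdge T₁ a b → TreeEdge T a b
    old a∈ b∈ (inj₁ (refl , _))        = contradiction a∈ v∉
    old a∈ b∈ (inj₂ (inj₁ (_ , refl))) = contradiction b∈ v∉
    old a∈ b∈ (inj₂ (inj₂ e))          = e
    one-step : ∀ {x P} → Walk Adj x P tip′ → P ≡ [] → x ≡ tip′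
    one-step nil refl = refl
    tip-edge′ : ∀ {y} → y ∈ vs → TreeEdge X.T′ tip′ y →
      (v ∷ P ≡ [] × TreeEdge T tip′ y) ⊎ (v ∷ P ≡ [ tip′ ] × y ≡ tip)
    tip-edge′ y∈ e′ with X.tip-edge (there y∈) e′
    ... | inj₂ (_ , refl)                       = contradiction y∈ v∉
    ... | inj₁ (P≡ , inj₁ (_ , eq))             = inj₂ (cong₂ _∷_ (one-step p P≡) P≡ , eq)
    ... | inj₁ (P≡ , inj₂ (inj₁ (_ , refl)))    = contradiction y∈ v∉
    ... | inj₁ (P≡ , inj₂ (inj₂ e″))            =
            contradiction (subst (_∈ vs) (sym (one-step p P≡)) (treeEdge-∈ˡ T e″)) v∉

  cnt : List V → V → ℕ
  cnt []      u = 0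
  cnt (x ∷ l) u = bit (x ≟ᵛ u) + cnt l u

  cnt-∉ : ∀ {l u} → u ∉ l → cnt l u ≡ 0
  cnt-∉ {[]}        u∉ = refl
  cnt-∉ {x ∷ l} {u} u∉ = cong₂ _+_ (bit-no (x ≟ᵛ u) λ { refl → u∉ (here refl) }) (cnt-∉ (u∉ ∘ there))

  ends : List (V × V) → List V
  ends []            = []
  ends ((a , b) ∷ E) = a ∷ b ∷ ends E

  -- The part before the first return to `vs`. In `ear` it is the path attached to the forest, in
  -- `detour` the part of a competing walk that leaves the given path.
  split-at : ∀ {R : V → V → Set} {vs s x ms t} → Walk R s (x ∷ ms) t → t ∈ vs →
    ∃[ P ] ∃[ b ] ∃[ rest ] ∃[ tip ] x ∷ ms ≡ P ++ b ∷ rest × All (_∉ vs) P × b ∈ vs ×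
      Walk R s P tip × R tip b × Walk R b rest t
  split-at {vs = vs} {x = x} (cons r p) t∈ with x ∈? vs
  ... | yes x∈ = [] , x , _ , _ , refl , [] , x∈ , nil , r , p
  ... | no x∉ with p
  ...   | nil = contradiction t∈ x∉
  ...   | p′@(cons _ _) with split-at p′ t∈
  ...     | P , b , rest , tip , eq , ∉s , b∈ , q , r′ , q′ =
            x ∷ P , b , rest , tip , cong (x ∷_) eq , x∉ ∷ ∉s , b∈ , cons r q , r′ , q′

  -- Up to its first non-tree edge a walk from the forest runs along tree edges and so stays in
  -- `vs`; hence an ear can start at `u`. For a tour the first alternative contradicts `acyclic`.
  scan : ∀ {vs} (T : Tree vs) {s ms t} → s ∈ vs → Walk Adj s ms t →
    Walk (TreeEdge T) s ms t ⊎
    (∃[ m₁ ] ∃[ y ] ∃[ m₂ ] ∃[ u ] ms ≡ m₁ ++ y ∷ m₂ × u ∈ vs × ¬ TreeEdge T u y × Walk Adj s m₁ u × Walk Adj u (y ∷ m₂) t)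
  scan T s∈ nil = inj₁ nil
  scan T {s} s∈ (cons {x = x} r p) with treeEdge? T s x
  ... | no ¬e = inj₂ ([] , x , _ , s , refl , s∈ , ¬e , nil , cons r p)
  ... | yes e with scan T (treeEdge-∈ʳ T e) p
  ...   | inj₁ q = inj₁ (cons e q)
  ...   | inj₂ (m₁ , y , m₂ , u , refl , u∈ , ¬e , q₁ , q₂) =
            inj₂ (x ∷ m₁ , y , m₂ , u , refl , u∈ , ¬e , cons r q₁ , q₂)

module Growth (I : Instance) (L : ℕ) where
  open Base I
  open Forest I

  -- Each of the m ears attaches a path to the forest T, and its last edge is listed in E.
  -- X lists the vertices to which ears have been attached.
  record Core (m r : ℕ) : Set where
    field
      {vs}    : List V
      T       : Tree vs
      X       : List V
      E       : List (V × V)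
      X-size  : length X ≤ m + m
      E-size  : length E ≡ m
      total≤  : total T ≤ m * L
      roots≤  : roots T ≤ r
      E-edge  : All (λ (a , b) → Adj a b × a ∈ vs × b ∈ vs × ¬ TreeEdge T a b × wt a b ≤ L) E
      E-uniq  : Unique (map proj₂ E)
      E-X     : All (λ e → proj₂ e ∈ X) E
      deg3    : ∀ u → cnt (ends E) u + children T u ≤ 3
      deg1    : ∀ u → u ∉ X → cnt (ends E) u + children T u ≤ 1

  emptyCore : Core 0 0
  emptyCore = record
    { T = empty ; X = [] ; E = [] ; X-size = z≤n ; E-size = refl ; total≤ = z≤n ; roots≤ = z≤n
    ; E-edge = [] ; E-uniq = [] ; E-X = [] ; deg3 = λ _ → z≤n ; deg1 = λ _ _ → z≤n }

  addRoot : ∀ {m r} (C : Core m r) s → s ∉ Core.vs C → Core m (suc r)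
  addRoot C s s∉ = record
    { T = root s s∉ C.T ; X = C.X ; E = C.E ; X-size = C.X-size ; E-size = C.E-size ; total≤ = C.total≤
    ; roots≤ = s≤s C.roots≤
    ; E-edge = All.map (λ { (e , a∈ , b∈ , ¬t , l) → e , there a∈ , there b∈ , ¬t , l }) C.E-edge
    ; E-uniq = C.E-uniq ; E-X = C.E-X ; deg3 = C.deg3 ; deg1 = C.deg1 }
    where module C = Core C

  ends-⊆ : ∀ {vs} {P Q : V → V → Set} {E} → All (λ (a , b) → P a b × a ∈ vs × b ∈ vs × Q a b) E → ends E ⊆ vs
  ends-⊆ ((_ , a∈ , _) ∷ _)     (here refl)         = a∈
  ends-⊆ ((_ , _ , b∈ , _) ∷ _) (there (here refl)) = b∈
  ends-⊆ (_ ∷ es)               (there (there x∈))  = ends-⊆ es x∈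

  -- The decomposition of the tour is exported because a tour that misses the old forest can return
  -- only to its own new root, so that the ear covers all of it.
  record Ear {m r} (C : Core m r) (ms : List V) : Set where
    field
      C′    : Core (suc m) r
      vs⊆   : Core.vs C ⊆ Core.vs C′
      {P}   : List V
      {b}   : V
      {rest} : List V
      ms-≡  : ms ≡ P ++ b ∷ rest
      P⊆    : P ⊆ Core.vs C′
      b∈    : b ∈ Core.vs C

  allowance : ∀ {P : Set} → Dec P → ℕ
  allowance (yes _) = 3
  allowance (no _)  = 1

  allowance-yes : ∀ {P : Set} (d : Dec P) → P → allowance d ≡ 3
  allowance-yes (yes _) _ = refl
  allowance-yes (no ¬p) p = contradiction p ¬p

  allowance-no : ∀ {P : Set} (d : Dec P) → ¬ P → allowance d ≡ 1
  allowance-no (yes p) ¬p = contradiction p ¬p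
  allowance-no (no _)  _  = refl

  allowance≤3 : ∀ {P : Set} (d : Dec P) → allowance d ≤ 3
  allowance≤3 (yes _) = ≤-refl
  allowance≤3 (no _)  = s≤s z≤n

  allowance≥1 : ∀ {P : Set} (d : Dec P) → 1 ≤ allowance d
  allowance≥1 (yes _) = s≤s z≤n
  allowance≥1 (no _)  = s≤s z≤n

  abstract
   -- The tour avoids `X`, so `u₀` and `b` have load at most 1 and gain at most 2, even if they
   -- coincide. Both then enter `X` and are never chosen as ends again, which keeps all loads at
   -- most 3. The inner vertices of the ear have load 1 and stay available.
   ear : ∀ {m r} (C : Core m r) {u y ms} → Tour Adj u (y ∷ ms) → u ∈ Core.vs C →
     ¬ TreeEdge (Core.T C) u y → All (_∉ Core.X C) (y ∷ ms) → len u (y ∷ ms) ≤ L → Ear C (y ∷ ms)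
   ear {m} {r} C {u₀} {y} {ms} B u∈ ¬e av len≤ with split-at (walk B) u∈
   ... | P , b , rest , tip , ms≡ , P∉ , b∈ , p , e , q = record
     { C′ = record
       { T = T′ ; X = u₀ ∷ b ∷ C.X ; E = (tip , b) ∷ C.E
       ; X-size = subst (2 + length C.X ≤_) (cong suc (sym (+-suc m m))) (s≤s (s≤s C.X-size)) ; E-size = cong suc C.E-size
       ; total≤ = subst (_≤ L + m * L) (sym total-≡)
                    (≤-trans (+-mono-≤ C.total≤ lenP) (≤-reflexive (+-comm (m * L) L)))
       ; roots≤ = subst (_≤ r) (sym roots-≡) C.roots≤
       ; E-edge = (e , tip′∈ , vs⊆ b∈ , new-edge , wt≤) ∷
                  All.map (λ { (e , a∈ , b∈ , ¬t , l) → e , vs⊆ a∈ , vs⊆ b∈ , (λ t → ¬t (old-edge a∈ b∈ t)) , l }) C.E-edge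
       -- The heads of earlier extra edges all lie in `X`, which the tour avoids. Distinct heads
       -- later keep two parallel extra edges from closing a degenerate cycle.
       ; E-uniq = ∉-Unique (λ b∈E → b∉X (b∈X b∈E)) C.E-uniq
       ; E-X = there (here refl) ∷ All.map (there ∘ there) C.E-X
       ; deg3 = λ u → subst (_≤ 3) (deg-eq u) (≤-trans (degrees u) (cap≤3 u))
       ; deg1 = λ u u∉ → subst (_≤ 1) (deg-eq u) (≤-trans (degrees u) (≤-reflexive (cap-∉ u u∉)))
       }
     ; vs⊆ = vs⊆ ; ms-≡ = ms≡ ; P⊆ = P⊆ ; b∈ = b∈ }
     where
     module C = Core C
     uniq : Unique (P ++ b ∷ rest)
     uniq = subst Unique ms≡ (unique B)
     ∉X : ∀ {z} → z ∈ y ∷ ms → z ∉ C.X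
     ∉X = All.lookup av
     b∉X : b ∉ C.X
     b∉X = ∉X (subst (b ∈_) (sym ms≡) (∈-++⁺ʳ P (here refl)))
     u∉X : u₀ ∉ C.X
     u∉X = ∉X (tour-start B)
     b∈X : b ∈ map proj₂ C.E → b ∈ C.X
     b∈X b∈ with ∈-map⁻ proj₂ b∈
     ... | _ , e∈ , refl = All.lookup C.E-X e∈
     d cap : V → ℕ
     d u = cnt (b ∷ ends C.E) u
     cap u = allowance (u ∈? (u₀ ∷ b ∷ C.X))
     cap-∈ : ∀ u → u ∈ u₀ ∷ b ∷ C.X → cap u ≡ 3
     cap-∈ u = allowance-yes (u ∈? (u₀ ∷ b ∷ C.X))
     cap-∉ : ∀ u → u ∉ u₀ ∷ b ∷ C.X → cap u ≡ 1
     cap-∉ u = allowance-no (u ∈? (u₀ ∷ b ∷ C.X))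
     cap≤3 : ∀ u → cap u ≤ 3
     cap≤3 u = allowance≤3 (u ∈? (u₀ ∷ b ∷ C.X))
     cap≥1 : ∀ u → 1 ≤ cap u
     cap≥1 u = allowance≥1 (u ∈? (u₀ ∷ b ∷ C.X))
     deg₀ : ∀ u → d u + (children C.T u + bit (u₀ ≟ᵛ u)) ≤ cap u
     deg₀ u = subst (_≤ cap u) (sym (reorder (bit (b ≟ᵛ u)) (cnt (ends C.E) u) (children C.T u) (bit (u₀ ≟ᵛ u)))) bound
       where
       reorder : ∀ x c t z → x + c + (t + z) ≡ c + t + (x + z)
       reorder = solve-∀
       bound : cnt (ends C.E) u + children C.T u + (bit (b ≟ᵛ u) + bit (u₀ ≟ᵛ u)) ≤ cap u
       D : ℕ
       D = cnt (ends C.E) u + children C.T u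
       untouched : u ≢ b → u ≢ u₀ → D + (bit (b ≟ᵛ u) + bit (u₀ ≟ᵛ u)) ≡ D
       untouched b≢ u≢ = trans (cong (D +_) (cong₂ _+_ (bit-no (b ≟ᵛ u) (b≢ ∘ sym)) (bit-no (u₀ ≟ᵛ u) (u≢ ∘ sym)))) (+-identityʳ D)
       touched : u ∈ u₀ ∷ b ∷ C.X → u ∉ C.X → D + (bit (b ≟ᵛ u) + bit (u₀ ≟ᵛ u)) ≤ cap u
       touched u∈ u∉ = ≤-trans (+-mono-≤ (C.deg1 u u∉) (+-mono-≤ (bit≤1 (b ≟ᵛ u)) (bit≤1 (u₀ ≟ᵛ u)))) (≤-reflexive (sym (cap-∈ u u∈)))
       bound = case u ∈? C.X of λ
         { (yes u∈) → subst₂ _≤_ (sym (untouched (λ { refl → b∉X u∈ }) (λ { refl → u∉X u∈ }))) (sym (cap-∈ u (there (there u∈)))) (C.deg3 u)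
         ; (no u∉) → case u ≟ᵛ b of λ
           { (yes u≡b) → touched (there (here u≡b)) u∉
           ; (no u≢b) → case u ≟ᵛ u₀ of λ
             { (yes u≡u₀) → touched (here u≡u₀) u∉
             ; (no u≢u₀) → subst₂ _≤_ (sym (untouched u≢b u≢u₀))
                 (sym (cap-∉ u λ { (here eq) → u≢u₀ eq ; (there (here eq)) → u≢b eq ; (there (there u∈)) → u∉ u∈ })) (C.deg1 u u∉) } } }
     d≡0 : All (λ v → d v ≡ 0) P
     d≡0 = All.map (λ { {v} v∉ → cong₂ _+_ (bit-no (b ≟ᵛ v) λ { refl → v∉ b∈ }) (cnt-∉ (v∉ ∘ ends-⊆ C.E-edge)) }) P∉
     open Extension (extend C.T u∈ p (proj₁ (AllPairs-++⁻ P uniq)) P∉ d cap d≡0 cap≥1 deg₀)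
     lenEq : len u₀ P + (wt tip b + len b rest) ≡ len u₀ (y ∷ ms)
     lenEq = trans (sym (len-++ (b ∷ rest) p)) (cong (len u₀) (sym ms≡))
     lenP : len u₀ P ≤ L
     lenP = ≤-trans (≤-trans (m≤m+n _ _) (≤-reflexive lenEq)) len≤
     wt≤ : wt tip b ≤ L
     wt≤ = ≤-trans (≤-trans (≤-trans (m≤m+n (wt tip b) (len b rest)) (m≤n+m _ (len u₀ P))) (≤-reflexive lenEq)) len≤
     deg-eq : ∀ u → d u + (children T′ u + bit (tip ≟ᵛ u)) ≡ cnt (tip ∷ b ∷ ends C.E) u + children T′ u
     deg-eq u = trans (sym (+-assoc (d u) _ _)) (trans (+-comm _ (bit (tip ≟ᵛ u))) (sym (+-assoc (bit (tip ≟ᵛ u)) (d u) _)))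
     -- A tree edge from `tip` to the old forest would be the edge from `u₀` to `y`, which is
     -- excluded, or would lead back to `u₀` after a single new vertex, and then the tour would have
     -- only two vertices.
     new-edge : ¬ TreeEdge T′ tip b
     new-edge t = no-edge p ms≡ (tip-edge b∈ t)
       where
       no-edge : ∀ {P} → Walk Adj u₀ P tip → y ∷ ms ≡ P ++ b ∷ rest →
         (P ≡ [] × TreeEdge C.T tip b) ⊎ (P ≡ [ tip ] × b ≡ u₀) → ⊥
       no-edge nil refl (inj₁ (refl , t′)) = ¬e t′
       no-edge _   refl (inj₂ (refl , refl)) = short q (unique B) (long B)
         where
         short : ∀ {rest} → Walk Adj b rest u₀ → Unique (tip ∷ b ∷ rest) → 3 ≤ length (tip ∷ b ∷ rest) → ⊥
         short nil          _ (s≤s (s≤s ()))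
         short q@(cons _ _) u _ = Unique-last [ tip ] u (walk-last⁺ q)

  ShortTour : ℕ → Set
  ShortTour D = Σ[ s ∈ V ] Σ[ ms ∈ List V ] Tour Adj s ms × len s ms ≤ D

  moves : ∀ {D} → ShortTour D → List V
  moves (_ , ms , _) = ms

  DisjointTours : ∀ {D} → List (ShortTour D) → Set
  DisjointTours = AllPairs λ A B → Disjoint (moves A) (moves B)

  -- A root is created only for a tour that misses the forest, and the forest then swallows this
  -- tour. Hence these tours are pairwise disjoint, and without `k` disjoint short cycles there are
  -- fewer than `k` roots.
  record Grown (m : ℕ) : Set where
    field
      fresh    : List (ShortTour L)
      disjoint : DisjointTours fresh
      few      : length fresh < k
      core     : Core m (length fresh)
      covered  : All (λ B → All (_∈ Core.vs core) (moves B)) fresh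

  step : (∀ (F : List (ShortTour L)) → DisjointTours F → length F ≢ k) → ∀ {m} (S : Grown m) {s ms} →
    Tour Adj s ms → All (_∉ Core.X (Grown.core S)) ms → len s ms ≤ L → Grown (suc m)
  step noPack {m} S {s} {ms} B av len≤ with any? (_∈? Core.vs (Grown.core S)) ms
  ... | yes hit = touching (find hit)
    where
    module S = Grown S
    module C = Core S.core
    touching : ∃[ z ] (z ∈ ms × z ∈ C.vs) → Grown (suc m)
    touching (z , z∈ms , z∈vs) with rotate-to B z∈ms
    ... | ms′ , B′ , len≡ , ⊆ms with scan C.T z∈vs (walk B′)
    ...   | inj₁ p = contradiction (tour p (unique B′) (long B′)) (acyclic C.T)
    ...   | inj₂ (m₁ , y , m₂ , u , refl , u∈ , ¬e , p₁ , p₂) with rotate m₁ (y ∷ m₂) B′ p₁ p₂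
    ...     | B″ , len≡′ = record
      { fresh = S.fresh ; disjoint = S.disjoint ; few = S.few ; core = Ear.C′ A
      ; covered = All.map (All.map (Ear.vs⊆ A)) S.covered }
      where
      A : Ear S.core (y ∷ m₂ ++ m₁)
      A = ear S.core B″ u∈ ¬e (All.tabulate λ x∈ → All.lookup av (⊆ms (++-swap-∈ m₁ (y ∷ m₂) x∈)))
              (≤-trans (≤-reflexive (trans len≡′ len≡)) len≤)
  step noPack {m} S {s} {[]} B av len≤ | no miss = contradiction (long B) λ ()
  step noPack {m} S {s} {y ∷ ms} B av len≤ | no miss = record
    { fresh = S.fresh′ ; disjoint = disjoint′ ; few = ≤∧≢⇒< S.few (noPack S.fresh′ disjoint′) ; core = Ear.C′ A
    ; covered = All.tabulate ms⊆ ∷ All.map (All.map (λ x∈ → Ear.vs⊆ A (there x∈))) S.covered }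
    where
    module S where
      open Grown S public
      fresh′ : List (ShortTour L)
      fresh′ = (s , y ∷ ms , B , len≤) ∷ fresh
    module C = Core S.core
    outside : ∀ {z} → z ∈ y ∷ ms → z ∉ C.vs
    outside z∈ms z∈vs = miss (lose z∈ms z∈vs)
    disjoint′ : DisjointTours S.fresh′
    disjoint′ = All.map (λ ⊆vs → λ { (z∈ , z∈′) → outside z∈ (All.lookup ⊆vs z∈′) }) S.covered ∷ S.disjoint
    s∉ : s ∉ C.vs
    s∉ = outside (tour-start B)
    A : Ear (addRoot S.core s s∉) (y ∷ ms)
    A = ear (addRoot S.core s s∉) B (here refl) (λ e → s∉ (treeEdge-∈ˡ C.T e)) av len≤
    module A = Ear A
    -- All of the tour lies outside the old forest, so `b` is the new root `s`; as `s` is the last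
    -- move, nothing follows it.
    covers : ∀ {P b rest} → b ∈ s ∷ C.vs → P ⊆ Core.vs A.C′ → y ∷ ms ≡ P ++ b ∷ rest → y ∷ ms ⊆ Core.vs A.C′
    covers (there b∈) P⊆ eq = contradiction b∈ (outside (subst (_ ∈_) (sym eq) (∈-++⁺ʳ _ (here refl))))
    covers {P} {b} {rest} (here refl) P⊆ eq with walk-split P (subst (λ l → Walk Adj s l s) eq (walk B))
    ... | _ , _ , cons _ q = λ x∈ → all-in (last-in q (subst Unique eq (unique B))) (subst (_ ∈_) eq x∈)
      where
      last-in : ∀ {rest} → Walk Adj s rest s → Unique (P ++ s ∷ rest) → rest ≡ []
      last-in nil          _ = refl
      last-in q@(cons _ _) u = contradiction (walk-last⁺ q) (Unique-last P u)
      all-in : rest ≡ [] → P ++ s ∷ rest ⊆ Core.vs A.C′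
      all-in refl x∈ with ∈-++⁻ P x∈
      ... | inj₁ x∈P         = P⊆ x∈P
      ... | inj₂ (here refl) = A.vs⊆ (here refl)
    ms⊆ : y ∷ ms ⊆ Core.vs A.C′
    ms⊆ = covers A.b∈ A.P⊆ A.ms-≡

  -- `noHit` only refutes that the vertices `X` used so far meet all short tours; the tour for the
  -- next ear therefore exists only under double negation. Two new entries of `X` per ear account
  -- for the size `N + N`.
  grow : (∀ (F : List (ShortTour L)) → DisjointTours F → length F ≢ k) → ∀ N →
    (∀ X → length X ≤ N + N → ¬ (∀ {s ms} → Tour Adj s ms → All (_∉ X) ms → L < len s ms)) →
    ∀ m → m ≤ N → ¬ ¬ Grown m
  grow noPack N noHit zero    _   κ = κ (record
    { fresh = [] ; disjoint = [] ; few = 1≤k ; core = emptyCore ; covered = [] })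
  grow noPack N noHit (suc m) m<N κ = grow noPack N noHit m (<⇒≤ m<N) λ S →
    noHit (Core.X (Grown.core S)) (≤-trans (Core.X-size (Grown.core S)) (+-mono-≤ (<⇒≤ m<N) (<⇒≤ m<N))) λ {s} {ms} B av →
      case len s ms ≤? L of λ
        { (yes len≤) → contradiction (step noPack S B av len≤) κ
        ; (no len≰)  → ≰⇒> len≰ }

-- Cutting a forest into pieces

module Decomposition (I : Instance) where
  open Base I
  open Forest I

  override : V → V → (V → V) → V → V
  override v y f u = if does (u ≟ᵛ v) then y else f u

  override-here : ∀ {v y} f → override v y f v ≡ y
  override-here {v} f with v ≟ᵛ v
  ... | yes _ = refl
  ... | no ≢v = contradiction refl ≢v

  override-there : ∀ {v y} f {u} → u ≢ v → override v y f u ≡ f u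
  override-there {v} f {u} u≢v with u ≟ᵛ v
  ... | yes u≡v = contradiction u≡v u≢v
  ... | no _    = refl

  remove : V → List V → List V
  remove v = filter (λ u → ¬? (u ≟ᵛ v))

  length-remove : ∀ v l → cnt l v + length (remove v l) ≡ length l
  length-remove v [] = refl
  length-remove v (x ∷ l) with x ≟ᵛ v
  ... | yes _ = cong suc (length-remove v l)
  ... | no _  = trans (+-suc (cnt l v) _) (cong suc (length-remove v l))

  cnt-remove : ∀ v l u → cnt (remove v l) u ≤ cnt l u
  cnt-remove v [] u = z≤n
  cnt-remove v (x ∷ l) u with x ≟ᵛ v
  ... | yes _ = ≤-trans (cnt-remove v l u) (m≤n+m _ (bit (x ≟ᵛ u)))
  ... | no _  = +-monoʳ-≤ (bit (x ≟ᵛ u)) (cnt-remove v l u)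

  remove-⊆ : ∀ {v vs l} → l ⊆ v ∷ vs → remove v l ⊆ vs
  remove-⊆ {v} {l = l} l⊆ u∈ with ∈-filter⁻ (λ u → ¬? (u ≟ᵛ v)) {xs = l} u∈
  ... | u∈l , u≢v with l⊆ u∈l
  ...   | here u≡v  = contradiction u≡v u≢v
  ...   | there u∈  = u∈

  cnt-override-≢ : ∀ {v x} f l → x ≢ v → cnt (map (override v v f) l) x ≡ cnt (map f (remove v l)) x
  cnt-override-≢ f [] x≢v = refl
  cnt-override-≢ {v} {x} f (u ∷ l) x≢v with u ≟ᵛ v
  ... | yes _ = cong₂ _+_ (bit-no (v ≟ᵛ x) (x≢v ∘ sym)) (cnt-override-≢ f l x≢v)
  ... | no _  = cong (bit (f u ≟ᵛ x) +_) (cnt-override-≢ f l x≢v)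

  cnt-override-≡ : ∀ {v} f l → (∀ {u} → u ∈ l → u ≢ v → f u ≢ v) → cnt (map (override v v f) l) v ≡ cnt l v
  cnt-override-≡ f [] f≢ = refl
  cnt-override-≡ {v} f (u ∷ l) f≢ with u ≟ᵛ v
  ... | yes _   = cong₂ _+_ (bit-yes (v ≟ᵛ v) refl) (cnt-override-≡ f l (f≢ ∘ there))
  ... | no u≢v  = cong₂ _+_ (bit-no (f u ≟ᵛ v) (f≢ (here refl) u≢v)) (cnt-override-≡ f l (f≢ ∘ there))

  cnt-push : ∀ v p l u → cnt (map (override v p id) l) u ≤ cnt l u + bit (p ≟ᵛ u) * cnt l v
  cnt-push v p [] u = z≤n
  cnt-push v p (x ∷ l) u with x ≟ᵛ v
  ... | yes _ = ≤-trans (+-monoʳ-≤ (bit (p ≟ᵛ u)) (cnt-push v p l u)) (≤-trans (≤-reflexive (eq (bit (p ≟ᵛ u)) (cnt l u) (cnt l v))) (+-monoˡ-≤ _ (m≤n+m _ (bit (x ≟ᵛ u)))))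
    where
    eq : ∀ b c d → b + (c + b * d) ≡ c + b * suc d
    eq = solve-∀
  ... | no _ = ≤-trans (+-monoʳ-≤ (bit (x ≟ᵛ u)) (cnt-push v p l u)) (≤-reflexive (sym (+-assoc (bit (x ≟ᵛ u)) _ _)))

  PieceEdge : ∀ {vs} → Tree vs → (V → V) → V → V → V → Set
  PieceEdge T label x a b = TreeEdge T a b × label a ≡ x × label b ≡ x

  -- label u is the oldest vertex of the piece of u; the tokens are the ends of the extra edges.
  record Pieces {vs} (T : Tree vs) (tokens : List V) (q : ℕ) : Set where
    field
      label   : V → V
      labels  : List V
      label∈  : ∀ {u} → u ∈ vs → label u ∈ labels
      labels⊆ : labels ⊆ vs
      climb   : ∀ {u} → u ∈ vs → ∃[ ms ] Walk (PieceEdge T label (label u)) u ms (label u) × len u ms ≤ total T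
      size    : ∀ x → cnt (map label tokens) x ≤ 3 * q
      few     : q * length labels ≤ length tokens + q * roots T

  -- Covers both occasions for a new piece, a root and a vertex holding at least `q` tokens. `few₀`
  -- records how the piece is paid for: by the root, or by the tokens that leave the count with it.
  cut : ∀ {vs v} {T : Tree vs} {tokens q} (T₁ : Tree (v ∷ vs)) → v ∉ vs → tokens ⊆ v ∷ vs →
    (∀ {a b} → TreeEdge T a b → TreeEdge T₁ a b) → total T ≤ total T₁ → cnt tokens v ≤ 3 * q →
    q + length (remove v tokens) + q * roots T ≤ length tokens + q * roots T₁ →
    Pieces T (remove v tokens) q → Pieces T₁ tokens q
  cut {vs} {v} {T} {tokens} {q} T₁ v∉ tokens⊆ edge total≤ size₀ few₀ P = record
    { label = label ; labels = v ∷ P.labels ; label∈ = label∈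
    ; labels⊆ = λ { (here refl) → here refl ; (there x∈) → there (P.labels⊆ x∈) }
    ; climb = climb ; size = size ; few = few }
    where
    module P = Pieces P
    label : V → V
    label = override v v P.label
    ≢v : ∀ {u} → u ∈ vs → u ≢ v
    ≢v u∈ refl = v∉ u∈
    same : ∀ {u} → u ∈ vs → label u ≡ P.label u
    same u∈ = override-there P.label (≢v u∈)
    label∈ : ∀ {u} → u ∈ v ∷ vs → label u ∈ v ∷ P.labels
    label∈ (here refl) = here (override-here P.label)
    label∈ (there u∈)  = there (subst (_∈ P.labels) (sym (same u∈)) (P.label∈ u∈))
    lift : ∀ {x a b} → PieceEdge T P.label x a b → PieceEdge T₁ label x a b
    lift (e , la , lb) = edge e , trans (same (treeEdge-∈ˡ T e)) la , trans (same (treeEdge-∈ʳ T e)) lb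
    climb : ∀ {u} → u ∈ v ∷ vs → ∃[ ms ] Walk (PieceEdge T₁ label (label u)) u ms (label u) × len u ms ≤ total T₁
    climb (here refl) = [] , subst (λ x → Walk (PieceEdge T₁ label x) v [] x) (sym (override-here P.label)) nil , z≤n
    climb {u} (there u∈) with P.climb u∈
    ... | ms , p , le = ms , subst (λ x → Walk (PieceEdge T₁ label x) u ms x) (sym (same u∈)) (walk-map lift p) , ≤-trans le total≤
    size : ∀ x → cnt (map label tokens) x ≤ 3 * q
    size x with x ≟ᵛ v
    ... | yes refl = subst (_≤ 3 * q) (sym (cnt-override-≡ P.label tokens λ u∈ u≢v eq →
            v∉ (subst (_∈ vs) eq (P.labels⊆ (P.label∈ (case tokens⊆ u∈ of λ { (here u≡v) → contradiction u≡v u≢v ; (there u∈) → u∈ })))))) size₀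
    ... | no x≢v = subst (_≤ 3 * q) (sym (cnt-override-≢ P.label tokens x≢v)) (P.size x)
    few : q * suc (length P.labels) ≤ length tokens + q * roots T₁
    few = ≤-trans (≤-reflexive (*-suc q _)) (≤-trans (+-monoʳ-≤ q P.few) (≤-trans (≤-reflexive (sym (+-assoc q _ _))) few₀))

  -- `v` inherits the label of its parent, so counting its tokens at the parent does not change the
  -- number of tokens in any piece.
  push : ∀ {vs v p} {T : Tree vs} {tokens q} v∉ p∈ e → total T ≤ total (child v p v∉ p∈ e T) →
    Pieces T (map (override v p id) tokens) q → Pieces (child v p v∉ p∈ e T) tokens q
  push {vs} {v} {p} {T} {tokens} {q} v∉ p∈ e total≤ P = record
    { label = label ; labels = P.labels ; label∈ = label∈ ; labels⊆ = there ∘ P.labels⊆ ; climb = climb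
    ; size = λ x → subst (λ l → cnt l x ≤ 3 * q) (sym eq) (P.size x)
    ; few = subst (λ l → q * length P.labels ≤ l + q * roots T) (length-map (override v p id) tokens) P.few }
    where
    module P = Pieces P
    T₁ = child v p v∉ p∈ e T
    label : V → V
    label = override v (P.label p) P.label
    same : ∀ {u} → u ∈ vs → label u ≡ P.label u
    same u∈ = override-there P.label λ { refl → v∉ u∈ }
    label∈ : ∀ {u} → u ∈ v ∷ vs → label u ∈ P.labels
    label∈ (here refl) = subst (_∈ P.labels) (sym (override-here P.label)) (P.label∈ p∈)
    label∈ (there u∈)  = subst (_∈ P.labels) (sym (same u∈)) (P.label∈ u∈)
    lift : ∀ {x a b} → PieceEdge T P.label x a b → PieceEdge T₁ label x a b
    lift (e , la , lb) = inj₂ (inj₂ e) , trans (same (treeEdge-∈ˡ T e)) la , trans (same (treeEdge-∈ʳ T e)) lb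
    climb : ∀ {u} → u ∈ v ∷ vs → ∃[ ms ] Walk (PieceEdge T₁ label (label u)) u ms (label u) × len u ms ≤ total T₁
    climb (here refl) with P.climb p∈
    ... | ms , r , le = p ∷ ms ,
      subst (λ x → Walk (PieceEdge T₁ label x) v (p ∷ ms) x) (sym (override-here P.label))
        (cons (inj₁ (refl , refl) , override-here P.label , same p∈) (walk-map lift r)) , +-monoʳ-≤ (wt v p) le
    climb {u} (there u∈) with P.climb u∈
    ... | ms , r , le = ms , subst (λ x → Walk (PieceEdge T₁ label x) u ms x) (sym (same u∈)) (walk-map lift r) , ≤-trans le total≤
    pointwise : ∀ u → label u ≡ P.label (override v p id u)
    pointwise u with u ≟ᵛ v
    ... | yes _ = refl
    ... | no _  = refl
    eq : map label tokens ≡ map P.label (map (override v p id) tokens)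
    eq = trans (map-cong pointwise tokens) (map-∘ tokens)

  -- From the newest vertex to the oldest: a vertex holding at least q tokens is cut off its parent,
  -- otherwise its tokens move to its parent.
  decompose : ∀ {vs} (T : Tree vs) tokens q → tokens ⊆ vs → (∀ u → cnt tokens u + q * children T u ≤ 3 * q) → Pieces T tokens q
  decompose empty tokens q tokens⊆ bound = record
    { label = id ; labels = [] ; label∈ = λ () ; labels⊆ = λ () ; climb = λ ()
    ; size = λ x → ≤-trans (≤-reflexive (cong (λ l → cnt l x) (none tokens tokens⊆))) z≤n
    ; few = ≤-trans (≤-reflexive (*-zeroʳ q)) z≤n }
    where
    none : ∀ l → l ⊆ [] → map id l ≡ []
    none [] _ = refl
    none (x ∷ l) l⊆ = contradiction (l⊆ (here refl)) λ ()
  decompose (root v v∉ T) tokens q tokens⊆ bound =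
    cut (root v v∉ T) v∉ tokens⊆ id ≤-refl (≤-trans (m≤m+n _ _) (bound v)) few₀
      (decompose T (remove v tokens) q (remove-⊆ tokens⊆) λ u → ≤-trans (+-monoˡ-≤ _ (cnt-remove v tokens u)) (bound u))
    where
    few₀ : q + length (remove v tokens) + q * roots T ≤ length tokens + q * suc (roots T)
    few₀ = ≤-trans (+-monoˡ-≤ (q * roots T) (+-monoʳ-≤ q (≤-trans (m≤n+m _ (cnt tokens v)) (≤-reflexive (length-remove v tokens)))))
                   (≤-reflexive (eq q (length tokens) (roots T)))
      where
      eq : ∀ q t r → q + t + q * r ≡ t + q * suc r
      eq = solve-∀
  decompose (child v p v∉ p∈ e T) tokens q tokens⊆ bound with q ≤? cnt tokens v
  ... | yes q≤ =
    cut (child v p v∉ p∈ e T) v∉ tokens⊆ (inj₂ ∘ inj₂) (m≤n+m _ (wt v p)) (≤-trans (m≤m+n _ _) (bound v)) few₀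
      (decompose T (remove v tokens) q (remove-⊆ tokens⊆) λ u →
        ≤-trans (+-mono-≤ (cnt-remove v tokens u) (*-monoʳ-≤ q (m≤n+m _ (bit (p ≟ᵛ u))))) (bound u))
    where
    few₀ : q + length (remove v tokens) + q * roots T ≤ length tokens + q * roots T
    few₀ = +-monoˡ-≤ (q * roots T) (≤-trans (+-monoˡ-≤ _ q≤) (≤-reflexive (length-remove v tokens)))
  ... | no q≰ = push v∉ p∈ e (m≤n+m _ (wt v p)) (decompose T (map (override v p id) tokens) q moved⊆ bound′)
    where
    moved⊆ : map (override v p id) tokens ⊆ _
    moved⊆ u∈ with ∈-map⁻ (override v p id) u∈
    ... | x , x∈ , refl with x ≟ᵛ v | tokens⊆ x∈
    ...   | yes _   | _           = p∈
    ...   | no x≢v  | here x≡v    = contradiction x≡v x≢v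
    ...   | no _    | there x∈vs  = x∈vs
    -- Each child still in the tree reserves `q` tokens that it may yet push to its parent; when `v`
    -- goes, its fewer than `q` tokens take the place of its reserve.
    bound′ : ∀ u → cnt (map (override v p id) tokens) u + q * children T u ≤ 3 * q
    bound′ u = begin
      cnt (map (override v p id) tokens) u + q * children T u
        ≤⟨ +-monoˡ-≤ _ (cnt-push v p tokens u) ⟩
      cnt tokens u + bit (p ≟ᵛ u) * cnt tokens v + q * children T u
        ≤⟨ +-monoˡ-≤ _ (+-monoʳ-≤ (cnt tokens u) (*-monoʳ-≤ (bit (p ≟ᵛ u)) (<⇒≤ (≰⇒> q≰)))) ⟩
      cnt tokens u + bit (p ≟ᵛ u) * q + q * children T u
        ≡⟨ eq (cnt tokens u) (bit (p ≟ᵛ u)) q (children T u) ⟩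
      cnt tokens u + q * (bit (p ≟ᵛ u) + children T u)
        ≤⟨ bound u ⟩
      3 * q ∎
      where
      open ≤-Reasoning
      eq : ∀ t b q c → t + b * q + q * c ≡ t + q * (b + c)
      eq = solve-∀

-- Disjoint cycles through repeated pairs of pieces

length-product : ∀ {A B : Set} (xs : List A) (ys : List B) → length (cartesianProduct xs ys) ≡ length xs * length ys
length-product []       ys = refl
length-product (x ∷ xs) ys = trans (length-++ (map (x ,_) ys)) (cong₂ _+_ (length-map (x ,_) ys) (length-product xs ys))

pigeonhole : ∀ {A B : Set} {R : A → A → Set} → (∀ (x y : B) → Dec (x ≡ y)) → (f : A → B) → ∀ (P : List B) {l} →
  All (λ a → f a ∈ P) l → AllPairs R l → length P < length l →
  ∃[ a ] ∃[ b ] a ∈ l × b ∈ l × R a b × f a ≡ f b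
pigeonhole _≟_ f P [] _ ()
pigeonhole {A} {B} {R} _≟_ f P {a ∷ l} (fa∈ ∷ f∈) (ra ∷ r) P< with any? (λ b → f a ≟ f b) l
... | yes hit with find hit
...   | b , b∈ , eq = a , b , here refl , there b∈ , All.lookup ra b∈ , eq
pigeonhole {A} {B} {R} _≟_ f P {a ∷ l} (fa∈ ∷ f∈) (ra ∷ r) P< | no miss with ∈-split fa∈
... | ys , zs , refl with pigeonhole _≟_ f (ys ++ zs) (All.tabulate λ {b} b∈ → shrink (All.lookup f∈ b∈) (λ eq → miss (lose b∈ (sym eq)))) r smaller
  where
  shrink : ∀ {y} → y ∈ ys ++ f a ∷ zs → y ≢ f a → y ∈ ys ++ zs
  shrink y∈ y≢ with ∈-++⁻ ys y∈
  ... | inj₁ y∈ys         = ∈-++⁺ˡ y∈ys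
  ... | inj₂ (here eq)    = contradiction eq y≢
  ... | inj₂ (there y∈zs) = ∈-++⁺ʳ ys y∈zs
  smaller : length (ys ++ zs) < length l
  smaller = s≤s⁻¹ (≤-trans (≤-reflexive (cong suc (trans (cong suc (length-++ ys)) (trans (sym (+-suc (length ys) (length zs))) (sym (length-++ ys)))))) P<)
... | x , y , x∈ , y∈ , rest = x , y , there x∈ , there y∈ , rest

module Hitting (I : Instance) (L D : ℕ) where
  open Base I
  open Forest I
  open Decomposition I
  open Growth I L

  module _ {m r q} (C : Core m r) (P : Pieces (Core.T C) (ends (Core.E C)) q)
           (D≥ : m * L + m * L + (m * L + m * L) + (L + L) ≤ D) where
    private
      module C = Core C
      module P = Pieces P

    Extra : V × V → Set
    Extra (a , b) = Adj a b × a ∈ C.vs × b ∈ C.vs × ¬ TreeEdge C.T a b × wt a b ≤ L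

    pieceEdge-sym : ∀ {x a b} → PieceEdge C.T P.label x a b → PieceEdge C.T P.label x b a
    pieceEdge-sym (e , la , lb) = treeEdge-sym C.T e , lb , la

    pieceEdge-adj : ∀ {x a b} → PieceEdge C.T P.label x a b → Adj a b
    pieceEdge-adj (e , _) = treeEdge-adj C.T e

    -- Climb from both ends to the oldest vertex of the piece and erase loops. Each climb weighs at
    -- most as much as the whole forest, that is `m * L`.
    connect : ∀ {a b} → a ∈ C.vs → b ∈ C.vs → P.label a ≡ P.label b →
      ∃[ ms ] Walk (PieceEdge C.T P.label (P.label a)) a ms b × Unique (a ∷ ms) × len a ms ≤ m * L + m * L
    connect {a} {b} a∈ b∈ eq with P.climb a∈ | P.climb b∈
    ... | as , p , ≤a | bs , p′ , ≤b with walk-reverse pieceEdge-sym p′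
    ... | bs′ , p″ , len≡ with simplify (walk-++ p (subst (λ x → Walk (PieceEdge C.T P.label x) x bs′ b) (sym eq) p″))
    ... | ms , q , u , le = ms , q , u , ≤-trans le (≤-trans (≤-reflexive (len-++ bs′ p))
            (+-mono-≤ (≤-trans ≤a C.total≤)
                      (≤-trans (≤-reflexive (trans (cong (λ x → len x bs′) eq) len≡)) (≤-trans ≤b C.total≤))))

    label-walk : ∀ {x a ms b} → Walk (PieceEdge C.T P.label x) a ms b → All (λ z → P.label z ≡ x) ms
    label-walk = walk-All λ (_ , _ , lb) → lb

    -- The extra edge is no tree edge, so the path that joins its ends inside the piece has at least
    -- two edges.
    innerTour : ∀ {a b} → Extra (a , b) → P.label a ≡ P.label b →
      Σ[ B ∈ ShortTour D ] All (λ z → P.label z ≡ P.label a) (moves B)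
    innerTour {a} {b} (e , a∈ , b∈ , ¬t , wt≤) eq with connect a∈ b∈ eq
    ... | ms , p , u , le with close (walk-map pieceEdge-adj p) u (adj-sym e) (long-enough p)
      where
      long-enough : ∀ {ms} → Walk (PieceEdge C.T P.label (P.label a)) a ms b → 2 ≤ length ms
      long-enough nil                   = contradiction e (adj-irrefl refl)
      long-enough (cons (t , _) nil)    = contradiction t ¬t
      long-enough (cons _ (cons _ _))   = s≤s (s≤s z≤n)
    ... | B , len≡ = (a , ms ++ [ a ] , B , ≤-trans (≤-reflexive len≡) bound) , All.++⁺ (label-walk p) (refl ∷ [])
      where
      bound : len a ms + wt b a ≤ D
      bound = ≤-trans (+-mono-≤ (≤-trans le (m≤m+n _ _)) (≤-trans (≤-reflexive (wt-sym b a)) (≤-trans wt≤ (m≤m+n _ _)))) D≥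

    -- One path in each piece and the two extra edges. The tails may coincide, but the heads differ,
    -- which gives at least three vertices; different labels keep the two paths apart. Two paths of
    -- `m * L + m * L` and two edges of `L` explain the bound `D`.
    outerTour : ∀ {a₁ b₁ a₂ b₂} → Extra (a₁ , b₁) → Extra (a₂ , b₂) → b₁ ≢ b₂ →
      P.label a₁ ≡ P.label a₂ → P.label b₁ ≡ P.label b₂ → P.label a₁ ≢ P.label b₁ →
      Σ[ B ∈ ShortTour D ] All (λ z → P.label z ≡ P.label a₁ ⊎ P.label z ≡ P.label b₁) (moves B)
    outerTour {a₁} {b₁} {a₂} {b₂} (e₁ , a₁∈ , b₁∈ , _ , wt₁) (e₂ , a₂∈ , b₂∈ , _ , wt₂) b≢ eqa eqb a≢b
      with connect a₁∈ a₂∈ eqa | connect b₂∈ b₁∈ (sym eqb)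
    ... | ms , p , u , le | ms′ , p′ , u′ , le′
      with close (walk-++ (walk-map pieceEdge-adj p) (cons e₂ (walk-map pieceEdge-adj p′))) uniq (adj-sym e₁) (long-enough ms p′)
      where
      separate : ∀ {z} → z ∈ a₁ ∷ ms × z ∈ b₂ ∷ ms′ → ⊥
      separate (z∈ , z∈′) = a≢b (trans (sym (All.lookup (refl ∷ label-walk p) z∈))
                                       (trans (All.lookup (refl ∷ label-walk p′) z∈′) (sym eqb)))
      uniq : Unique (a₁ ∷ ms ++ b₂ ∷ ms′)
      uniq = Unique.++⁺ u u′ separate
      long-enough : ∀ ms {ms′} → Walk (PieceEdge C.T P.label (P.label b₂)) b₂ ms′ b₁ → 2 ≤ length (ms ++ b₂ ∷ ms′)
      long-enough []       nil        = contradiction refl b≢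
      long-enough []       (cons _ _) = s≤s (s≤s z≤n)
      long-enough (_ ∷ ms) p          = s≤s (subst (1 ≤_) (sym (length-++ ms)) (≤-trans (s≤s z≤n) (m≤n+m _ (length ms))))
    ... | B , len≡ = (a₁ , (ms ++ b₂ ∷ ms′) ++ [ a₁ ] , B , ≤-trans (≤-reflexive len≡) bound) ,
                     All.++⁺ (All.++⁺ (All.map inj₁ (label-walk p)) (inj₂ (sym eqb) ∷ All.map (λ eq → inj₂ (trans eq (sym eqb))) (label-walk p′)))
                             (inj₁ refl ∷ [])
      where
      M = m * L + m * L
      bound : len a₁ (ms ++ b₂ ∷ ms′) + wt b₁ a₁ ≤ D
      bound = begin
        len a₁ (ms ++ b₂ ∷ ms′) + wt b₁ a₁           ≡⟨ cong₂ _+_ (len-++ (b₂ ∷ ms′) p) (wt-sym b₁ a₁) ⟩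
        len a₁ ms + (wt a₂ b₂ + len b₂ ms′) + wt a₁ b₁ ≤⟨ +-mono-≤ (+-mono-≤ le (+-mono-≤ wt₂ le′)) wt₁ ⟩
        M + (L + M) + L                              ≡⟨ eq M L ⟩
        M + M + (L + L)                              ≤⟨ D≥ ⟩
        D                                            ∎
        where
        open ≤-Reasoning
        eq : ∀ m l → m + (l + m) + l ≡ m + m + (l + l)
        eq = solve-∀

    key : V × V → V × V
    key (a , b) = P.label a , P.label b

    tourBetween : ∀ {e₁ e₂} → Extra e₁ → Extra e₂ → proj₂ e₁ ≢ proj₂ e₂ → key e₁ ≡ key e₂ →
      Σ[ B ∈ ShortTour D ] All (λ z → P.label z ≡ proj₁ (key e₁) ⊎ P.label z ≡ proj₂ (key e₁)) (moves B)
    tourBetween {a₁ , b₁} x₁ x₂ b≢ eq with P.label a₁ ≟ᵛ P.label b₁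
    ... | yes same with innerTour x₁ same
    ...   | B , all = B , All.map inj₁ all
    tourBetween x₁ x₂ b≢ eq | no diff = outerTour x₁ x₂ b≢ (cong proj₁ eq) (cong proj₂ eq) diff

    Avoids : V → V → V × V → Set
    Avoids x y e = (proj₁ (key e) ≢ x × proj₁ (key e) ≢ y) × (proj₂ (key e) ≢ x × proj₂ (key e) ≢ y)

    avoids? : ∀ x y e → Dec (Avoids x y e)
    avoids? x y (a , b) = (¬? (P.label a ≟ᵛ x) ×-dec ¬? (P.label a ≟ᵛ y)) ×-dec (¬? (P.label b ≟ᵛ x) ×-dec ¬? (P.label b ≟ᵛ y))

    ends-at : V → List (V × V) → ℕ
    ends-at x E = cnt (map P.label (ends E)) x

    ends-filter : ∀ x y z E → ends-at z (filter (avoids? x y) E) ≤ ends-at z E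
    ends-filter x y z [] = z≤n
    ends-filter x y z ((a , b) ∷ E) with does (avoids? x y (a , b))
    ... | true  = +-monoʳ-≤ (bit (P.label a ≟ᵛ z)) (+-monoʳ-≤ (bit (P.label b ≟ᵛ z)) (ends-filter x y z E))
    ... | false = ≤-trans (ends-filter x y z E) (≤-trans (m≤n+m _ (bit (P.label b ≟ᵛ z))) (m≤n+m _ (bit (P.label a ≟ᵛ z))))

    -- A deleted edge has an end at `x` or at `y` and is paid for by this end.
    lost : ∀ x y E → length E ≤ length (filter (avoids? x y) E) + (ends-at x E + ends-at y E)
    lost x y [] = z≤n
    lost x y ((a , b) ∷ E) = case avoids? x y (a , b) of λ
      { (yes av) → ≤-trans (s≤s (lost x y E)) (≤-trans (miss xa ya xb yb)
                     (≤-reflexive (cong (λ l → length l + ((xa + (xb + X)) + (ya + (yb + Y)))) (sym (filter-accept (avoids? x y) av)))))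
      ; (no ¬av) → ≤-trans (s≤s (lost x y E)) (≤-trans (hit xa ya xb yb (touched ¬av (P.label a ≟ᵛ x) (P.label a ≟ᵛ y) (P.label b ≟ᵛ x) (P.label b ≟ᵛ y)))
                     (≤-reflexive (cong (λ l → length l + ((xa + (xb + X)) + (ya + (yb + Y)))) (sym (filter-reject (avoids? x y) ¬av))))) }
      where
      F X Y xa ya xb yb : ℕ
      xa = bit (P.label a ≟ᵛ x)
      ya = bit (P.label a ≟ᵛ y)
      xb = bit (P.label b ≟ᵛ x)
      yb = bit (P.label b ≟ᵛ y)
      F = length (filter (avoids? x y) E)
      X = ends-at x E
      Y = ends-at y E
      gather : ∀ F X Y a b c d → F + (X + Y) + (a + b + (c + d)) ≡ F + ((a + (c + X)) + (b + (d + Y)))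
      gather = solve-∀
      hit : ∀ a b c d → 1 ≤ a + b + (c + d) → suc (F + (X + Y)) ≤ F + ((a + (c + X)) + (b + (d + Y)))
      hit a b c d 1≤ = ≤-trans (≤-reflexive (+-comm 1 _)) (≤-trans (+-monoʳ-≤ (F + (X + Y)) 1≤) (≤-reflexive (gather F X Y a b c d)))
      miss : ∀ a b c d → suc (F + (X + Y)) ≤ suc F + ((a + (c + X)) + (b + (d + Y)))
      miss a b c d = s≤s (≤-trans (m≤m+n _ _) (≤-reflexive (gather F X Y a b c d)))
      touched : ∀ {A B C D : Set} → ¬ ((¬ A × ¬ B) × (¬ C × ¬ D)) → (da : Dec A) (db : Dec B) (dc : Dec C) (dd : Dec D) →
        1 ≤ bit da + bit db + (bit dc + bit dd)
      touched ¬av (yes _) db      dc      dd      = s≤s z≤n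
      touched ¬av (no _)  (yes _) dc      dd      = s≤s z≤n
      touched ¬av (no _)  (no _)  (yes _) dd      = s≤s z≤n
      touched ¬av (no _)  (no _)  (no _)  (yes _) = s≤s z≤n
      touched ¬av (no ¬a) (no ¬b) (no ¬c) (no ¬d) = contradiction ((¬a , ¬b) , (¬c , ¬d)) ¬av

    -- Each cycle stays in at most two pieces, and these hold at most `3 * q + 3 * q` ends of extra
    -- edges. Deleting the edges at them thus leaves more extra edges than pairs of pieces in every
    -- remaining round. `forb` lists the pieces already used.
    greedy : ∀ j (E : List (V × V)) (forb : List V) → All Extra E → AllPairs (λ e e′ → proj₂ e ≢ proj₂ e′) E →
      (∀ x → ends-at x E ≤ 3 * q) → All (λ e → proj₁ (key e) ∉ forb × proj₂ (key e) ∉ forb) E →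
      length P.labels * length P.labels + j * (3 * q + 3 * q) < length E →
      Σ[ F ∈ List (ShortTour D) ] DisjointTours F × length F ≡ j × All (λ B → All (λ z → P.label z ∉ forb) (moves B)) F
    greedy zero E forb _ _ _ _ _ = [] , [] , refl , []
    greedy (suc j) E forb ex un sz fb many
      with pigeonhole (≡-dec _≟ᵛ_ _≟ᵛ_) key (cartesianProduct P.labels P.labels)
             (All.map (λ { (_ , a∈ , b∈ , _) → ∈-cartesianProduct⁺ (P.label∈ a∈) (P.label∈ b∈) }) ex) un
             (≤-trans (s≤s (≤-trans (≤-reflexive (length-product P.labels P.labels)) (m≤m+n _ _))) many)
    ... | e₁ , e₂ , e₁∈ , e₂∈ , b≢ , eq with tourBetween (All.lookup ex e₁∈) (All.lookup ex e₂∈) b≢ eq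
    ... | B , on with greedy j (filter (avoids? x y) E) (x ∷ y ∷ forb) (All.filter⁺ _ ex) (AllPairs.filter⁺ _ un)
                        (λ z → ≤-trans (ends-filter x y z E) (sz z))
                        (All.zipWith (λ { ((( ax , ay) , (bx , by)) , (fa , fb)) → ∉3 ax ay fa , ∉3 bx by fb })
                          (All.all-filter (avoids? x y) E , All.filter⁺ (avoids? x y) fb))
                        still-many
      where
      x = proj₁ (key e₁)
      y = proj₂ (key e₁)
      ∉3 : ∀ {z} → z ≢ x → z ≢ y → z ∉ forb → z ∉ x ∷ y ∷ forb
      ∉3 zx zy zf (here eq)         = zx eq
      ∉3 zx zy zf (there (here eq)) = zy eq
      ∉3 zx zy zf (there (there z∈)) = zf z∈
      s² = length P.labels * length P.labels
      still-many : s² + j * (3 * q + 3 * q) < length (filter (avoids? x y) E)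
      still-many = +-cancelʳ-< (3 * q + 3 * q) _ _ (≤-trans (≤-trans (≤-reflexive (cong suc (assoc s² (j * (3 * q + 3 * q)) (3 * q + 3 * q)))) many)
                     (≤-trans (lost x y E) (+-monoʳ-≤ (length (filter (avoids? x y) E)) (+-mono-≤ (sz x) (sz y)))))
        where
        assoc : ∀ s c d → s + c + d ≡ s + (d + c)
        assoc = solve-∀
    ... | F , disj , len≡ , off = B ∷ F , All.map (λ {A} → separate {A}) off ∷ disj , cong suc len≡ ,
            All.map (λ { (inj₁ lx) → λ z∈ → proj₁ (All.lookup fb e₁∈) (subst (_∈ forb) lx z∈)
                       ; (inj₂ ly) → λ z∈ → proj₂ (All.lookup fb e₁∈) (subst (_∈ forb) ly z∈) }) on
              ∷ All.map (All.map (λ z∉ z∈ → z∉ (there (there z∈)))) off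
      where
      separate : ∀ {A} → All (λ z → P.label z ∉ proj₁ (key e₁) ∷ proj₂ (key e₁) ∷ forb) (moves {D} A) → Disjoint (moves B) (moves A)
      separate off (z∈B , z∈A) with All.lookup on z∈B
      ... | inj₁ eq = All.lookup off z∈A (here eq)
      ... | inj₂ eq = All.lookup off z∈A (there (here eq))

  length-ends : ∀ E → length (ends E) ≡ length E + length E
  length-ends []            = refl
  length-ends ((a , b) ∷ E) = cong suc (trans (cong suc (length-ends E)) (sym (+-suc (length E) (length E))))

  -- `L` limits the cycles to be hit, `D` those assembled in the pieces. Without `k` disjoint cycles
  -- within `D` there are none within `L`, so if no small set hits, growth reaches `N` ears; `arith`
  -- then leaves enough extra edges for `k` disjoint cycles within `D`, a contradiction.
  hitting : ∀ N q → 1 ≤ q → N * L + N * L + (N * L + N * L) + (L + L) ≤ D →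
    (∀ s → q * s ≤ N + N + q * k → s * s + k * (3 * q + 3 * q) < N) →
    (∀ (F : List (ShortTour D)) → DisjointTours F → length F ≢ k) →
    ¬ (∀ X → length X ≤ N + N → ¬ (∀ {s ms} → Tour Adj s ms → All (_∉ X) ms → L < len s ms))
  hitting N q 1≤q D≥ arith noPack noHit = grow noPackL N noHit N ≤-refl λ S →
    let open Grown S
        module C = Core core
        P = decompose C.T (ends C.E) q (ends-⊆ C.E-edge) (bound core)
        module P = Pieces P
        F , disj , len≡ , _ = greedy core P D≥ k C.E [] C.E-edge (AllPairs.map⁻ C.E-uniq) P.size
          (All.tabulate λ _ → (λ ()) , (λ ()))
          (subst (length P.labels * length P.labels + k * (3 * q + 3 * q) <_) (sym C.E-size) (arith (length P.labels) (≤-trans P.few (+-mono-≤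
            (≤-reflexive (trans (length-ends C.E) (cong₂ _+_ C.E-size C.E-size)))
            (*-monoʳ-≤ q (≤-trans C.roots≤ (<⇒≤ few)))))))
    in noPack F disj len≡
    where
    bound : ∀ {m r} (C : Core m r) u → cnt (ends (Core.E C)) u + q * children (Core.T C) u ≤ 3 * q
    bound C u = begin
      t + q * c        ≤⟨ +-monoˡ-≤ (q * c) (≤-trans (≤-reflexive (sym (*-identityˡ t))) (*-monoˡ-≤ t 1≤q)) ⟩
      q * t + q * c    ≡⟨ sym (*-distribˡ-+ q t c) ⟩
      q * (t + c)      ≤⟨ *-monoʳ-≤ q (Core.deg3 C u) ⟩
      q * 3            ≡⟨ *-comm q 3 ⟩
      3 * q            ∎
      where
      open ≤-Reasoning
      t c : ℕ
      t = cnt (ends (Core.E C)) u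
      c = children (Core.T C) u
    L≤D : L ≤ D
    L≤D = ≤-trans (≤-trans (m≤m+n L L) (m≤n+m _ (N * L + N * L + (N * L + N * L)))) D≥
    weaken : ShortTour L → ShortTour D
    weaken (s , ms , B , le) = s , ms , B , ≤-trans le L≤D
    noPackL : ∀ (F : List (ShortTour L)) → DisjointTours F → length F ≢ k
    noPackL F disj len≡ = noPack (map weaken F) (AllPairs.map⁺ disj) (trans (length-map weaken F) len≡)

-- Cycles as tours

AllPairs-lookup : ∀ {A : Set} {R : A → A → Set} → (∀ {x y} → R x y → R y x) → ∀ {xs} → AllPairs R xs →
  ∀ i j → i ≢ j → R (lookup xs i) (lookup xs j)
AllPairs-lookup R-sym (_ ∷ _)  zero    zero    i≢j = contradiction refl i≢j
AllPairs-lookup R-sym (r ∷ _)  zero    (suc j) _   = All.lookup r (∈-lookup j)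
AllPairs-lookup R-sym (r ∷ _)  (suc i) zero    _   = R-sym (All.lookup r (∈-lookup i))
AllPairs-lookup R-sym (_ ∷ rs) (suc i) (suc j) i≢j = AllPairs-lookup R-sym rs i j (i≢j ∘ cong suc)

edges : ∀ {V : Set} → V → List V → List (V × V)
edges s []       = []
edges s (x ∷ ms) = (s , x) ∷ edges x ms

edges-++ : ∀ {V : Set} {R : V → V → Set} {s ms t} ms′ → Walk R s ms t → edges s (ms ++ ms′) ≡ edges s ms ++ edges t ms′
edges-++ ms′ nil        = refl
edges-++ ms′ (cons _ p) = cong (_ ∷_) (edges-++ ms′ p)

module Cycles (I : Instance) where
  open Base I
  open Cycle

  ATour : Set
  ATour = Σ[ s ∈ V ] Σ[ ms ∈ List V ] Tour Adj s ms

  start : ATour → V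
  start (s , _) = s

  path : ATour → List V
  path (_ , ms , _) = ms

  length′ : ATour → ℕ
  length′ (s , ms , _) = len s ms

  next-inject₁ : ∀ (C : Cycle G) i → next C (inject₁ i) ≡ suc i
  next-inject₁ C i = Fin.toℕ-injective (trans (Fin.toℕ-fromℕ< (m%n<n (suc (toℕ (inject₁ i))) (order C)))
    (trans (cong (λ j → suc j % order C) (Fin.toℕ-inject₁ i)) (m<n⇒m%n≡m (s≤s (Fin.toℕ<n i)))))

  next-fromℕ : ∀ (C : Cycle G) → next C (fromℕ (2 + extra C)) ≡ zero
  next-fromℕ C = Fin.toℕ-injective (trans (Fin.toℕ-fromℕ< (m%n<n (suc (toℕ (fromℕ (2 + extra C)))) (order C)))
    (trans (cong (λ j → suc j % order C) (Fin.toℕ-fromℕ (2 + extra C))) (n%n≡0 (order C))))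

  walk-tabulate : ∀ {m} (f : Fin (suc m) → V) → (∀ i → Adj (f (inject₁ i)) (f (suc i))) →
    Walk Adj (f zero) (tabulate (f ∘ suc)) (f (fromℕ m))
  walk-tabulate {zero}  f e = nil
  walk-tabulate {suc m} f e = cons (e zero) (walk-tabulate (f ∘ suc) (e ∘ suc))

  len-tabulate : ∀ {m} (f : Fin (suc m) → V) →
    len (f zero) (tabulate (f ∘ suc)) ≡ sum (λ i → wt (f (inject₁ i)) (f (suc i)))
  len-tabulate {zero}  f = refl
  len-tabulate {suc m} f = cong (wt (f zero) (f (suc zero)) +_) (len-tabulate (f ∘ suc))

  edges-tabulate : ∀ {m} (f : Fin (suc m) → V) {e} → e ∈ edges (f zero) (tabulate (f ∘ suc)) →
    ∃[ i ] e ≡ (f (inject₁ i) , f (suc i))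
  edges-tabulate {suc m} f (here eq)  = zero , eq
  edges-tabulate {suc m} f (there e∈) with edges-tabulate (f ∘ suc) e∈
  ... | i , eq = suc i , eq

  cycleLength-wt : ∀ C → cycleLength w C ≡
    sum (λ i → wt (vertex C (inject₁ i)) (vertex C (suc i))) + wt (vertex C (fromℕ (2 + extra C))) (vertex C zero)
  cycleLength-wt C = trans (sum-cong-≗ λ i → weight≡wt (adjacent C i)) (trans (sum-init-last (λ i → wt (vertex C i) (vertex C (next C i))))
    (cong₂ _+_ (sum-cong-≗ λ i → cong (λ j → wt (vertex C (inject₁ i)) (vertex C j)) (next-inject₁ C i))
               (cong (λ j → wt (vertex C (fromℕ _)) (vertex C j)) (next-fromℕ C))))

  module _ (C : Cycle G) where
    private
      v = vertex C
      closed = close (walk-tabulate v λ i → subst (λ j → Adj (v (inject₁ i)) (v j)) (next-inject₁ C i) (adjacent C (inject₁ i)))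
                     (Unique.tabulate⁺ {f = v} (injective C))
                     (subst (λ j → Adj (v (fromℕ _)) (v j)) (next-fromℕ C) (adjacent C (fromℕ _)))
                     (s≤s (s≤s z≤n))

    toTour : ATour
    toTour = v zero , tabulate (v ∘ suc) ++ [ v zero ] , proj₁ closed

    toTour-length : length′ toTour ≡ cycleLength w C
    toTour-length = trans (proj₂ closed) (trans (cong (_+ wt (v (fromℕ _)) (v zero)) (len-tabulate v)) (sym (cycleLength-wt C)))

    toTour-vertex : ∀ {x} → x ∈ path toTour → ∃[ i ] x ≡ v i
    toTour-vertex x∈ with ∈-++⁻ (tabulate (v ∘ suc)) x∈
    ... | inj₂ (here eq) = zero , eq
    ... | inj₁ x∈′ with ∈-tabulate⁻ {f = v ∘ suc} x∈′
    ...   | i , eq = suc i , eq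

    toTour-edge : ∀ {e} → e ∈ edges (start toTour) (path toTour) → ∃[ i ] e ≡ (v i , v (next C i))
    toTour-edge {e} e∈ with ∈-++⁻ (edges (v zero) (tabulate (v ∘ suc)))
                          (subst (e ∈_) (edges-++ [ v zero ] (walk-tabulate {2 + extra C} v λ i → subst (λ j → Adj (v (inject₁ i)) (v j)) (next-inject₁ C i) (adjacent C (inject₁ i)))) e∈)
    ... | inj₂ (here eq) = fromℕ _ , trans eq (cong (λ j → v (fromℕ _) , v j) (sym (next-fromℕ C)))
    ... | inj₁ e∈′ with edges-tabulate v e∈′
    ...   | i , eq = inject₁ i , trans eq (cong (λ j → v (inject₁ i) , v j) (sym (next-inject₁ C i)))

  walk-lookup : ∀ {x ms t} → Walk Adj x ms t → ∀ (i : Fin (length ms)) → Adj (lookup (x ∷ ms) (inject₁ i)) (lookup (x ∷ ms) (suc i))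
  walk-lookup (cons e p) zero    = e
  walk-lookup (cons e p) (suc i) = walk-lookup p i

  lookup-last : ∀ {x ms t} → Walk Adj x ms t → lookup (x ∷ ms) (fromℕ (length ms)) ≡ t
  lookup-last nil        = refl
  lookup-last (cons _ p) = lookup-last p

  len-lookup : ∀ x ms → len x ms ≡ sum (λ (i : Fin (length ms)) → wt (lookup (x ∷ ms) (inject₁ i)) (lookup (x ∷ ms) (suc i)))
  len-lookup x []       = refl
  len-lookup x (y ∷ ms) = cong (wt x y +_) (len-lookup y ms)

  edge-lookup : ∀ (x : V) ms (i : Fin (length ms)) → (lookup (x ∷ ms) (inject₁ i) , lookup (x ∷ ms) (suc i)) ∈ edges x ms
  edge-lookup x (y ∷ ms) zero    = here refl
  edge-lookup x (y ∷ ms) (suc i) = there (edge-lookup y ms i)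

  Unique-lookup : ∀ {ms : List V} → Unique ms → ∀ {i j} → lookup ms i ≡ lookup ms j → i ≡ j
  Unique-lookup u {i} {j} eq with i Fin.≟ j
  ... | yes i≡j = i≡j
  ... | no i≢j  = contradiction eq (AllPairs-lookup (λ ne → ne ∘ sym) u i j i≢j)

  -- The start `s` is also the last move, so the moves are the vertices of the cycle and the first
  -- edge of the walk is the one that closes it.
  fromTour : ATour → Cycle G
  fromTour (_ , [] , tour _ _ ())
  fromTour (_ , _ ∷ [] , tour _ _ (s≤s ()))
  fromTour (_ , _ ∷ _ ∷ [] , tour _ _ (s≤s (s≤s ())))
  fromTour (s , ms@(a ∷ b ∷ c ∷ rest) , tour (cons e p) u _) = C
    where
    nxt : Fin (3 + length rest) → Fin (3 + length rest)
    nxt i = fromℕ< (m%n<n (suc (toℕ i)) (3 + length rest))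
    adj : ∀ i → Adj (lookup ms i) (lookup ms (nxt i))
    C : Cycle G
    C = record { extra = length rest ; vertex = lookup ms ; injective = Unique-lookup u ; adjacent = adj }
    adj i with view i
    ... | ‵fromℕ     = subst₂ Adj (sym (lookup-last p)) (cong (lookup ms) (sym nxt-last)) e
      where
      nxt-last : nxt (fromℕ (2 + length rest)) ≡ zero
      nxt-last = Fin.toℕ-injective (trans (Fin.toℕ-fromℕ< _) (trans (cong (λ j → suc j % (3 + length rest)) (Fin.toℕ-fromℕ (2 + length rest))) (n%n≡0 (3 + length rest))))
    ... | ‵inject₁ j = subst (Adj (lookup ms (inject₁ j))) (cong (lookup ms) (sym nxt-inj)) (walk-lookup p j)
      where
      nxt-inj : nxt (inject₁ j) ≡ suc j
      nxt-inj = Fin.toℕ-injective (trans (Fin.toℕ-fromℕ< (m%n<n (suc (toℕ (inject₁ j))) (3 + length rest)))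
        (trans (cong (λ j → suc j % (3 + length rest)) (Fin.toℕ-inject₁ j)) (m<n⇒m%n≡m (s≤s (Fin.toℕ<n j)))))

  fromTour-length : ∀ B → cycleLength w (fromTour B) ≡ length′ B
  fromTour-length (_ , [] , tour _ _ ())
  fromTour-length (_ , _ ∷ [] , tour _ _ (s≤s ()))
  fromTour-length (_ , _ ∷ _ ∷ [] , tour _ _ (s≤s (s≤s ())))
  fromTour-length B@(s , a ∷ b ∷ c ∷ rest , tour (cons e p) u _) =
    trans (cycleLength-wt (fromTour B))
      (trans (cong₂ _+_ (sym (len-lookup a (b ∷ c ∷ rest))) (cong (λ x → wt x a) (lookup-last p)))
             (+-comm (len a (b ∷ c ∷ rest)) (wt s a)))

  fromTour-vertex : ∀ B i → vertex (fromTour B) i ∈ path B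
  fromTour-vertex (_ , [] , tour _ _ ())
  fromTour-vertex (_ , _ ∷ [] , tour _ _ (s≤s ()))
  fromTour-vertex (_ , _ ∷ _ ∷ [] , tour _ _ (s≤s (s≤s ())))
  fromTour-vertex (s , ms@(_ ∷ _ ∷ _ ∷ _) , tour (cons _ _) _ _) i = ∈-lookup i

  fromTour-edge : ∀ B i → (vertex (fromTour B) i , vertex (fromTour B) (next (fromTour B) i)) ∈ edges (start B) (path B)
  fromTour-edge (_ , [] , tour _ _ ())
  fromTour-edge (_ , _ ∷ [] , tour _ _ (s≤s ()))
  fromTour-edge (_ , _ ∷ _ ∷ [] , tour _ _ (s≤s (s≤s ())))
  fromTour-edge B@(s , ms@(a ∷ b ∷ c ∷ rest) , tour (cons e p) u _) i with view i
  ... | ‵fromℕ     = here (cong₂ _,_ (lookup-last p) (cong (lookup ms) (next-fromℕ (fromTour B))))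
  ... | ‵inject₁ j = there (subst (λ z → (lookup ms (inject₁ j) , lookup ms z) ∈ edges a (b ∷ c ∷ rest)) (sym (next-inject₁ (fromTour B) j)) (edge-lookup a (b ∷ c ∷ rest) j))

  Same : V × V → V × V → Set
  Same = SameEdge {G = G}

  EdgesApart : List (V × V) → List (V × V) → Set
  EdgesApart E E′ = ∀ {e e′} → e ∈ E → e′ ∈ E′ → ¬ Same e e′

  fromTour-vertexDisjoint : ∀ A B → Disjoint (path A) (path B) → VertexDisjoint (fromTour A) (fromTour B)
  fromTour-vertexDisjoint A B disj i j eq = disj (fromTour-vertex A i , subst (_∈ path B) (sym eq) (fromTour-vertex B j))

  fromTour-edgeDisjoint : ∀ A B → EdgesApart (edges (start A) (path A)) (edges (start B) (path B)) → EdgeDisjoint (fromTour A) (fromTour B)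
  fromTour-edgeDisjoint A B disj i j = disj (fromTour-edge A i) (fromTour-edge B j)

  vertexDisjoint-sym : ∀ {C D : Cycle G} → VertexDisjoint C D → VertexDisjoint D C
  vertexDisjoint-sym d i j eq = d j i (sym eq)

  same-sym : ∀ {e e′} → Same e e′ → Same e′ e
  same-sym (inj₁ (p , q)) = inj₁ (sym p , sym q)
  same-sym (inj₂ (p , q)) = inj₂ (sym q , sym p)

  edgeDisjoint-sym : ∀ {C D : Cycle G} → EdgeDisjoint C D → EdgeDisjoint D C
  edgeDisjoint-sym d i j s = d j i (same-sym s)

  -- Allows the vertex-disjoint cycles found in the pieces to compete with an optimal packing in
  -- either problem.
  vertex⇒edgeDisjoint : ∀ {C D : Cycle G} → VertexDisjoint C D → EdgeDisjoint C D
  vertex⇒edgeDisjoint {D = D} d i j (inj₁ (p , _)) = d i j p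
  vertex⇒edgeDisjoint {D = D} d i j (inj₂ (p , _)) = d i (next D j) p

  totalLength : List ATour → ℕ
  totalLength []      = 0
  totalLength (B ∷ F) = length′ B + totalLength F

  packing : ∀ (Dis : Rel (Cycle G) 0ℓ) → (∀ {C D} → Dis C D → Dis D C) → ∀ {m} (F : List ATour) → length F ≡ m →
    AllPairs (λ A B → Dis (fromTour A) (fromTour B)) F →
    Σ[ C ∈ (Fin m → Cycle G) ] (∀ i j → i ≢ j → Dis (C i) (C j)) × sum (λ i → cycleLength w (C i)) ≡ totalLength F
  packing Dis Dis-sym F refl disj = (λ i → fromTour (lookup F i)) , AllPairs-lookup Dis-sym disj , total F
    where
    total : ∀ F → sum (λ i → cycleLength w (fromTour (lookup F i))) ≡ totalLength F
    total []      = refl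
    total (B ∷ F) = cong₂ _+_ (fromTour-length B) (total F)

-- Forced paths away from X

walk-zip : ∀ {V : Set} {R : V → V → Set} {P : V → Set} {s ms t} → P s → All P ms → Walk R s ms t →
  Walk (λ u v → R u v × P u × P v) s ms t
walk-zip ps []         nil        = nil
walk-zip ps (px ∷ pms) (cons r p) = cons (r , ps , px) (walk-zip px pms p)

module Routes (I : Instance) where
  open Base I
  open Forest I using (split-at; bit-yes; bit-no)

  Away : List V → V → V → Set
  Away X u v = Adj u v × u ∉ X × v ∉ X

  away-sym : ∀ {X u v} → Away X u v → Away X v u
  away-sym (e , u∉ , v∉) = adj-sym e , v∉ , u∉

  Girth> : ℕ → List V → Set
  Girth> L X = ∀ {s ms} → Tour Adj s ms → All (_∉ X) ms → L < len s ms

  Unique-length : ∀ {ms Y : List V} → Unique ms → ms ⊆ Y → length ms ≤ length Y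
  Unique-length {ms} {Y} u ⊆Y with length ms ≤? length Y
  ... | yes le = le
  ... | no ≰ with pigeonhole _≟ᵛ_ id Y (All.tabulate ⊆Y) u (≰⇒> ≰)
  ...   | a , b , _ , _ , a≢b , a≡b = contradiction a≡b a≢b

  Unique-length-n : ∀ {ms : List V} → Unique ms → length ms ≤ n
  Unique-length-n u = ≤-trans (Unique-length u λ {x} _ → ∈-allFin x) (≤-reflexive (length-tabulate id))

  len-prefix : ∀ c P₁ P₂ → len c P₁ ≤ len c (P₁ ++ P₂)
  len-prefix c []       P₂ = z≤n
  len-prefix c (x ∷ P₁) P₂ = +-monoʳ-≤ (wt c x) (len-prefix x P₁ P₂)

  module _ {L X} (girth : Girth> L X) where

    detour : ∀ {c x y t P Q} → Walk (Away X) c (y ∷ P) t → Unique (c ∷ y ∷ P) → Walk (Away X) c (x ∷ Q) t → x ≢ y →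
      len c (x ∷ Q) ≤ len c (y ∷ P) → len c (y ∷ P) + len c (y ∷ P) ≤ L →
      ∃[ rest ] Walk (Away X) c rest t × len c rest < len c (x ∷ Q) × length rest < length (x ∷ Q)
    detour {c} {x} {y} {t} {P} {Q} p u q x≢y Q≤P 2P≤L with split-at q (walk-last p)
    ... | S , b , rest , tip , eq , S∉ , here refl , q₁ , e , q₂ = rest , q₂ , shorter , fewer
      where
      shorter : len c rest < len c (x ∷ Q)
      shorter = begin-strict
        len c rest                           <⟨ m<n+m (len c rest) {wt tip c} (wt-pos (proj₁ e)) ⟩
        wt tip c + len c rest                ≤⟨ m≤n+m _ (len c S) ⟩
        len c S + (wt tip c + len c rest)    ≡⟨ sym (len-++ (c ∷ rest) q₁) ⟩
        len c (S ++ c ∷ rest)                ≡⟨ cong (len c) (sym eq) ⟩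
        len c (x ∷ Q)                        ∎
        where open ≤-Reasoning
      fewer : length rest < length (x ∷ Q)
      fewer = subst (length rest <_) (sym (trans (cong length eq) (length-++ S))) (m≤n+m _ (length S))
    ... | S , b , rest , tip , eq , S∉ , there b∈ , q₁ , e , q₂ with ∈-split b∈
    ... | P₁ , P₂ , eqP = contradiction (short-tour q₁ S∉ eq) too-long
      where
      P≡ : y ∷ P ≡ (P₁ ++ [ b ]) ++ P₂
      P≡ = trans eqP (sym (++-assoc P₁ [ b ] P₂))
      p₁ : Walk (Away X) c (P₁ ++ [ b ]) b
      p₁ with walk-split (P₁ ++ [ b ]) (subst (λ l → Walk (Away X) c l t) P≡ p)
      ... | b′ , p₁ , _ = subst (Walk (Away X) c (P₁ ++ [ b ])) (walk-snoc⁻ P₁ p₁) p₁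
      u₁ : Unique (c ∷ P₁ ++ [ b ])
      u₁ = proj₁ (AllPairs-++⁻ (c ∷ P₁ ++ [ b ]) (subst Unique (cong (c ∷_) P≡) u))
      ⊆P : c ∷ P₁ ++ [ b ] ⊆ c ∷ y ∷ P
      ⊆P {z} z∈ = subst (z ∈_) (cong (c ∷_) (sym P≡)) (∈-++⁺ˡ z∈)
      len₁ : len c (P₁ ++ [ b ]) ≤ len c (y ∷ P)
      len₁ = ≤-trans (len-prefix c (P₁ ++ [ b ]) P₂) (≤-reflexive (cong (len c) (sym P≡)))
      Short : Set
      Short = ∃ λ s → ∃ λ ms → Tour Adj s ms × All (_∉ X) ms × len s ms ≤ len c (y ∷ P) + len c (x ∷ Q)
      too-long : ¬ Short
      too-long (s , ms , B , av , le) =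
        contradiction (≤-trans le (≤-trans (+-monoʳ-≤ (len c (y ∷ P)) Q≤P) 2P≤L)) (<⇒≱ (girth B av))
      away-∉ : ∀ {s ms t} → Walk (Away X) s ms t → All (_∉ X) ms
      away-∉ = walk-All λ (_ , _ , v∉) → v∉
      short-tour : ∀ {S} → Walk (Away X) c S tip → All (_∉ c ∷ y ∷ P) S → x ∷ Q ≡ S ++ b ∷ rest → Short
      short-tour nil _ refl with close (walk-map proj₁ p₁) u₁ (adj-sym (proj₁ e)) (2≤ P₁ eqP)
        where
        2≤ : ∀ P₁ → y ∷ P ≡ P₁ ++ x ∷ P₂ → 2 ≤ length (P₁ ++ [ x ])
        2≤ []       refl = contradiction refl x≢y
        2≤ (_ ∷ P₁) _    = s≤s (subst (1 ≤_) (sym (length-++ P₁)) (m≤n+m 1 (length P₁)))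
      ... | B , len≡ = c , _ , B , away-∉ (walk-++ p₁ (cons (away-sym e) nil)) ,
        ≤-trans (≤-reflexive len≡) (+-mono-≤ len₁ (≤-trans (≤-reflexive (wt-sym x c)) (m≤m+n _ _)))
      short-tour {s₁ ∷ S′} (cons e₀ q₁′) (s₁∉ ∷ S∉) eq
        with walk-reverse (λ (r , a , b) → away-sym r , b , a) (walk-zip s₁∉ S∉ q₁′)
      ... | ms″ , r′ , len≡′ with simplify r′
      ... | ms′ , r , u′ , le with close (walk-map proj₁ (walk-++ p₁ (cons (away-sym e) (walk-map proj₁ r))))
              (Unique.++⁺ {xs = c ∷ P₁ ++ [ b ]} u₁ u′ λ (z∈ , z∈′) → All.lookup outside z∈′ (⊆P z∈)) (adj-sym (proj₁ e₀))
              (subst (2 ≤_) (sym (length-++ (P₁ ++ [ b ]))) (+-mono-≤ (subst (1 ≤_) (sym (length-++ P₁)) (m≤n+m 1 (length P₁))) (s≤s z≤n)))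
        where
        outside : All (_∉ c ∷ y ∷ P) (tip ∷ ms′)
        outside = All.lookup (s₁∉ ∷ S∉) (walk-last q₁′) ∷ walk-All (λ (_ , _ , v∉) → v∉) r
      ... | B , len≡ = c , _ , B , away-∉ (walk-++ (walk-++ p₁ (cons (away-sym e) (walk-map proj₁ r))) (cons (away-sym e₀) nil)) , (begin
          _                                                              ≡⟨ len≡ ⟩
          len c ((P₁ ++ [ b ]) ++ tip ∷ ms′) + wt s₁ c                   ≡⟨ cong₂ _+_ (len-++ (tip ∷ ms′) p₁) (wt-sym s₁ c) ⟩
          len c (P₁ ++ [ b ]) + (wt b tip + len tip ms′) + wt c s₁       ≤⟨ +-monoˡ-≤ _ (+-mono-≤ len₁ (+-mono-≤ (≤-reflexive (wt-sym b tip)) (≤-trans le (≤-reflexive len≡′)))) ⟩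
          len c (y ∷ P) + (wt tip b + len s₁ S′) + wt c s₁               ≤⟨ m≤m+n _ (len b rest) ⟩
          len c (y ∷ P) + (wt tip b + len s₁ S′) + wt c s₁ + len b rest  ≡⟨ rearrange (len c (y ∷ P)) (wt tip b) (len s₁ S′) (wt c s₁) (len b rest) ⟩
          len c (y ∷ P) + (wt c s₁ + len s₁ S′ + (wt tip b + len b rest)) ≡⟨ cong (len c (y ∷ P) +_) (sym (len-++ (b ∷ rest) (cons e₀ q₁′))) ⟩
          len c (y ∷ P) + len c ((s₁ ∷ S′) ++ b ∷ rest)                  ≡⟨ cong (λ l → len c (y ∷ P) + len c l) (sym eq) ⟩
          len c (y ∷ P) + len c (x ∷ Q)                                  ∎)
        where
        open ≤-Reasoning
        rearrange : ∀ p e s f r → p + (e + s) + f + r ≡ p + (f + s + (e + r))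
        rearrange = solve-∀

    -- Common first moves are stripped. A walk that diverges at once loses a loop by `detour`; by
    -- induction the strictly shorter remainder is the path itself, although the walk was no longer
    -- than the path.
    unique-path : ∀ fuel {c t P Q} → length Q ≤ fuel → Walk (Away X) c P t → Unique (c ∷ P) → Walk (Away X) c Q t →
      len c Q ≤ len c P → len c P + len c P ≤ L → Q ≡ P
    unique-path _ _ nil _ nil _ _ = refl
    unique-path _ _ nil _ (cons e q) le _ = contradiction (≤-trans (m≤m+n _ _) le) (<⇒≱ (wt-pos (proj₁ e)))
    unique-path _ _ p@(cons _ _) u nil _ _ = contradiction (walk-last⁺ p) (Unique-∉ u)
    unique-path (suc fuel) {c} {t} {y ∷ P} {x ∷ Q} (s≤s lenQ) p@(cons e p′) u@(_ ∷ u′) q@(cons e′ q′) le 2P≤L with x ≟ᵛ y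
    ... | yes refl = cong (x ∷_) (unique-path fuel lenQ p′ u′ q′ (+-cancelˡ-≤ (wt c x) _ _ le)
                       (≤-trans (+-mono-≤ (m≤n+m _ (wt c x)) (m≤n+m _ (wt c x))) 2P≤L))
    ... | no x≢y with detour p u q x≢y le 2P≤L
    ...   | rest , q″ , shorter , fewer with unique-path fuel (≤-trans (s≤s⁻¹ fewer) lenQ) p u q″ (<⇒≤ (<-≤-trans shorter le)) 2P≤L
    ...     | refl = contradiction le (<⇒≱ shorter)

  -- The form in which uniqueness is used by next hops: before `t`, every walk to `t` that is no
  -- longer than the remaining path begins with the same vertex. The whole path is then recovered
  -- one hop at a time.
  data Forced (X : List V) (t : V) : V → List V → Set where
    stop : Forced X t t []
    hop  : ∀ {c x P} → c ≢ t → Walk (Away X) c (x ∷ P) t →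
      (∀ {y Q} → Walk (Away X) c (y ∷ Q) t → len c (y ∷ Q) ≤ len c (x ∷ P) → y ≡ x) →
      Forced X t x P → Forced X t c (x ∷ P)

  forced : ∀ {L X} → Girth> L X → ∀ {c t P} → Walk (Away X) c P t → Unique (c ∷ P) → len c P + len c P ≤ L → Forced X t c P
  forced girth nil _ _ = stop
  forced girth {c} {P = x ∷ P} p@(cons e p′) u@(_ ∷ u′) 2P≤L =
    hop (λ { refl → Unique-∉ u (walk-last⁺ p) }) p
        (λ q le → cong head′ (unique-path girth _ ≤-refl p u q le 2P≤L))
        (forced girth p′ u′ (≤-trans (+-mono-≤ (m≤n+m _ (wt c x)) (m≤n+m _ (wt c x))) 2P≤L))
    where
    head′ : List V → V
    head′ []      = c
    head′ (y ∷ _) = y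

  edgeMove : V → V → List V
  edgeMove c t = if does (t ≟ᵛ c) then [] else [ t ]

  edgeMove-stay : ∀ c → edgeMove c c ≡ []
  edgeMove-stay c with c ≟ᵛ c
  ... | yes _ = refl
  ... | no ≢c = contradiction refl ≢c

  edgeMove-go : ∀ {c t} → t ≢ c → edgeMove c t ≡ [ t ]
  edgeMove-go {c} {t} t≢c with t ≟ᵛ c
  ... | yes eq = contradiction eq t≢c
  ... | no _   = refl

  -- A pair t₁ , t₂ of digits encodes an edge to t₁, or no move if already there, and then the forced path to t₂.
  data Pairs (X : List V) : V → List V → ℕ → List V → Set where
    done : ∀ {c} → Pairs X c [] 0 []
    step : ∀ {c t₁ t₂ ds j m ms} → Forced X t₂ t₁ m → length m ≤ n → Pairs X t₂ ds j ms →
      Pairs X c (t₁ ∷ t₂ ∷ ds) (suc j) (edgeMove c t₁ ++ m ++ ms)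

  -- An idle pair repeats the current vertex: no edge, then the empty path. So every cycle takes
  -- exactly `M` pairs, a loop bound that does not depend on the guess.
  pad : ∀ {X c ds j ms} → Pairs X c ds j ms → ∀ {M} → j ≤ M → ∃[ ds′ ] Pairs X c ds′ M ms
  pad {X} {c} done {M} _ = idle M
    where
    idle : ∀ M → ∃[ ds ] Pairs X c ds M []
    idle zero = [] , done
    idle (suc M) with idle M
    ... | ds , p = c ∷ c ∷ ds , subst (Pairs X c (c ∷ c ∷ ds) (suc M)) (trans (++-identityʳ _) (edgeMove-stay c)) (step stop z≤n p)
  pad (step f m≤n p) (s≤s j≤M) with pad p j≤M
  ... | ds , p′ = _ , step f m≤n p′

  visits : List V → List V → ℕ
  visits X ms = length (filter (_∈? X) ms)

  visits-∷ : ∀ X x ms → visits X (x ∷ ms) ≡ bit (x ∈? X) + visits X ms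
  visits-∷ X x ms with x ∈? X
  ... | yes _ = refl
  ... | no _  = refl

  visits-++ : ∀ X P ms → visits X ms ≤ visits X (P ++ ms)
  visits-++ X []      ms = ≤-refl
  visits-++ X (x ∷ P) ms = ≤-trans (visits-++ X P ms) (≤-trans (m≤n+m _ (bit (x ∈? X))) (≤-reflexive (sym (visits-∷ X x (P ++ ms)))))

  visits-≤ : ∀ {X Y ms} → X ⊆ Y → Unique ms → visits X ms ≤ length Y
  visits-≤ {X} {Y} {ms} X⊆Y u = Unique-length (AllPairs.filter⁺ (_∈? X) u)
    λ {x} x∈ → X⊆Y (proj₂ (∈-filter⁻ (_∈? X) {xs = ms} x∈))

  module _ {L X} (girth : Girth> L X) where

    -- `a` is the length already covered. Lengths are doubled instead of halving `L`, and `maximal`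
    -- names the two reasons for stopping, which later pay for the pair.
    record Segment (x : V) (ms : List V) (a : ℕ) : Set where
      field
        {P rest} : List V
        split    : ms ≡ P ++ rest
        avoids   : All (_∉ X) P
        short    : a + len x P + (a + len x P) ≤ L
        maximal  : ∀ {y r} → rest ≡ y ∷ r → y ∈ X ⊎ L < a + len x (P ++ [ y ]) + (a + len x (P ++ [ y ]))

    segment : ∀ x ms a → a + a ≤ L → Segment x ms a
    segment x [] a 2a≤L = record
      { P = [] ; rest = [] ; split = refl ; avoids = [] ; short = subst (λ b → b + b ≤ L) (sym (+-identityʳ a)) 2a≤L ; maximal = λ () }
    segment x (y ∷ ms) a 2a≤L with y ∈? X
    ... | yes y∈ = record
      { P = [] ; split = refl ; avoids = [] ; short = subst (λ b → b + b ≤ L) (sym (+-identityʳ a)) 2a≤L ; maximal = λ { refl → inj₁ y∈ } }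
    ... | no y∉ with (a + wt x y) + (a + wt x y) ≤? L
    ...   | no ≰ = record
      { P = [] ; split = refl ; avoids = [] ; short = subst (λ b → b + b ≤ L) (sym (+-identityʳ a)) 2a≤L
      ; maximal = λ { refl → inj₂ (subst (λ b → L < b + b) (cong (a +_) (sym (+-identityʳ (wt x y)))) (≰⇒> ≰)) } }
    ...   | yes le = record
      { P = y ∷ S.P ; split = cong (y ∷_) S.split ; avoids = y∉ ∷ S.avoids
      ; short = subst (λ b → b + b ≤ L) (+-assoc a (wt x y) (len y S.P)) S.short
      ; maximal = λ {z} eq → [ inj₁ , inj₂ ∘ subst (λ b → L < b + b) (+-assoc a (wt x y) (len y (S.P ++ [ z ]))) ]′ (S.maximal eq) }
      where module S = Segment (segment y ms (a + wt x y) le)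

    -- A route of edges and short paths breaks off at X or after a length of L / 2.
    budget : V → List V → ℕ
    budget x ms = suc L * (1 + bit (x ∈? X) + (visits X ms + visits X ms)) + (len x ms + len x ms)

    -- Every pair but the last costs `suc L`, paid by the vertex of `X` that it enters, by the
    -- vertex of `X` before which it stops, or by twice the length travelled, which exceeds `L`. So
    -- each visit to `X` pays at most twice; the summand 1 in `budget` pays for the last pair.
    pairs : ∀ fuel {c x ms s} → length (x ∷ ms) ≤ fuel → Walk Adj c (x ∷ ms) s → Unique (x ∷ ms) →
      ∃[ ds ] ∃[ j ] Pairs X c ds j (x ∷ ms) × suc L * j ≤ budget x ms
    pairs (suc fuel) {c} {x} {ms} {s} (s≤s fuel≥) (cons e p) u = route (start (x ∈? X))
      where
      Start : Set
      Start = Σ[ P ∈ List V ] Σ[ rest ∈ List V ] Σ[ t ∈ V ] ms ≡ P ++ rest × Forced X t x P × length P ≤ n × Walk Adj x P t × Walk Adj t rest s ×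
        (∀ {y r} → rest ≡ y ∷ r → suc L + suc L * bit (y ∈? X) ≤
          suc L * bit (x ∈? X) + suc L * (bit (y ∈? X) + bit (y ∈? X)) + (len x (P ++ [ y ]) + len x (P ++ [ y ])))
      -- A pair whose edge enters `X` takes the empty path, since forced paths are confined to the
      -- rest of the graph.
      start : Dec (x ∈ X) → Start
      start (yes x∈) = [] , ms , x , refl , stop , z≤n , nil , p , λ {y} _ →
        ≤-trans (+-mono-≤ (≤-reflexive (sym (trans (cong (suc L *_) (bit-yes (x ∈? X) x∈)) (*-identityʳ (suc L)))))
                          (*-monoʳ-≤ (suc L) (m≤m+n (bit (y ∈? X)) _)))
                (m≤m+n _ _)
      start (no x∉) with segment x ms 0 z≤n
      ... | record { P = P ; rest = rest ; split = refl ; avoids = av ; short = sh ; maximal = max } with walk-split P p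
      ...   | t , p₁ , p₂ = P , rest , t , refl , forced girth away (proj₁ (AllPairs-++⁻ (x ∷ P) u)) sh ,
              Unique-length-n (proj₁ (AllPairs-++⁻ P (AllPairs.tail u))) , p₁ , p₂ , λ {y} eq → cost y (max eq)
        where
        away : Walk (Away X) x P t
        away = walk-zip x∉ av p₁
        cost : ∀ y → y ∈ X ⊎ L < len x (P ++ [ y ]) + len x (P ++ [ y ]) → suc L + suc L * bit (y ∈? X) ≤
          suc L * bit (x ∈? X) + suc L * (bit (y ∈? X) + bit (y ∈? X)) + (len x (P ++ [ y ]) + len x (P ++ [ y ]))
        cost y (inj₁ y∈) rewrite bit-yes (y ∈? X) y∈ | *-identityʳ L | *-comm L 2 | +-identityʳ L =
          ≤-trans (≤-reflexive (eq L)) (≤-trans (m≤n+m _ (suc L * bit (x ∈? X))) (m≤m+n _ _))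
          where
          eq : ∀ L → suc L + suc L ≡ 2 + (L + L)
          eq = solve-∀
        cost y (inj₂ L<) = ≤-trans (+-monoˡ-≤ _ L<) (≤-trans (+-monoʳ-≤ (len x (P ++ [ y ]) + len x (P ++ [ y ])) (*-monoʳ-≤ (suc L) (m≤m+n (bit (y ∈? X)) _)))
          (≤-trans (≤-reflexive (+-comm (len x (P ++ [ y ]) + len x (P ++ [ y ])) _)) (+-monoˡ-≤ _ (m≤n+m _ (suc L * bit (x ∈? X))))))
      edge : edgeMove c x ≡ [ x ]
      edge = edgeMove-go λ { refl → adj-irrefl refl e }
      route : Start → ∃[ ds ] ∃[ j ] Pairs X c ds j (x ∷ ms) × suc L * j ≤ budget x ms
      route (P , [] , t , refl , f , P≤n , p₁ , p₂ , _) =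
        x ∷ t ∷ [] , 1 , subst (λ l → Pairs X c (x ∷ t ∷ []) 1 (l ++ P ++ [])) edge (step f P≤n done) ,
        ≤-trans (*-monoʳ-≤ (suc L) (s≤s z≤n)) (m≤m+n (suc L * (1 + bit (x ∈? X) + (visits X (P ++ []) + visits X (P ++ [])))) _)
      route (P , y ∷ r , t , refl , f , P≤n , p₁ , p₂ , cost)
        with pairs fuel (≤-trans (≤-trans (m≤n+m _ (length P)) (≤-reflexive (sym (length-++ P)))) fuel≥) p₂
                   (proj₁ (proj₂ (AllPairs-++⁻ P (AllPairs.tail u))))
      ... | ds , j , ps , le = x ∷ t ∷ ds , suc j , subst (λ l → Pairs X c (x ∷ t ∷ ds) (suc j) (l ++ P ++ y ∷ r)) edge (step f P≤n ps) , (begin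
          suc L * suc j                                                ≡⟨ *-suc (suc L) j ⟩
          suc L + suc L * j                                            ≤⟨ +-monoʳ-≤ (suc L) le ⟩
          suc L + budget y r                                           ≡⟨ open₁ (suc L) bY vr lr ⟩
          suc L + suc L * bY + (suc L * (1 + (vr + vr)) + (lr + lr))   ≤⟨ +-monoˡ-≤ _ (cost refl) ⟩
          suc L * bX + suc L * (bY + bY) + (lP + lP) + (suc L * (1 + (vr + vr)) + (lr + lr)) ≡⟨ close₁ (suc L) bX bY vr lr lP ⟩
          suc L * (1 + bX + (bY + vr + (bY + vr))) + (lP + lr + (lP + lr))
            ≤⟨ +-mono-≤ (*-monoʳ-≤ (suc L) (+-monoʳ-≤ (1 + bX) (+-mono-≤ more more))) (≤-reflexive (cong (λ z → z + z) (sym lens))) ⟩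
          budget x (P ++ y ∷ r)                                        ∎)
        where
        open ≤-Reasoning
        bX bY vr lr lP : ℕ
        bX = bit (x ∈? X)
        bY = bit (y ∈? X)
        vr = visits X r
        lr = len y r
        lP = len x (P ++ [ y ])
        more : bY + vr ≤ visits X (P ++ y ∷ r)
        more = ≤-trans (≤-reflexive (sym (visits-∷ X y r))) (visits-++ X P (y ∷ r))
        lens : len x (P ++ y ∷ r) ≡ lP + lr
        lens = trans (len-++ (y ∷ r) p₁) (trans (sym (+-assoc (len x P) (wt t y) lr))
          (cong (_+ lr) (sym (trans (len-++ [ y ] p₁) (cong (len x P +_) (+-identityʳ (wt t y)))))))
        open₁ : ∀ l b v r → l + (l * (1 + b + (v + v)) + (r + r)) ≡ l + l * b + (l * (1 + (v + v)) + (r + r))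
        open₁ = solve-∀
        close₁ : ∀ l b c v r p → l * b + l * (c + c) + (p + p) + (l * (1 + (v + v)) + (r + r)) ≡
          l * (1 + b + (c + v + (c + v))) + (p + r + (p + r))
        close₁ = solve-∀

    -- The `X` read by the machine is padded with repetitions to `M` entries. `Y` is a short list
    -- containing the same vertices, and its length is what bounds the visits.
    tour-pairs : ∀ {s ms Y R M} → Tour Adj s ms → X ⊆ Y → len s ms ≤ suc L * R → 1 + (length Y + length Y) + (R + R) ≤ M →
      ∃[ ds ] Pairs X s ds M ms
    tour-pairs {ms = []} (tour _ _ ()) _ _ _
    tour-pairs {s} {x ∷ ms} {Y} {R} {M} B X⊆Y W≤ M≥ with pairs (length (x ∷ ms)) ≤-refl (walk B) (unique B)
    ... | ds , j , ps , le = pad ps (≤-trans j≤ M≥)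
      where
      open ≤-Reasoning
      v y : ℕ
      v = visits X (x ∷ ms)
      y = length Y
      v≤y : v ≤ y
      v≤y = visits-≤ X⊆Y (unique B)
      b≤ : bit (x ∈? X) + (visits X ms + visits X ms) ≤ y + y
      b≤ = ≤-trans (≤-trans (m≤m+n _ (bit (x ∈? X))) (≤-reflexive (eq (bit (x ∈? X)) (visits X ms))))
             (+-mono-≤ (≤-trans (≤-reflexive (sym (visits-∷ X x ms))) v≤y) (≤-trans (≤-reflexive (sym (visits-∷ X x ms))) v≤y))
        where
        eq : ∀ b v → b + (v + v) + b ≡ b + v + (b + v)
        eq = solve-∀
      len≤ : len x ms ≤ suc L * R
      len≤ = ≤-trans (m≤n+m _ (wt s x)) W≤
      j≤ : j ≤ 1 + (y + y) + (R + R)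
      j≤ = *-cancelˡ-≤ (suc L) (begin
        suc L * j                                          ≤⟨ le ⟩
        suc L * (1 + bit (x ∈? X) + (visits X ms + visits X ms)) + (len x ms + len x ms)
          ≤⟨ +-mono-≤ (*-monoʳ-≤ (suc L) (s≤s b≤)) (+-mono-≤ len≤ len≤) ⟩
        suc L * (1 + (y + y)) + (suc L * R + suc L * R)    ≡⟨ eq (suc L) (y + y) R ⟩
        suc L * (1 + (y + y) + (R + R))                    ∎)
        where
        eq : ∀ l y r → l * (1 + y) + (l * r + l * r) ≡ l * (1 + y + (r + r))
        eq = solve-∀

-- Running programs

block : List Instr → Program
block []       = skip
block (ι ∷ is) = instr ι ⨾ block is

execs : List Instr → State → State
execs []       s = s
execs (ι ∷ is) s = execs is (exec ι s)

record Run (p : Program) (s : State) (B : ℕ) (Q : State → Set) : Set where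
  constructor run
  field
    {steps}  : ℕ
    {final}  : State
    halts    : ⟨ p , s ⟩⇓[ steps ] final
    steps≤   : steps ≤ B
    post     : Q final

touches : (Instr → Bool) → Program → Bool
touches f (instr ι)    = f ι
touches f skip         = false
touches f (p ⨾ q)      = touches f p ∨ touches f q
touches f (ifnz _ p q) = touches f p ∨ touches f q
touches f (while _ p)  = touches f p

-- A syntactic test of the program replaces reasoning about its execution: a component that no
-- instruction touches keeps its value, and for concrete programs the test evaluates to `false`.
frame : ∀ {A : Set} (look : State → A) (f : Instr → Bool) → (∀ ι {s} → f ι ≡ false → look (exec ι s) ≡ look s) →
  ∀ {p s s′ t} → ⟨ p , s ⟩⇓[ t ] s′ → touches f p ≡ false → look s′ ≡ look s
frame look f safe (⇓instr {ι})         eq = safe ι eq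
frame look f safe ⇓skip                eq = refl
frame look f safe (⇓seq {p} d d′)      eq =
  trans (frame look f safe d′ (∨-conicalʳ (touches f p) _ eq)) (frame look f safe d (∨-conicalˡ (touches f p) _ eq))
frame look f safe (⇓then {p = p} _ d)  eq = frame look f safe d (∨-conicalˡ (touches f p) _ eq)
frame look f safe (⇓else {p = p} _ d)  eq = frame look f safe d (∨-conicalʳ (touches f p) _ eq)
frame look f safe (⇓done _)            eq = refl
frame look f safe (⇓loop _ d d′)       eq = trans (frame look f safe d′ eq) (frame look f safe d eq)

update-≢ : ∀ {A : Set} (f : ℕ → A) i x j → does (j ≟ i) ≡ false → (f [ i ↦ x ]) j ≡ f j
update-≢ f i x j eq = cong (λ b → if b then x else f j) eq

update-there : ∀ {A : Set} (f : ℕ → A) {i x j} → j ≢ i → (f [ i ↦ x ]) j ≡ f j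
update-there f {i} {x} {j} j≢i = update-≢ f i x j (dec-false (j ≟ i) j≢i)

update-here : ∀ {A : Set} (f : ℕ → A) {i x j} → j ≡ i → (f [ i ↦ x ]) j ≡ x
update-here f {i} {x} {j} eq = cong (λ b → if b then x else f j) (dec-true (j ≟ i) eq)

writesⁱ storesⁱ wwritesⁱ wstoresⁱ : ℕ → Instr → Bool
writesⁱ y (const! x c)    = does (y ≟ x)
writesⁱ y (add! x _ _)    = does (y ≟ x)
writesⁱ y (monus! x _ _)  = does (y ≟ x)
writesⁱ y (load! x _ _)   = does (y ≟ x)
writesⁱ y (wleq! x _ _)   = does (y ≟ x)
writesⁱ y _               = false
storesⁱ y (store! _ a _)  = does (y ≟ a)
storesⁱ y _               = false
wwritesⁱ y (wmove! u _)   = does (y ≟ u)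
wwritesⁱ y (wadd! u _ _)  = does (y ≟ u)
wwritesⁱ y (wload! u _ _) = does (y ≟ u)
wwritesⁱ y _              = false
wstoresⁱ y (wstore! _ a _) = does (y ≟ a)
wstoresⁱ y _               = false

writes stores wwrites wstores : Program → ℕ → Bool
writes  p y = touches (writesⁱ y) p
stores  p y = touches (storesⁱ y) p
wwrites p y = touches (wwritesⁱ y) p
wstores p y = touches (wstoresⁱ y) p

frame-var : ∀ {p s s′ t} → ⟨ p , s ⟩⇓[ t ] s′ → ∀ y → writes p y ≡ false → var s′ y ≡ var s y
frame-var d y = frame (λ s → var s y) (writesⁱ y) safe d
  where
  safe : ∀ ι {s} → writesⁱ y ι ≡ false → var (exec ι s) y ≡ var s y
  safe (const! x c)    {s} eq = update-≢ (var s) x _ y eq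
  safe (add! x _ _)    {s} eq = update-≢ (var s) x _ y eq
  safe (monus! x _ _)  {s} eq = update-≢ (var s) x _ y eq
  safe (load! x _ _)   {s} eq = update-≢ (var s) x _ y eq
  safe (wleq! x _ _)   {s} eq = update-≢ (var s) x _ y eq
  safe (store! _ _ _)  eq = refl
  safe (wmove! _ _)    eq = refl
  safe (wadd! _ _ _)   eq = refl
  safe (wload! _ _ _)  eq = refl
  safe (wstore! _ _ _) eq = refl

frame-arr : ∀ {p s s′ t} → ⟨ p , s ⟩⇓[ t ] s′ → ∀ a → stores p a ≡ false → arr s′ a ≡ arr s a
frame-arr d y = frame (λ s → arr s y) (storesⁱ y) safe d
  where
  safe : ∀ ι {s} → storesⁱ y ι ≡ false → arr (exec ι s) y ≡ arr s y
  safe (store! _ a _)  {s} eq = update-≢ (arr s) a _ y eq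
  safe (const! _ _)    eq = refl
  safe (add! _ _ _)    eq = refl
  safe (monus! _ _ _)  eq = refl
  safe (load! _ _ _)   eq = refl
  safe (wmove! _ _)    eq = refl
  safe (wadd! _ _ _)   eq = refl
  safe (wleq! _ _ _)   eq = refl
  safe (wload! _ _ _)  eq = refl
  safe (wstore! _ _ _) eq = refl

frame-wvar : ∀ {p s s′ t} → ⟨ p , s ⟩⇓[ t ] s′ → ∀ u → wwrites p u ≡ false → wvar s′ u ≡ wvar s u
frame-wvar d y = frame (λ s → wvar s y) (wwritesⁱ y) safe d
  where
  safe : ∀ ι {s} → wwritesⁱ y ι ≡ false → wvar (exec ι s) y ≡ wvar s y
  safe (wmove! u _)    {s} eq = update-≢ (wvar s) u _ y eq
  safe (wadd! u _ _)   {s} eq = update-≢ (wvar s) u _ y eq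
  safe (wload! u _ _)  {s} eq = update-≢ (wvar s) u _ y eq
  safe (const! _ _)    eq = refl
  safe (add! _ _ _)    eq = refl
  safe (monus! _ _ _)  eq = refl
  safe (load! _ _ _)   eq = refl
  safe (store! _ _ _)  eq = refl
  safe (wleq! _ _ _)   eq = refl
  safe (wstore! _ _ _) eq = refl

frame-warr : ∀ {p s s′ t} → ⟨ p , s ⟩⇓[ t ] s′ → ∀ a → wstores p a ≡ false → warr s′ a ≡ warr s a
frame-warr d y = frame (λ s → warr s y) (wstoresⁱ y) safe d
  where
  safe : ∀ ι {s} → wstoresⁱ y ι ≡ false → warr (exec ι s) y ≡ warr s y
  safe (wstore! _ a _) {s} eq = update-≢ (warr s) a _ y eq
  safe (const! _ _)    eq = refl
  safe (add! _ _ _)    eq = refl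
  safe (monus! _ _ _)  eq = refl
  safe (load! _ _ _)   eq = refl
  safe (store! _ _ _)  eq = refl
  safe (wmove! _ _)    eq = refl
  safe (wadd! _ _ _)   eq = refl
  safe (wleq! _ _ _)   eq = refl
  safe (wload! _ _ _)  eq = refl

record Kept (p : Program) (s s′ : State) : Set where
  field
    vars  : ∀ y → writes p y ≡ false → var s′ y ≡ var s y
    arrs  : ∀ a → stores p a ≡ false → arr s′ a ≡ arr s a
    wvars : ∀ u → wwrites p u ≡ false → wvar s′ u ≡ wvar s u
    warrs : ∀ a → wstores p a ≡ false → warr s′ a ≡ warr s a

_framed : ∀ {p s B Q} → Run p s B Q → Run p s B (λ s′ → Q s′ × Kept p s s′)
run d le post framed = run d le (post , record { vars = frame-var d ; arrs = frame-arr d ; wvars = frame-wvar d ; warrs = frame-warr d })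

run-instr : ∀ ι {s Q} → Q (exec ι s) → Run (instr ι) s 1 Q
run-instr ι post = run ⇓instr ≤-refl post

infixr 4 _then_

_then_ : ∀ {p q s B B′ Q Q′} → Run p s B Q → (∀ {s′} → Q s′ → Run q s′ B′ Q′) → Run (p ⨾ q) s (B + B′) Q′
run d le post then f with f post
... | run d′ le′ post′ = run (⇓seq d d′) (+-mono-≤ le le′) post′

weaken : ∀ {p s B B′ Q Q′} → B ≤ B′ → (∀ {s′} → Q s′ → Q′ s′) → Run p s B Q → Run p s B′ Q′
weaken B≤ f (run d le post) = run d (≤-trans le B≤) (f post)

run-execs : ∀ is s → ⟨ block is , s ⟩⇓[ suc (length is) ] execs is s
run-execs []       s = ⇓skip
run-execs (ι ∷ is) s = ⇓seq ⇓instr (run-execs is (exec ι s))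

run-block : ∀ is {s Q} → Q (execs is s) → Run (block is) s (suc (length is)) Q
run-block is post = run (run-execs is _) ≤-refl post

run-skip : ∀ {s Q} → Q s → Run skip s 1 Q
run-skip post = run ⇓skip ≤-refl post

run-ifnz : ∀ {x p q s B B′ Q} → (var s x ≢ 0 → Run p s B Q) → (var s x ≡ 0 → Run q s B′ Q) →
  Run (ifnz x p q) s (suc (B + B′)) Q
run-ifnz {x} {s = s} {B} {B′} f g with var s x ≟ 0
... | no ≢0 with f ≢0
...   | run d le post = run (⇓then ≢0 d) (s≤s (≤-trans le (m≤m+n B B′))) post
run-ifnz {x} {s = s} {B} {B′} f g | yes ≡0 with g ≡0
...   | run d le post = run (⇓else ≡0 d) (s≤s (≤-trans le (m≤n+m B′ B))) post

-- Variables 2 and 31 hold the constants 1 and 0.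
loop : ℕ → ℕ → Program → Program
loop c y p = instr (add! c y 31) ⨾ while c (p ⨾ instr (monus! c c 2))

-- Setting the counter and the final test take two steps; each round adds a test and a decrement to
-- the body.
loopCost : ℕ → ℕ → ℕ
loopCost m B = 2 + m * (2 + B)

-- The counter runs down while the index of the invariant runs up. `stable` demands that the
-- invariant ignore the counter, which the loop itself overwrites.
run-loop : ∀ {c y p B} (Inv : ℕ → State → Set) → writes p c ≡ false → does (c ≟ 2) ≡ false → writes p 2 ≡ false →
  (∀ {j s} v → Inv j s → Inv j (setVar c v s)) → ∀ m →
  (∀ {j s} → j < m → var s 2 ≡ 1 → Inv j s → Run p s B (Inv (suc j))) →
  ∀ {s} → var s 2 ≡ 1 → var s 31 ≡ 0 → var s y ≡ m → Inv 0 s → Run (loop c y p) s (loopCost m B) (Inv m)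
run-loop {c} {y} {p} {B} Inv c-fresh c≢2 2-fresh stable m body {s} one zer y≡ inv₀ =
  run (⇓seq ⇓instr (Run.halts loop′)) (s≤s (≤-trans (Run.steps≤ loop′) (≤-reflexive (+-comm _ 1)))) (Run.post loop′)
  where
  hit : ∀ v s → var (setVar c v s) c ≡ v
  hit v s = update-here (var s) {x = v} refl
  one′ : ∀ v s → var s 2 ≡ 1 → var (setVar c v s) 2 ≡ 1
  one′ v s eq = trans (update-there (var s) {c} {v} λ { refl → case c≢2 of λ () }) eq
  iterate : ∀ r j {s} → j + r ≡ m → var s 2 ≡ 1 → var s c ≡ r → Inv j s →
    Run (while c (p ⨾ instr (monus! c c 2))) s (r * (2 + B) + 1) (Inv m)
  iterate zero j eq one c≡ inv = run (⇓done c≡) ≤-refl (subst (λ j → Inv j _) (trans (sym (+-identityʳ j)) eq) inv)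
  iterate (suc r) j {s} eq one c≡ inv with body (subst (j <_) eq (m<m+n j (s≤s z≤n))) one inv
  ... | run {t} {s′} d le post with iterate r (suc j) {setVar c (var s′ c ∸ var s′ 2) s′} (trans (sym (+-suc j r)) eq)
                                     (one′ _ s′ (trans (frame-var d 2 2-fresh) one))
                                     (trans (hit _ s′) (trans (cong₂ _∸_ (trans (frame-var d c c-fresh) c≡) (trans (frame-var d 2 2-fresh) one)) refl))
                                     (stable _ post)
  ...   | run {t′} d′ le′ post′ = run (⇓loop (λ c≡0 → case trans (sym c≡) c≡0 of λ ()) (⇓seq d ⇓instr) d′)
            (≤-trans (s≤s (+-mono-≤ (+-monoˡ-≤ 1 le) le′)) (≤-reflexive (cost B (r * (2 + B))))) post′
    where
    cost : ∀ B r → suc (B + 1 + (r + 1)) ≡ 2 + B + r + 1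
    cost = solve-∀
  loop′ : Run (while c (p ⨾ instr (monus! c c 2))) (exec (add! c y 31) s) (m * (2 + B) + 1) (Inv m)
  loop′ = iterate m 0 refl (one′ _ s one) (trans (hit _ s) (trans (cong₂ _+_ y≡ zer) (+-identityʳ m))) (stable _ inv₀)

-- `r` bounds the number of rounds after the current one; it must drop whenever the loop continues.
run-while : ∀ {x p B} (Inv : ℕ → State → Set) {Done : State → Set} →
  (∀ {r s} → Inv r s → Run p s B (λ s′ → (var s′ x ≡ 0 × Done s′) ⊎ (var s′ x ≢ 0 × Σ[ r′ ∈ ℕ ] r ≡ suc r′ × Inv r′ s′))) →
  ∀ r {s} → var s x ≢ 0 → Inv r s → Run (while x p) s (suc r * suc B + 1) Done
run-while {x} {p} {B} Inv {Done} body r {s} go inv with body inv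
... | run d le (inj₁ (stop , result)) = run (⇓loop go d (⇓done stop)) (s≤s (+-mono-≤ (≤-trans le (m≤m+n B (r * suc B))) ≤-refl)) result
... | run d le (inj₂ (go′ , r′ , refl , inv′)) with run-while Inv {Done} body r′ go′ inv′
...   | run d′ le′ result = run (⇓loop go d d′) (≤-trans (s≤s (+-mono-≤ le le′)) (≤-reflexive (cong suc (sym (+-assoc B (suc r′ * suc B) 1))))) result

-- Moving along an edge

-- Variables 14, 19, 30, 32, 33 are scratch, 20 to 27 are loop counters.
--   0 n    1 k     2 one     3 M      4 number of digits   5 edge stamp   6 vertex stamp   7 failures   8 position
--   9 current vertex   10 start   11 moves   12 target   13 next vertex   15 distance stamp
--   16 result   17 continue   18 carry   28, 29 row and column   31 zero
-- Arrays: 0 adjacency   1 row offsets   2 digits   3 X   4 used vertices   5 used edges   6 finite distances   7 next hops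
-- Weights: variables 0 ℓ   1 total   2, 3 scratch   4 zero; arrays 0 weights   1 distances
checkAdjacent checkVertex checkEdge markEdge arrive : List Instr
checkAdjacent = load! 32 1 9 ∷ add! 32 32 13 ∷ load! 14 0 32 ∷ monus! 14 2 14 ∷ add! 7 7 14 ∷ []
checkVertex   = load! 14 4 13 ∷ monus! 14 6 14 ∷ monus! 14 2 14 ∷ add! 7 7 14 ∷ store! 6 4 13 ∷ []
checkEdge     = load! 14 5 32 ∷ monus! 14 5 14 ∷ monus! 14 2 14 ∷ add! 7 7 14 ∷ []
markEdge      = store! 5 5 32 ∷ load! 33 1 13 ∷ add! 33 33 9 ∷ store! 5 5 33 ∷ []
arrive        = wload! 2 0 32 ∷ wadd! 1 1 2 ∷ add! 9 13 31 ∷ add! 11 11 2 ∷ []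

move : Program
move = block checkAdjacent ⨾ block checkVertex ⨾ block checkEdge ⨾ block markEdge ⨾ block arrive

data Mode : Set where
  vertexMode edgeMode : Mode

m+n≡0 : ∀ m n → m + n ≡ 0 → m ≡ 0 × n ≡ 0
m+n≡0 zero n eq = refl , eq

1∸ : ∀ {m} → 1 ∸ m ≡ 0 → 0 < m
1∸ {zero}  ()
1∸ {suc m} _ = s≤s z≤n

1∸⁻ : ∀ {m} → 0 < m → 1 ∸ m ≡ 0
1∸⁻ {suc m} _ = 0∸n≡0 m

-- Here `m` is the current stamp and `n` an entry. As entries never exceed the stamp, the difference
-- vanishes exactly at marked entries, and the check contributes 1 there and 0 elsewhere.
stale : ∀ {m n} → 1 ∸ (m ∸ n) ≡ 0 → n ≢ m
stale {m} eq refl = contradiction (subst (0 <_) (n∸n≡0 m) (1∸ eq)) λ ()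

stale⁻ : ∀ {m n} → n ≤ m → n ≢ m → 1 ∸ (m ∸ n) ≡ 0
stale⁻ {m} {n} n≤m n≢m = 1∸⁻ {m ∸ n} (m<n⇒0<n∸m (≤∧≢⇒< n≤m n≢m))

module Machine (I : Instance) (M : ℕ) where
  open Base I
  open Cycles I
  open Routes I

  index : V → V → ℕ
  index u v = toℕ u * n + toℕ v

  index-injective : ∀ {u v a b} → index u v ≡ index a b → (u , v) ≡ (a , b)
  index-injective {u} {v} {a} {b} eq = cong₂ _,_ (proj₁ both) (proj₂ both)
    where
    code : ∀ u v → toℕ (combine u v) ≡ index u v
    code u v = trans (Fin.toℕ-combine u v) (cong (_+ toℕ v) (*-comm n (toℕ u)))
    both = Fin.combine-injective u v a b (Fin.toℕ-injective (trans (code u v) (trans eq (sym (code a b)))))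

  -- Invariants are indexed by the values they mention instead of the state, so that an instruction touching none
  -- of these values preserves them definitionally.
  record CtxR (v0 v1 v2 v3 v31 : ℕ) (a0 a1 : ℕ → ℕ) (w0 w4 : ℕ) (x0 : ℕ → ℕ) : Set where
    field
      n≡    : v0 ≡ n
      k≡    : v1 ≡ k
      one≡  : v2 ≡ 1
      M≡    : v3 ≡ M
      zero≡ : v31 ≡ 0
      adj≡  : ∀ u v → a0 (index u v) ≡ bit (adj? u v)
      off≡  : ∀ (u : V) → a1 (toℕ u) ≡ toℕ u * n
      ℓ≡    : w0 ≡ ℓ
      wz≡   : w4 ≡ 0
      wt≡   : ∀ u v → x0 (index u v) ≡ wt u v

  Ctx : State → Set
  Ctx s = CtxR (var s 0) (var s 1) (var s 2) (var s 3) (var s 31) (arr s 0) (arr s 1) (wvar s 0) (wvar s 4) (warr s 0)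

  record UsedR (sv : ℕ) (used : ℕ → ℕ) (U : List V) : Set where
    field
      bound : ∀ i → used i ≤ sv
      to    : ∀ y → used (toℕ y) ≡ sv → y ∈ U
      from  : ∀ y → y ∈ U → used (toℕ y) ≡ sv

  record EdgeR (it : ℕ) (usedE : ℕ → ℕ) (E : List (V × V)) : Set where
    field
      bound : ∀ i → usedE i ≤ it
      to    : ∀ u v → usedE (index u v) ≡ it → Any (Same (u , v)) E
      from  : ∀ u v → Any (Same (u , v)) E → usedE (index u v) ≡ it

  record FailR (bad : ℕ) (OK : Set) : Set where
    field
      to   : bad ≡ 0 → OK
      from : OK → bad ≡ 0

  -- U and E list the vertices and edges blocked so far; OK says that no check has failed.
  record SimR (it sv bad cur cnt : ℕ) (used usedE : ℕ → ℕ) (tw : ℕ)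
              (U : List V) (E : List (V × V)) (c : V) (m tot : ℕ) (OK : Set) : Set where
    field
      vertices : UsedR sv used U
      traces   : EdgeR it usedE E
      fails    : FailR bad OK
      cur≡     : cur ≡ toℕ c
      cnt≡     : cnt ≡ m
      tw≡      : tw ≡ tot

  Sim : State → List V → List (V × V) → V → ℕ → ℕ → Set → Set
  Sim s = SimR (var s 5) (var s 6) (var s 7) (var s 9) (var s 11) (arr s 4) (arr s 5) (wvar s 1)

  mark-used : ∀ {sv used U x} x̂ → x̂ ≡ toℕ x → UsedR sv used U → UsedR sv (used [ x̂ ↦ sv ]) (x ∷ U)
  mark-used {sv} {used} {U} {x} _ refl R = record { bound = bound ; to = to ; from = from }
    where
    module R = UsedR R
    bound : ∀ i → (used [ toℕ x ↦ sv ]) i ≤ sv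
    bound i with i ≟ toℕ x
    ... | yes eq = ≤-reflexive (update-here used eq)
    ... | no ne  = ≤-trans (≤-reflexive (update-there used ne)) (R.bound i)
    to : ∀ y → (used [ toℕ x ↦ sv ]) (toℕ y) ≡ sv → y ∈ x ∷ U
    to y eq with y ≟ᵛ x
    ... | yes y≡x = here y≡x
    ... | no y≢x  = there (R.to y (trans (sym (update-there used (y≢x ∘ Fin.toℕ-injective))) eq))
    from : ∀ y → y ∈ x ∷ U → (used [ toℕ x ↦ sv ]) (toℕ y) ≡ sv
    from y y∈ with y ≟ᵛ x | y∈
    ... | yes y≡x | _         = update-here used (cong toℕ y≡x)
    ... | no y≢x  | here y≡x  = contradiction y≡x y≢x
    ... | no y≢x  | there y∈U = trans (update-there used (y≢x ∘ Fin.toℕ-injective)) (R.from y y∈U)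

  mark-edge : ∀ {it usedE E c x} e e₂ → e ≡ index c x → e₂ ≡ index x c → EdgeR it usedE E →
    EdgeR it (usedE [ e ↦ it ] [ e₂ ↦ it ]) ((c , x) ∷ E)
  mark-edge {it} {usedE} {E} {c} {x} _ _ refl refl R = record { bound = bound ; to = to ; from = from }
    where
    module R = EdgeR R
    usedE′ = usedE [ index c x ↦ it ] [ index x c ↦ it ]
    look : ∀ i → (i ≡ index x c ⊎ i ≡ index c x) × usedE′ i ≡ it ⊎ (i ≢ index x c × i ≢ index c x) × usedE′ i ≡ usedE i
    look i with i ≟ index x c | i ≟ index c x
    ... | yes eq | _      = inj₁ (inj₁ eq , update-here (usedE [ index c x ↦ it ]) eq)
    ... | no ne  | yes eq = inj₁ (inj₂ eq , trans (update-there (usedE [ index c x ↦ it ]) ne) (update-here usedE eq))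
    ... | no ne  | no ne′ = inj₂ ((ne , ne′) , trans (update-there (usedE [ index c x ↦ it ]) ne) (update-there usedE ne′))
    bound : ∀ i → usedE′ i ≤ it
    bound i with look i
    ... | inj₁ (_ , eq) = ≤-reflexive eq
    ... | inj₂ (_ , eq) = ≤-trans (≤-reflexive eq) (R.bound i)
    to : ∀ u v → usedE′ (index u v) ≡ it → Any (Same (u , v)) ((c , x) ∷ E)
    to u v eq with look (index u v)
    ... | inj₂ (_ , eq′) = there (R.to u v (trans (sym eq′) eq))
    ... | inj₁ (inj₁ i≡ , _) with index-injective {u} {v} {x} {c} i≡
    ...   | refl = here (inj₂ (refl , refl))
    to u v eq | inj₁ (inj₂ i≡ , _) with index-injective {u} {v} {c} {x} i≡
    ...   | refl = here (inj₁ (refl , refl))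
    from : ∀ u v → Any (Same (u , v)) ((c , x) ∷ E) → usedE′ (index u v) ≡ it
    from u v same with look (index u v) | same
    ... | inj₁ (_ , eq)          | _                         = eq
    ... | inj₂ ((_ , ne) , _)    | here (inj₁ (refl , refl)) = contradiction refl ne
    ... | inj₂ ((ne , _) , _)    | here (inj₂ (refl , refl)) = contradiction refl ne
    ... | inj₂ (_ , eq)          | there same′               = trans eq (R.from u v same′)

  add-check : ∀ {bad OK d} {P : Set} → (d ≡ 0 → P) → (P → d ≡ 0) → FailR bad OK → FailR (bad + d) (OK × P)
  add-check {bad} {OK} {d} f g R = record
    { to = λ eq → let b , d≡ = m+n≡0 bad d eq in FailR.to R b , f d≡ ; from = λ (ok , p) → cong₂ _+_ (FailR.from R ok) (g p) }

  adjacent-check : ∀ c x {one a} → one ≡ 1 → a ≡ bit (adj? c x) → (one ∸ a ≡ 0 → Adj c x) × (Adj c x → one ∸ a ≡ 0)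
  adjacent-check c x refl refl with adj? c x
  ... | yes e = (λ _ → e) , λ _ → refl
  ... | no ¬e = (λ ()) , λ e → contradiction e ¬e

  vertex-check : ∀ {sv used U x} x̂ {one} → one ≡ 1 → x̂ ≡ toℕ x → UsedR sv used U →
    (one ∸ (sv ∸ used x̂) ≡ 0 → x ∉ U) × (x ∉ U → one ∸ (sv ∸ used x̂) ≡ 0)
  vertex-check {x = x} _ refl refl R =
    (λ eq x∈ → stale eq (UsedR.from R x x∈)) , λ x∉ → stale⁻ (UsedR.bound R (toℕ x)) (x∉ ∘ UsedR.to R x)

  edge-check : ∀ {it usedE E c x} e {one} → one ≡ 1 → e ≡ index c x → EdgeR it usedE E →
    (one ∸ (it ∸ usedE e) ≡ 0 → ¬ Any (Same (c , x)) E) × (¬ Any (Same (c , x)) E → one ∸ (it ∸ usedE e) ≡ 0)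
  edge-check {c = c} {x} _ refl refl R =
    (λ eq same → stale eq (EdgeR.from R c x same)) , λ fresh → stale⁻ (EdgeR.bound R (index c x)) (fresh ∘ EdgeR.to R c x)

  MoveOK : List V → List (V × V) → V → V → Set → Set
  MoveOK U E c x OK = ((OK × Adj c x) × x ∉ U) × ¬ Any (Same (c , x)) E

  run-move : ∀ {s U E c m tot OK x} → Ctx s → Sim s U E c m tot OK → var s 13 ≡ toℕ x →
    Run move s 27 (λ s → Ctx s × Sim s (x ∷ U) ((c , x) ∷ E) x (suc m) (tot + wt c x) (MoveOK U E c x OK))
  run-move {s} {U} {E} {c} {m} {tot} {OK} {x} ctx S x≡ =
    run-block checkAdjacent {Q = λ s → Ctx s × Sim s U E c m tot (OK × Adj c x) × var s 13 ≡ toℕ x × var s 32 ≡ index c x}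
      (ctx , record { vertices = S.vertices ; traces = S.traces ; cur≡ = S.cur≡ ; cnt≡ = S.cnt≡ ; tw≡ = S.tw≡
                    ; fails = let f , g = adjacent-check c x C.one≡ (trans (cong (arr s 0) e≡) (C.adj≡ c x)) in add-check f g S.fails }
      , x≡ , e≡)
    then λ {s} (ctx , S , x≡ , e≡) →
    run-block checkVertex {Q = λ s → Ctx s × Sim s (x ∷ U) E c m tot ((OK × Adj c x) × x ∉ U) × var s 13 ≡ toℕ x × var s 32 ≡ index c x}
      (let module T = SimR S in
       ctx , record { vertices = mark-used _ x≡ T.vertices ; traces = T.traces ; cur≡ = T.cur≡ ; cnt≡ = T.cnt≡ ; tw≡ = T.tw≡
                    ; fails = let f , g = vertex-check (var s 13) (CtxR.one≡ ctx) x≡ T.vertices in add-check f g T.fails }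
      , x≡ , e≡)
    then λ {s} (ctx , S , x≡ , e≡) →
    run-block checkEdge {Q = λ s → Ctx s × Sim s (x ∷ U) E c m tot (MoveOK U E c x OK) × var s 13 ≡ toℕ x × var s 32 ≡ index c x}
      (let module T = SimR S in
       ctx , record { vertices = T.vertices ; traces = T.traces ; cur≡ = T.cur≡ ; cnt≡ = T.cnt≡ ; tw≡ = T.tw≡
                    ; fails = let f , g = edge-check (var s 32) (CtxR.one≡ ctx) e≡ T.traces in add-check f g T.fails }
      , x≡ , e≡)
    then λ {s} (ctx , S , x≡ , e≡) →
    run-block markEdge {Q = λ s → Ctx s × Sim s (x ∷ U) ((c , x) ∷ E) c m tot (MoveOK U E c x OK) × var s 13 ≡ toℕ x × var s 32 ≡ index c x}
      (let module T = SimR S in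
       ctx , record { vertices = T.vertices ; fails = T.fails ; cur≡ = T.cur≡ ; cnt≡ = T.cnt≡ ; tw≡ = T.tw≡
                    ; traces = mark-edge (var s 32) (arr s 1 (var s 13) + var s 9) e≡
                        (cong₂ _+_ (trans (cong (arr s 1) x≡) (CtxR.off≡ ctx x)) T.cur≡) T.traces }
      , x≡ , e≡)
    then λ {s} (ctx , S , x≡ , e≡) →
    run-block arrive
      (let module T = SimR S in
       ctx , record { vertices = T.vertices ; fails = T.fails ; traces = T.traces
                    ; cur≡ = trans (cong₂ _+_ x≡ (CtxR.zero≡ ctx)) (+-identityʳ (toℕ x))
                    ; cnt≡ = trans (cong₂ _+_ T.cnt≡ (CtxR.one≡ ctx)) (+-comm m 1)
                    ; tw≡ = cong₂ _+_ T.tw≡ (trans (cong (warr s 0) e≡) (CtxR.wt≡ ctx c x)) })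
    where
    module C = CtxR ctx
    module S = SimR S
    e≡ : arr s 1 (var s 9) + var s 13 ≡ index c x
    e≡ = cong₂ _+_ (trans (cong (arr s 1) S.cur≡) (C.off≡ c)) x≡

-- Bellman–Ford

testAdjacent testRow testColumn testFinite candidate compare! improve startTable : List Instr
testAdjacent = load! 32 1 28 ∷ add! 32 32 29 ∷ load! 19 0 32 ∷ monus! 14 2 19 ∷ []
testRow      = load! 19 3 28 ∷ monus! 19 5 19 ∷ monus! 19 2 19 ∷ add! 14 14 19 ∷ []
testColumn   = load! 19 3 29 ∷ monus! 19 5 19 ∷ monus! 19 2 19 ∷ add! 14 14 19 ∷ []
testFinite   = load! 19 6 29 ∷ monus! 19 15 19 ∷ add! 14 14 19 ∷ []
candidate    = wload! 2 0 32 ∷ wload! 3 1 29 ∷ wadd! 3 2 3 ∷ load! 14 6 28 ∷ monus! 14 15 14 ∷ []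
compare!     = wload! 2 1 28 ∷ wleq! 14 2 3 ∷ []
improve      = wstore! 3 1 28 ∷ store! 15 6 28 ∷ store! 29 7 28 ∷ []
startTable   = add! 15 15 2 ∷ store! 15 6 12 ∷ wstore! 4 1 12 ∷ []

relax row round bellmanFord : Program
relax = block testAdjacent ⨾ block testRow ⨾ block testColumn ⨾ block testFinite ⨾
        ifnz 14 skip
          (block candidate ⨾ ifnz 14 (block improve) (block compare! ⨾ ifnz 14 skip (block improve)))
row         = instr (const! 29 0) ⨾ loop 25 0 (relax ⨾ instr (add! 29 29 2)) ⨾ instr (add! 28 28 2)
round       = instr (const! 28 0) ⨾ loop 24 0 row
bellmanFord = block startTable ⨾ loop 23 0 round

module Distances (I : Instance) (M : ℕ) where
  open Base I
  open Routes I
  open Machine I M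

  -- An entry is finite if it carries the stamp `fs`. `nx<` includes stale next hops, so that even a
  -- wrong guess moves to some vertex and the tracing stays meaningful.
  record TabR (fs : ℕ) (fin nx : ℕ → ℕ) (d : ℕ → ℕ) (X : List V) (t : V) : Set where
    field
      fin≤  : ∀ i → fin i ≤ fs
      nx<   : ∀ i → nx i < n
      sound : ∀ u → fin (toℕ u) ≡ fs → ∃[ Q ] Walk (Away X) u Q t × len u Q ≤ d (toℕ u) ×
                (u ≢ t → ∃[ y ] ∃[ Q′ ] Q ≡ y ∷ Q′ × nx (toℕ u) ≡ toℕ y)

  Table : State → List V → V → Set
  Table s X t = Ctx s × UsedR (var s 5) (arr s 3) X × TabR (var s 15) (arr s 6) (arr s 7) (warr s 1) X t

  Has : State → V → ℕ → Set
  Has s u b = arr s 6 (toℕ u) ≡ var s 15 × warr s 1 (toℕ u) ≤ b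

  _⊑_ : State → State → Set
  s ⊑ s′ = ∀ v b → Has s v b → Has s′ v b

  At : State → V → V → Set
  At s u x = var s 28 ≡ toℕ u × var s 29 ≡ toℕ x

  Relaxed : State → List V → V → V → State → Set
  Relaxed s X u x s′ = s ⊑ s′ × (Away X u x → ∀ b → Has s x b → Has s′ u (wt u x + b))

  run-improve : ∀ {s₀ s X t u x} → Table s X t → s₀ ⊑ s → At s u x → Away X u x → Has s x (warr s 1 (toℕ x)) →
    (∀ b → Has s₀ x b → warr s 1 (toℕ x) ≤ b) →
    wvar s 3 ≡ wt u x + warr s 1 (toℕ x) → (arr s 6 (toℕ u) ≡ var s 15 → wvar s 3 ≤ warr s 1 (toℕ u)) →
    Run (block improve) s 4 (λ s′ → Table s′ X t × Relaxed s₀ X u x s′)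
  run-improve {s₀} {s} {X} {t} {u} {x} (ctx , inX , T) ⊑s (u≡ , x≡) a (x-fin , _) best cand≡ better =
    run-block improve
      ((ctx , inX , record { fin≤ = fin≤ ; nx< = nx< ; sound = sound }) ,
       (λ v b h → grows v b (⊑s v b h)) ,
       λ _ b h → here-fin u refl , ≤-trans (≤-reflexive (trans (here-d u refl) cand≡)) (+-monoʳ-≤ (wt u x) (best b h)))
    where
    module T = TabR T
    fs = var s 15
    fin′ nx′ d′ : ℕ → ℕ
    fin′ = arr s 6 [ var s 28 ↦ var s 15 ]
    nx′ = arr s 7 [ var s 28 ↦ var s 29 ]
    d′ = warr s 1 [ var s 28 ↦ wvar s 3 ]
    here-fin : ∀ v → v ≡ u → fin′ (toℕ v) ≡ fs
    here-fin v refl = update-here (arr s 6) (sym u≡)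
    here-d : ∀ v → v ≡ u → d′ (toℕ v) ≡ wvar s 3
    here-d v refl = update-here (warr s 1) (sym u≡)
    off : ∀ {v} → v ≢ u → toℕ v ≢ var s 28
    off v≢u eq = v≢u (Fin.toℕ-injective (trans eq u≡))
    fin≤ : ∀ i → fin′ i ≤ fs
    fin≤ i with i ≟ var s 28
    ... | yes eq = ≤-reflexive (update-here (arr s 6) eq)
    ... | no ne  = ≤-trans (≤-reflexive (update-there (arr s 6) ne)) (T.fin≤ i)
    nx< : ∀ i → nx′ i < n
    nx< i with i ≟ var s 28
    ... | yes eq = subst (_< n) (sym (trans (update-here (arr s 7) eq) x≡)) (Fin.toℕ<n x)
    ... | no ne  = subst (_< n) (sym (update-there (arr s 7) ne)) (T.nx< i)
    sound : ∀ v → fin′ (toℕ v) ≡ fs → ∃[ Q ] Walk (Away X) v Q t × len v Q ≤ d′ (toℕ v) ×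
              (v ≢ t → ∃[ y ] ∃[ Q′ ] Q ≡ y ∷ Q′ × nx′ (toℕ v) ≡ toℕ y)
    sound v eq with v ≟ᵛ u
    ... | yes refl with T.sound x x-fin
    ...   | Q , p , le , _ = x ∷ Q , cons a p , ≤-trans (+-monoʳ-≤ (wt u x) le) (≤-reflexive (sym (trans (here-d u refl) cand≡))) ,
              λ _ → x , Q , refl , trans (update-here (arr s 7) (sym u≡)) x≡
    sound v eq | no v≢u with T.sound v (trans (sym (update-there (arr s 6) (off v≢u))) eq)
    ...   | Q , p , le , first = Q , p , ≤-trans le (≤-reflexive (sym (update-there (warr s 1) (off v≢u)))) ,
              λ v≢t → let y , Q′ , eq , eq′ = first v≢t in y , Q′ , eq , trans (update-there (arr s 7) (off v≢u)) eq′
    grows : ∀ v b → Has s v b → fin′ (toℕ v) ≡ fs × d′ (toℕ v) ≤ b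
    grows v b (f , d≤) with v ≟ᵛ u
    ... | yes refl = here-fin u refl , ≤-trans (≤-reflexive (here-d u refl)) (≤-trans (better f) d≤)
    ... | no v≢u   = trans (update-there (arr s 6) (off v≢u)) f , ≤-trans (≤-reflexive (update-there (warr s 1) (off v≢u))) d≤

  relaxCost : ℕ
  relaxCost = 100

  run-relax : ∀ {s X t u x} → Table s X t → At s u x → Run relax s relaxCost (λ s′ → Table s′ X t × Relaxed s X u x s′)
  run-relax {s₀} {X} {t} {u} {x} (ctx₀ , inX₀ , T₀) at₀@(u≡₀ , x≡₀) = weaken (≤ᵇ⇒≤ _ _ _) id (
    run-block testAdjacent {Q = λ s → Table s X t × At s u x × s₀ ⊑ s × var s 32 ≡ index u x × FailR (var s 14) (Adj u x)}
      ((ctx₀ , inX₀ , T₀) , at₀ , (λ _ _ h → h) , e≡ , adjacent)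
    then λ {s} (T@(ctx , inX , tab) , at@(u≡ , x≡) , ⊑s , e≡ , F) →
    run-block testRow {Q = λ s → Table s X t × At s u x × s₀ ⊑ s × var s 32 ≡ index u x × FailR (var s 14) (Adj u x × u ∉ X)}
      (T , at , ⊑s , e≡ , (let f , g = vertex-check {x = u} (var s 28) (CtxR.one≡ ctx) u≡ inX in add-check f g F))
    then λ {s} (T@(ctx , inX , tab) , at@(u≡ , x≡) , ⊑s , e≡ , F) →
    run-block testColumn {Q = λ s → Table s X t × At s u x × s₀ ⊑ s × var s 32 ≡ index u x × FailR (var s 14) ((Adj u x × u ∉ X) × x ∉ X)}
      (T , at , ⊑s , e≡ , (let f , g = vertex-check {x = x} (var s 29) (CtxR.one≡ ctx) x≡ inX in add-check f g F))
    then λ {s} (T@(ctx , inX , tab) , at@(u≡ , x≡) , ⊑s , e≡ , F) →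
    run-block testFinite {Q = λ s → Table s X t × At s u x × s₀ ⊑ s × var s 32 ≡ index u x ×
                                    FailR (var s 14) (((Adj u x × u ∉ X) × x ∉ X) × arr s 6 (toℕ x) ≡ var s 15)}
      (T , at , ⊑s , e≡ , add-check {d = var s 15 ∸ arr s 6 (var s 29)}
         (λ eq → ≤-antisym (TabR.fin≤ tab _) (subst (λ z → var s 15 ≤ arr s 6 z) x≡ (m∸n≡0⇒m≤n eq)))
         (λ eq → m≤n⇒m∸n≡0 (≤-reflexive (sym (trans (cong (arr s 6) x≡) eq)))) F)
    then λ {s} (T , at , ⊑s , e≡ , F) →
    run-ifnz
      (λ ≢0 → run-skip (T , ⊑s , λ (e , u∉ , x∉) b h → contradiction (FailR.from F (((e , u∉) , x∉) , proj₁ (⊑s x b h))) ≢0))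
      (λ ≡0 → update T at ⊑s e≡ (FailR.to F ≡0)))
    where
    e≡ : arr s₀ 1 (var s₀ 28) + var s₀ 29 ≡ index u x
    e≡ = cong₂ _+_ (trans (cong (arr s₀ 1) u≡₀) (CtxR.off≡ ctx₀ u)) x≡₀
    adjacent : FailR (var s₀ 2 ∸ arr s₀ 0 (arr s₀ 1 (var s₀ 28) + var s₀ 29)) (Adj u x)
    adjacent = let f , g = adjacent-check u x (CtxR.one≡ ctx₀) (trans (cong (arr s₀ 0) e≡) (CtxR.adj≡ ctx₀ u x))
               in record { to = f ; from = g }
    update : ∀ {s} → Table s X t → At s u x → s₀ ⊑ s → var s 32 ≡ index u x →
      ((Adj u x × u ∉ X) × x ∉ X) × arr s 6 (toℕ x) ≡ var s 15 →
      Run (block candidate ⨾ ifnz 14 (block improve) (block compare! ⨾ ifnz 14 skip (block improve))) s 20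
        (λ s′ → Table s′ X t × Relaxed s₀ X u x s′)
    update {s} T at ⊑s e≡ (((e , u∉) , x∉) , fin≡) =
      run-block candidate {Q = λ s → Table s X t × At s u x × s₀ ⊑ s × arr s 6 (toℕ x) ≡ var s 15 ×
                                     wvar s 3 ≡ wt u x + warr s 1 (toℕ x) × var s 14 ≡ var s 15 ∸ arr s 6 (toℕ u)}
        (T , at , ⊑s , fin≡ ,
         cong₂ _+_ (trans (cong (warr s 0) e≡) (CtxR.wt≡ (proj₁ T) u x)) (cong (warr s 1) (proj₂ at)) ,
         cong (λ z → var s 15 ∸ arr s 6 z) (proj₁ at))
      then λ {s} (T@(_ , _ , tab) , at , ⊑s , fin≡ , cand≡ , far≡) →
      run-ifnz
        (λ ≢0 → run-improve {s₀ = s₀} T ⊑s at (e , u∉ , x∉) (fin≡ , ≤-refl) (λ b h → proj₂ (⊑s x b h)) cand≡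
                  λ eq → contradiction (trans far≡ (m≤n⇒m∸n≡0 (≤-reflexive (sym eq)))) ≢0)
        (λ ≡0 →
          run-block compare! {Q = λ s → Table s X t × At s u x × s₀ ⊑ s × arr s 6 (toℕ x) ≡ var s 15 ×
                                        wvar s 3 ≡ wt u x + warr s 1 (toℕ x) × arr s 6 (toℕ u) ≡ var s 15 ×
                                        var s 14 ≡ bit (warr s 1 (toℕ u) ≤? wvar s 3)}
            (T , at , ⊑s , fin≡ , cand≡ ,
             ≤-antisym (TabR.fin≤ tab _) (m∸n≡0⇒m≤n (trans (sym far≡) ≡0)) ,
             cong (λ z → bit (warr s 1 z ≤? wvar s 3)) (proj₁ at))
          then λ {s} (T , at , ⊑s , fin≡ , cand≡ , ufin , leq≡) →
          run-ifnz
            (λ ≢0 → run-skip (T , ⊑s , λ _ b h → ufin , ≤-trans (known (warr s 1 (toℕ u) ≤? wvar s 3) leq≡ ≢0) (≤-trans (≤-reflexive cand≡) (+-monoʳ-≤ (wt u x) (proj₂ (⊑s x b h))))))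
            (λ ≡0 → run-improve {s₀ = s₀} T ⊑s at (e , u∉ , x∉) (fin≡ , ≤-refl) (λ b h → proj₂ (⊑s x b h)) cand≡ λ _ → unknown (warr s 1 (toℕ u) ≤? wvar s 3) leq≡ ≡0))
      where
      known : ∀ {z} {P : Set} (d : Dec P) → z ≡ bit d → z ≢ 0 → P
      known (yes p) _  _  = p
      known (no _)  eq ≢0 = contradiction eq ≢0
      unknown : ∀ {z a b} (d : Dec (a ≤ b)) → z ≡ bit d → z ≡ 0 → b ≤ a
      unknown (yes _) eq ≡0 = case trans (sym eq) ≡0 of λ ()
      unknown (no ≰)  _  _  = <⇒≤ (≰⇒> ≰)

  -- Only an upper bound: the table is updated in place, so a relaxation may already use entries
  -- improved in the same round and reflect longer walks.
  Within : ℕ → State → List V → V → Set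
  Within r s X t = ∀ {c Q} → Walk (Away X) c Q t → length Q ≤ r → Has s c (len c Q)

  -- Edges u x whose relaxation in the current round is complete.
  Relaxes : ℕ → State → List V → V → V → V → Set
  Relaxes r s X t u x = Away X u x → ∀ Q → Walk (Away X) x Q t → length Q ≤ r → Has s u (wt u x + len x Q)

  RowInv : ℕ → List V → V → V → ℕ → State → Set
  RowInv r X t u b s = Table s X t × var s 28 ≡ toℕ u × var s 29 ≡ b × Within r s X t ×
    (∀ v x → toℕ v < toℕ u → Relaxes r s X t v x) × (∀ x → toℕ x < b → Relaxes r s X t u x)

  RoundInv : ℕ → List V → V → ℕ → State → Set
  RoundInv r X t a s = Table s X t × var s 28 ≡ a × Within r s X t × (∀ v x → toℕ v < a → Relaxes r s X t v x)

  rowCost roundCost bfCost : ℕ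
  rowCost   = 1 + (loopCost n (relaxCost + 1) + 1)
  roundCost = 1 + loopCost n rowCost
  bfCost    = 4 + loopCost n roundCost

  one-of : ∀ {s X t} → Table s X t → var s 2 ≡ 1
  one-of (ctx , _) = CtxR.one≡ ctx

  run-row : ∀ {r X t a s} → a < n → RoundInv r X t a s → Run row s rowCost (RoundInv r X t (suc a))
  run-row {r} {X} {t} {a} {s₀} a<n (T , row≡ , within , prior) =
    run-instr (const! 29 0) {Q = RowInv r X t u 0} (T , trans row≡ (sym u≡) , refl , within , (λ v x lt → prior v x (subst (toℕ v <_) u≡ lt)) , λ _ ())
    then λ {s} I@(T@(ctx , _) , _) →
    run-loop (RowInv r X t u) refl refl refl (λ _ inv → inv) n body (CtxR.one≡ ctx) (CtxR.zero≡ ctx) (CtxR.n≡ ctx) I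
    then λ {s} (T , row≡ , col≡ , within , above , prior) →
    run-instr (add! 28 28 2)
      (T , trans (cong₂ _+_ (trans row≡ u≡) (one-of {s} {X} {t} T)) (+-comm a 1) , within ,
       λ v x lt → case m≤n⇒m<n∨m≡n (s≤s⁻¹ lt) of λ
         { (inj₁ lt′) → above v x (subst (toℕ v <_) (sym u≡) lt′)
         ; (inj₂ eq)  → subst (λ v → Relaxes r s X t v x) (Fin.toℕ-injective (trans u≡ (sym eq))) (prior x (Fin.toℕ<n x)) })
    where
    u : V
    u = fromℕ< a<n
    u≡ : toℕ u ≡ a
    u≡ = Fin.toℕ-fromℕ< a<n
    body : ∀ {b s} → b < n → var s 2 ≡ 1 → RowInv r X t u b s → Run (relax ⨾ instr (add! 29 29 2)) s (relaxCost + 1) (RowInv r X t u (suc b))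
    body {b} {s} b<n _ (T , row≡ , col≡ , within , above , prior) =
      (run-relax {s} {X} {t} {u} {x} T (row≡ , trans col≡ (sym x≡)) framed)
      then λ {s′} ((T′ , ⊑s , new) , kept) →
      run-instr (add! 29 29 2)
        (T′ , trans (Kept.vars kept 28 refl) row≡ , trans (cong₂ _+_ (trans (Kept.vars kept 29 refl) col≡) (one-of {s′} {X} {t} T′)) (+-comm b 1) ,
         (λ p le → ⊑s _ _ (within p le)) , (λ v y lt e Q p le → ⊑s _ _ (above v y lt e Q p le)) ,
         λ y lt → case m≤n⇒m<n∨m≡n (s≤s⁻¹ lt) of λ
           { (inj₁ lt′) → λ e Q p le → ⊑s _ _ (prior y lt′ e Q p le)
           ; (inj₂ eq)  → subst (Relaxes r s′ X t u) (Fin.toℕ-injective (trans x≡ (sym eq))) λ e Q p le → new e _ (within p le) })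
      where
      x : V
      x = fromℕ< b<n
      x≡ : toℕ x ≡ b
      x≡ = Fin.toℕ-fromℕ< b<n

  run-round : ∀ {r X t s} → Table s X t → Within r s X t → Run round s roundCost (λ s → Table s X t × Within (suc r) s X t)
  run-round {r} {X} {t} T within =
    run-instr (const! 28 0) {Q = RoundInv r X t 0} (T , refl , within , λ _ _ ())
    then λ {s} I@((ctx , _) , _) →
    weaken ≤-refl (λ {s} → finish {s})
      (run-loop (RoundInv r X t) refl refl refl (λ _ inv → inv) n (λ {a} {s} a<n _ inv → run-row {s = s} a<n inv) (CtxR.one≡ ctx) (CtxR.zero≡ ctx) (CtxR.n≡ ctx) I)
    where
    finish : ∀ {s} → RoundInv r X t n s → Table s X t × Within (suc r) s X t
    finish {s} (T , _ , within , prior) = T , longer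
      where
      longer : Within (suc r) s X t
      longer nil        le       = within nil z≤n
      longer (cons {x = x} e p) (s≤s le) = prior _ x (Fin.toℕ<n _) e _ p le

  -- Raising the distance stamp makes all old distances infinite without a pass over the table.
  -- After `n` rounds every walk with at most `n` moves is accounted for, in particular every forced
  -- path of an encoding.
  run-bellmanFord : ∀ {s X t} → Ctx s → UsedR (var s 5) (arr s 3) X → (∀ i → arr s 6 i ≤ var s 15) → (∀ i → arr s 7 i < n) →
    var s 12 ≡ toℕ t → Run bellmanFord s bfCost (λ s → Table s X t × Within n s X t)
  run-bellmanFord {s} {X} {t} ctx inX fin≤ nx< t≡ =
    run-block startTable {Q = λ s → Table s X t × Within 0 s X t} ((ctx , inX , table) , start)
    then λ (T@(ctx , _) , W) →
    run-loop (λ r s → Table s X t × Within r s X t) refl refl refl (λ _ inv → inv) n (λ {r} {s} _ _ (T , W) → run-round {r} {X} {t} {s} T W)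
      (CtxR.one≡ ctx) (CtxR.zero≡ ctx) (CtxR.n≡ ctx) (T , W)
    where
    fs′ = var s 15 + var s 2
    fin′ d′ : ℕ → ℕ
    fin′ = arr s 6 [ var s 12 ↦ fs′ ]
    d′ = warr s 1 [ var s 12 ↦ wvar s 4 ]
    fresh : ∀ i → arr s 6 i < fs′
    fresh i = ≤-trans (s≤s (fin≤ i)) (≤-reflexive (trans (+-comm 1 (var s 15)) (cong (var s 15 +_) (sym (CtxR.one≡ ctx)))))
    table : TabR fs′ fin′ (arr s 7) d′ X t
    table = record { fin≤ = bounded ; nx< = nx< ; sound = sound }
      where
      bounded : ∀ i → fin′ i ≤ fs′
      bounded i with i ≟ var s 12
      ... | yes eq = ≤-reflexive (update-here (arr s 6) eq)
      ... | no ne  = ≤-trans (≤-reflexive (update-there (arr s 6) ne)) (<⇒≤ (fresh i))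
      sound : ∀ u → fin′ (toℕ u) ≡ fs′ → ∃[ Q ] Walk (Away X) u Q t × len u Q ≤ d′ (toℕ u) ×
                (u ≢ t → ∃[ y ] ∃[ Q′ ] Q ≡ y ∷ Q′ × arr s 7 (toℕ u) ≡ toℕ y)
      sound u eq with u ≟ᵛ t
      ... | yes refl = [] , nil , z≤n , λ ≢t → contradiction refl ≢t
      ... | no u≢t   = contradiction (trans (sym (update-there (arr s 6) λ eq → u≢t (Fin.toℕ-injective (trans eq t≡)))) eq) (<⇒≢ (fresh (toℕ u)))
    start : ∀ {c Q} → Walk (Away X) c Q t → length Q ≤ 0 → fin′ (toℕ c) ≡ fs′ × d′ (toℕ c) ≤ len c Q
    start nil _ = update-here (arr s 6) (sym t≡) , ≤-trans (≤-reflexive (trans (update-here (warr s 1) (sym t≡)) (CtxR.wz≡ ctx))) z≤n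

  -- The entry is at most the length of the forced path, and some walk no longer than the entry
  -- begins with the recorded next hop. Such a walk has to begin like the forced path.
  forced-hop : ∀ {s X t c x P} → Table s X t → Within n s X t → Forced X t c (x ∷ P) → length (x ∷ P) ≤ n → arr s 7 (toℕ c) ≡ toℕ x
  forced-hop (_ , _ , tab) within (hop c≢t p only _) le with within p le
  ... | fin , d≤ with TabR.sound tab _ fin
  ...   | Q , q , len≤ , first with first c≢t
  ...     | y , Q′ , refl , nx≡ = trans nx≡ (cong toℕ (only q (≤-trans len≤ d≤)))

-- Following a guess

nextDigit : ℕ → List Instr
nextDigit x = load! x 2 8 ∷ add! 8 8 2 ∷ []

differ : List Instr
differ = monus! 14 9 12 ∷ monus! 19 12 9 ∷ add! 14 14 19 ∷ []

hop! edgeStep pair : Program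
hop!     = block differ ⨾ ifnz 14 (instr (load! 13 7 9) ⨾ move) skip
edgeStep = block differ ⨾ ifnz 14 (instr (add! 13 12 31) ⨾ move) skip
pair     = block (nextDigit 12) ⨾ edgeStep ⨾ block (nextDigit 12) ⨾ bellmanFord ⨾ loop 26 0 hop!

data Reads {V : Set} (δ : ℕ → V) : ℕ → List V → Set where
  []  : ∀ {p} → Reads δ p []
  _∷_ : ∀ {p x xs} → δ p ≡ x → Reads δ (suc p) xs → Reads δ p (x ∷ xs)

distance≡0 : ∀ a b → (a ∸ b) + (b ∸ a) ≡ 0 → a ≡ b
distance≡0 a b eq = let p , q = m+n≡0 (a ∸ b) (b ∸ a) eq in ≤-antisym (m∸n≡0⇒m≤n p) (m∸n≡0⇒m≤n q)

distance-refl : ∀ a → (a ∸ a) + (a ∸ a) ≡ 0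
distance-refl a = cong₂ _+_ (n∸n≡0 a) (n∸n≡0 a)

moveCost hopCost edgeCost : ℕ
moveCost = 27
hopCost  = 4 + suc (1 + moveCost + 1)
edgeCost = hopCost

pairCost : Instance → ℕ → ℕ
pairCost I M = 3 + (edgeCost + (3 + (Distances.bfCost I M + loopCost (Instance.n I) hopCost)))

module Following (I : Instance) (M : ℕ) (X : List (Fin (Instance.n I))) (δ : ℕ → Fin (Instance.n I)) where
  open Base I
  open Routes I
  open Machine I M
  open Distances I M

  record EnvR (v5 v15 : ℕ) (a2 a3 a6 a7 : ℕ → ℕ) : Set where
    field
      digits : ∀ i → a2 i ≡ toℕ (δ i)
      inX    : UsedR v5 a3 X
      fin≤   : ∀ i → a6 i ≤ v15
      nx<    : ∀ i → a7 i < n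

  Env : State → Set
  Env s = Ctx s × EnvR (var s 5) (var s 15) (arr s 2) (arr s 3) (arr s 6) (arr s 7)

  record TargetR (t : V) (v12 v15 : ℕ) (a6 a7 x1 : ℕ → ℕ) : Set where
    field
      target : v12 ≡ toℕ t
      table  : TabR v15 a6 a7 x1 X t
      within : ∀ {c Q} → Walk (Away X) c Q t → length Q ≤ n → a6 (toℕ c) ≡ v15 × x1 (toℕ c) ≤ len c Q

  Target : V → State → Set
  Target t s = TargetR t (var s 12) (var s 15) (arr s 6) (arr s 7) (warr s 1)

  keep-env : ∀ {v5 v5′ v15 v15′ a2 a2′ a3 a3′ a6 a6′ a7 a7′} → v5′ ≡ v5 → v15′ ≡ v15 → a2′ ≡ a2 → a3′ ≡ a3 → a6′ ≡ a6 → a7′ ≡ a7 →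
    EnvR v5 v15 a2 a3 a6 a7 → EnvR v5′ v15′ a2′ a3′ a6′ a7′
  keep-env refl refl refl refl refl refl E = E

  keep-target : ∀ {t v12 v12′ v15 v15′ a6 a6′ a7 a7′ x1 x1′} → v12′ ≡ v12 → v15′ ≡ v15 → a6′ ≡ a6 → a7′ ≡ a7 → x1′ ≡ x1 →
    TargetR t v12 v15 a6 a7 x1 → TargetR t v12′ v15′ a6′ a7′ x1′
  keep-target refl refl refl refl refl T = T

  keep-sim : ∀ {it it′ sv sv′ bad bad′ cur cur′ cnt cnt′ used used′ usedE usedE′ tw tw′ U E c m tot OK} →
    it′ ≡ it → sv′ ≡ sv → bad′ ≡ bad → cur′ ≡ cur → cnt′ ≡ cnt → used′ ≡ used → usedE′ ≡ usedE → tw′ ≡ tw →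
    SimR it sv bad cur cnt used usedE tw U E c m tot OK → SimR it′ sv′ bad′ cur′ cnt′ used′ usedE′ tw′ U E c m tot OK
  keep-sim refl refl refl refl refl refl refl refl S = S

  module _ (U₀ : List V) (E₀ : List (V × V)) (c₀ : V) (tot₀ : ℕ) (OK₀ : Set) where

    -- Moves are listed newest first.
    top : List V → V
    top []      = c₀
    top (x ∷ _) = x

    trail : List V → List (V × V)
    trail []        = E₀
    trail (x ∷ rms) = (top rms , x) ∷ trail rms

    sofar : List V → ℕ
    sofar []        = tot₀
    sofar (x ∷ rms) = sofar rms + wt (top rms) x

    valid : List V → Set
    valid []        = OK₀
    valid (x ∷ rms) = MoveOK (rms ++ U₀) (trail rms) (top rms) x (valid rms)

    SimP : State → List V → Set
    SimP s rms = Sim s (rms ++ U₀) (trail rms) (top rms) (length rms) (sofar rms) (valid rms)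

    run-step : ∀ {s rms x} → Env s → SimP s rms → var s 13 ≡ toℕ x →
      Run move s moveCost (λ s′ → (Env s′ × SimP s′ (x ∷ rms)) × Kept move s s′)
    run-step {s} {rms} {x} (ctx , E) S x≡ = weaken ≤-refl
      (λ ((ctx , S) , kept) → let open Kept kept in
        ((ctx , keep-env (vars 5 refl) (vars 15 refl) (arrs 2 refl) (arrs 3 refl) (arrs 6 refl) (arrs 7 refl) E) , S) , kept)
      (run-move ctx S x≡ framed)

    -- The record of moves and checks holds for every guess. The last clause is conditional: if a
    -- forced path starts where the hops started, then the moves made so far are a prefix of it, and
    -- the rest fits into the remaining rounds.
    Follows : V → List V → ℕ → State → Set
    Follows t rms₀ j s = Env s × Target t s × Σ[ rms ∈ List V ] SimP s rms ×
      (∀ P → Forced X t (top rms₀) P → length P ≤ n →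
        ∃[ P′ ] Forced X t (top rms) P′ × P′ ʳ++ rms ≡ P ʳ++ rms₀ × j + length P′ ≤ n)

    advance : ∀ {t rms j s y} → Env s → Target t s → top rms ≢ t → arr s 7 (toℕ (top rms)) ≡ toℕ y →
      ∀ {target-moves} → ∃[ P ] Forced X t (top rms) P × P ʳ++ rms ≡ target-moves × j + length P ≤ n →
      ∃[ P ] Forced X t y P × P ʳ++ (y ∷ rms) ≡ target-moves × suc j + length P ≤ n
    advance _ _ c≢t _ (_ , stop , _) = contradiction refl c≢t
    advance {t} {rms} {j} {s} (ctx , E) T c≢t nx≡ (x ∷ P , f@(hop _ _ _ f′) , eq , le)
      with Fin.toℕ-injective (trans (sym nx≡) (forced-hop {s} (ctx , EnvR.inX E , TargetR.table T) (TargetR.within T) f (≤-trans (m≤n+m _ j) le)))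
    ... | refl = P , f′ , eq , subst (_≤ n) (+-suc j (length P)) le

    -- At its target a forced path is empty, because `hop` requires `c ≢ t`; so the remaining rounds
    -- change nothing.
    stay : ∀ {t rms j} → top rms ≡ t → j < n →
      ∀ {target-moves} → ∃[ P ] Forced X t (top rms) P × P ʳ++ rms ≡ target-moves × j + length P ≤ n →
      ∃[ P ] Forced X t (top rms) P × P ʳ++ rms ≡ target-moves × suc j + length P ≤ n
    stay {j = j} c≡t j<n (_ , stop , eq , le) = [] , stop , eq , subst (_≤ n) (sym (cong suc (+-identityʳ j))) j<n
    stay c≡t j<n (_ , hop c≢t _ _ _ , _) = contradiction c≡t c≢t

    apart : ∀ {s} {t c : V} → var s 9 ≡ toℕ c → var s 12 ≡ toℕ t → var s 14 ≡ (var s 9 ∸ var s 12) + (var s 12 ∸ var s 9) →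
      (var s 14 ≢ 0 → c ≢ t) × (var s 14 ≡ 0 → c ≡ t)
    apart {s} {t} {c} c≡ t≡ d≡ =
      (λ { ≢0 refl → ≢0 (trans d≡ (subst (λ z → (var s 9 ∸ z) + (z ∸ var s 9) ≡ 0) (trans c≡ (sym t≡)) (distance-refl (var s 9)))) }) ,
      λ ≡0 → Fin.toℕ-injective (trans (sym c≡) (trans (distance≡0 (var s 9) (var s 12) (trans (sym d≡) ≡0)) t≡))

    run-hop : ∀ {t rms₀ j s} → j < n → Follows t rms₀ j s → Run hop! s hopCost (Follows t rms₀ (suc j))
    run-hop {t} {rms₀} {j} {s} j<n (env , T , rms , S , follow) =
      run-block differ {Q = λ s → Env s × Target t s × SimP s rms × var s 14 ≡ (var s 9 ∸ var s 12) + (var s 12 ∸ var s 9)}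
        (env , T , S , refl)
      then λ {s} (env , T , S , diff≡) →
      let y  = fromℕ< (EnvR.nx< (proj₂ env) (var s 9))
          y≡ = Fin.toℕ-fromℕ< (EnvR.nx< (proj₂ env) (var s 9))
          go , end = apart {s} (SimR.cur≡ S) (TargetR.target T) diff≡
      in run-ifnz
        (λ ≢0 →
          run-instr (load! 13 7 9) {Q = λ s → Env s × Target t s × SimP s rms × var s 13 ≡ toℕ y} (env , T , S , sym y≡)
          then λ {s′} (env′ , T′ , S′ , x≡) →
          weaken ≤-refl
            (λ ((env″ , S″) , kept) → let open Kept kept in
              env″ , keep-target (vars 12 refl) (vars 15 refl) (arrs 6 refl) (arrs 7 refl) (warrs 1 refl) T′ , y ∷ rms , S″ ,
              λ P f P≤n → advance {rms = rms} {j} {s} env T (go ≢0) (trans (sym (cong (arr s 7) (SimR.cur≡ S))) (sym y≡)) (follow P f P≤n))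
            (run-step {rms = rms} env′ S′ x≡))
        (λ ≡0 → run-skip (env , T , rms , S , λ P f P≤n → stay {rms = rms} (end ≡0) j<n (follow P f P≤n)))

    Edged : V → List V → State → Set
    Edged t rms₀ s = Env s × var s 12 ≡ toℕ t × SimP s (edgeMove (top rms₀) t ʳ++ rms₀)

    run-edgeStep : ∀ {t rms s} → Env s → SimP s rms → var s 12 ≡ toℕ t →
      Run edgeStep s edgeCost (λ s′ → Edged t rms s′ × Kept edgeStep s s′)
    run-edgeStep {t} {rms} {s} env S t≡ = run′ framed
      where
      run′ : Run edgeStep s edgeCost (Edged t rms)
      run′ =
        run-block differ {Q = λ s → Env s × var s 12 ≡ toℕ t × SimP s rms × var s 14 ≡ (var s 9 ∸ var s 12) + (var s 12 ∸ var s 9)}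
          (env , t≡ , S , refl)
        then λ {s} (env , t≡ , S , diff≡) →
        let go , end = apart {s} (SimR.cur≡ S) t≡ diff≡ in run-ifnz
          (λ ≢0 →
            run-instr (add! 13 12 31) {Q = λ s → Env s × var s 12 ≡ toℕ t × SimP s rms × var s 13 ≡ toℕ t}
              (env , t≡ , S , trans (cong₂ _+_ t≡ (CtxR.zero≡ (proj₁ env))) (+-identityʳ (toℕ t)))
            then λ {s} (env , t≡ , S , x≡) →
            weaken ≤-refl
              (λ {s′} ((env , S) , kept) → env , trans (Kept.vars kept 12 refl) t≡ ,
                 subst (λ m → SimP s′ (m ʳ++ rms)) (sym (edgeMove-go (λ eq → go ≢0 (sym eq)))) S)
              (run-step {rms = rms} env S x≡))
          (λ ≡0 → run-skip (env , t≡ , subst (λ m → SimP s (m ʳ++ rms)) (sym (stays (end ≡0))) S))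
        where
        stays : ∀ {c} → c ≡ t → edgeMove c t ≡ []
        stays refl = edgeMove-stay t

    top-edge : ∀ t rms → top (edgeMove (top rms) t ʳ++ rms) ≡ t
    top-edge t rms with t ≟ᵛ top rms
    ... | yes eq = sym eq
    ... | no _   = refl

    PairPost : List V → ℕ → State → Set
    PairPost rms₀ p s = Env s × Σ[ rms ∈ List V ] SimP s rms ×
      (∀ {t₁ t₂ ds m} → Reads δ p (t₁ ∷ t₂ ∷ ds) → Forced X t₂ t₁ m → length m ≤ n →
        rms ≡ (edgeMove (top rms₀) t₁ ++ m) ʳ++ rms₀ × Reads δ (var s 8) ds)

    run-pair : ∀ {rms₀ s} → Env s → SimP s rms₀ → Run pair s (pairCost I M) (PairPost rms₀ (var s 8))
    run-pair {rms₀} {s₀} env S =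
      run-block (nextDigit 12) {Q = λ s → Env s × SimP s rms₀ × var s 12 ≡ toℕ t₁ × var s 8 ≡ suc p}
        (env , S , EnvR.digits (proj₂ env) p , suc≡ {s₀} (proj₁ env))
      then λ {s} (env , S , t≡ , p≡) →
      run-edgeStep {t₁} {rms₀} env S t≡
      then λ {s} ((env , t≡ , S) , kept) →
      run-block (nextDigit 12) {Q = λ s → Env s × SimP s rms₁ × var s 12 ≡ toℕ t₂ × var s 8 ≡ suc (suc p)}
        (env , S , trans (EnvR.digits (proj₂ env) (var s 8)) (cong (toℕ ∘ δ) (trans (Kept.vars kept 8 refl) p≡)) ,
         trans (suc≡ {s} (proj₁ env)) (cong suc (trans (Kept.vars kept 8 refl) p≡)))
      then λ {s} (env , S , t≡ , p≡) →
      weaken ≤-refl (searched env S t≡ p≡)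
        (run-bellmanFord (proj₁ env) (EnvR.inX (proj₂ env)) (EnvR.fin≤ (proj₂ env)) (EnvR.nx< (proj₂ env)) t≡ framed)
      then λ {s} (F@(env , _) , p≡) →
      weaken ≤-refl (λ {s′} (F , kept) → finish {s′} F (trans (Kept.vars kept 8 refl) p≡))
        (run-loop (Follows t₂ rms₁) refl refl refl (λ _ inv → inv) n (λ {_} {s} j<n _ F → run-hop {s = s} j<n F)
          (CtxR.one≡ (proj₁ env)) (CtxR.zero≡ (proj₁ env)) (CtxR.n≡ (proj₁ env)) F framed)
      where
      p : ℕ
      p = var s₀ 8
      t₁ t₂ : V
      t₁ = δ p
      t₂ = δ (suc p)
      rms₁ : List V
      rms₁ = edgeMove (top rms₀) t₁ ʳ++ rms₀
      suc≡ : ∀ {s} → Ctx s → var s 8 + var s 2 ≡ suc (var s 8)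
      suc≡ {s} ctx = trans (cong (var s 8 +_) (CtxR.one≡ ctx)) (+-comm (var s 8) 1)
      searched : ∀ {s} → Env s → SimP s rms₁ → var s 12 ≡ toℕ t₂ → var s 8 ≡ suc (suc p) →
        ∀ {s′} → (Table s′ X t₂ × Within n s′ X t₂) × Kept bellmanFord s s′ → Follows t₂ rms₁ 0 s′ × var s′ 8 ≡ suc (suc p)
      searched (ctx , E) S t≡ p≡ (((ctx′ , inX′ , tab) , within) , kept) = let open Kept kept in
        ((ctx′ , record { digits = λ i → trans (cong (λ a → a i) (arrs 2 refl)) (EnvR.digits E i) ; inX = inX′
                        ; fin≤ = TabR.fin≤ tab ; nx< = TabR.nx< tab }) ,
         record { target = trans (vars 12 refl) t≡ ; table = tab ; within = within } , rms₁ ,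
         keep-sim (vars 5 refl) (vars 6 refl) (vars 7 refl) (vars 9 refl) (vars 11 refl) (arrs 4 refl) (arrs 5 refl) (wvars 1 refl) S ,
         λ P f P≤n → P , f , refl , P≤n) ,
        trans (vars 8 refl) p≡
      finish : ∀ {s} → Follows t₂ rms₁ n s → var s 8 ≡ suc (suc p) → PairPost rms₀ p s
      finish {s} (env , T , rms , S , follow) p≡ = env , rms , S , matches
        where
        matches : ∀ {t₁ t₂ ds m} → Reads δ p (t₁ ∷ t₂ ∷ ds) → Forced X t₂ t₁ m → length m ≤ n →
          rms ≡ (edgeMove (top rms₀) t₁ ++ m) ʳ++ rms₀ × Reads δ (var s 8) ds
        matches {m = m} (refl ∷ (refl ∷ r)) f m≤n
          with follow m (subst (λ c → Forced X t₂ c m) (sym (top-edge t₁ rms₀)) f) m≤n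
        ... | [] , _ , eq , _ = trans eq (sym (++-ʳ++ (edgeMove (top rms₀) t₁))) , subst (λ q → Reads δ q _) (sym p≡) r
        ... | _ ∷ P , _ , _ , le = contradiction le (<⇒≱ (m<m+n n (s≤s z≤n)))

-- Checking one guess

bump : Mode → List Instr
bump vertexMode = []
bump edgeMode   = add! 6 6 2 ∷ []

openCycle closeCycle countMoves openGuess closeGuess countGuess : List Instr
openCycle  = load! 10 2 8 ∷ add! 8 8 2 ∷ add! 9 10 31 ∷ const! 11 0 ∷ []
closeCycle = monus! 14 9 10 ∷ monus! 19 10 9 ∷ add! 14 14 19 ∷ add! 7 7 14 ∷ []
countMoves = const! 14 3 ∷ monus! 14 14 11 ∷ add! 7 7 14 ∷ []
openGuess  = add! 5 5 2 ∷ add! 6 6 2 ∷ const! 7 0 ∷ const! 8 0 ∷ wmove! 1 4 ∷ []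
closeGuess = wleq! 14 1 0 ∷ monus! 14 2 14 ∷ add! 7 7 14 ∷ []
countGuess = monus! 14 2 7 ∷ add! 16 16 14 ∷ []

readX : Program
readX = block (nextDigit 13) ⨾ instr (store! 5 3 13)

cycle checkGuess guess : Mode → Program
cycle mode      = block (bump mode) ⨾ block openCycle ⨾ loop 22 3 pair ⨾ block closeCycle ⨾ block countMoves
checkGuess mode = block openGuess ⨾ loop 20 3 readX ⨾ loop 21 1 (cycle mode) ⨾ block closeGuess
guess mode      = checkGuess mode ⨾ block countGuess

-- Marks are stamps, held in variables 5 and 6: raising a stamp unmarks everything at once.
module Guessing (I : Instance) (M : ℕ) (mode : Mode) where
  open Base I
  open Routes I
  open Machine I M

  cycleCost checkCost guessCost : ℕ
  cycleCost = 2 + (5 + (loopCost M (pairCost I M) + (5 + 4)))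
  checkCost = 6 + (loopCost M 4 + (loopCost k cycleCost + 4))
  guessCost = checkCost + 3

  Log : Set
  Log = List (V × List V)

  module _ (X : List V) where
    data Encoding : Log → List V → Set where
      []  : Encoding [] []
      _∷_ : ∀ {s ms ds F rest} → Pairs X s ds M ms → Encoding F rest → Encoding ((s , ms) ∷ F) (s ∷ ds ++ rest)

  -- A log lists tours, and the moves of each tour, newest first.
  _⊳_ : Log → Log → Log
  []             ⊳ log = log
  ((s , ms) ∷ F) ⊳ log = F ⊳ ((s , ms ʳ++ []) ∷ log)

  firstDigits : (ℕ → V) → ℕ → List V
  firstDigits δ zero    = []
  firstDigits δ (suc j) = δ j ∷ firstDigits δ j

  Reads-++ : ∀ {δ : ℕ → V} {p} xs {ys} → Reads δ p (xs ++ ys) → Reads δ (p + length xs) ys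
  Reads-++ {δ} {p} []       {ys} r       = subst (λ q → Reads δ q ys) (sym (+-identityʳ p)) r
  Reads-++ {δ} {p} (x ∷ xs) {ys} (_ ∷ r) = subst (λ q → Reads δ q ys) (sym (+-suc p (length xs))) (Reads-++ xs r)

  Reads-reverse : ∀ {δ : ℕ → V} p ys {zs} → Reads δ p (ys ++ zs) → firstDigits δ (p + length ys) ≡ ys ʳ++ firstDigits δ p
  Reads-reverse {δ} p []       _          = cong (firstDigits δ) (+-identityʳ p)
  Reads-reverse {δ} p (y ∷ ys) (refl ∷ r) = trans (cong (firstDigits δ) (+-suc p (length ys))) (Reads-reverse (suc p) ys r)

  carriedOver : Mode → List V → List V
  carriedOver vertexMode us = us
  carriedOver edgeMode   us = []

  U₀ : List V → List V
  U₀ = carriedOver mode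

  -- In edge mode the vertex stamp is raised before the next cycle, so nothing but the bound on the
  -- entries has to survive.
  UsedInv : Mode → ℕ → (ℕ → ℕ) → List V → Set
  UsedInv vertexMode sv used us = UsedR sv used us
  UsedInv edgeMode   sv used us = ∀ i → used i ≤ sv

  used-bound : ∀ mode {sv used us} → UsedInv mode sv used us → ∀ i → used i ≤ sv
  used-bound vertexMode = UsedR.bound
  used-bound edgeMode   = id

  unmarked : ∀ {sv one} {used : ℕ → ℕ} → one ≡ 1 → (∀ i → used i ≤ sv) → UsedR (sv + one) used []
  unmarked {sv} refl bound = record
    { bound = λ i → ≤-trans (bound i) (m≤m+n sv 1)
    ; to = λ y eq → contradiction (bound (toℕ y)) (<⇒≱ (≤-reflexive (trans (+-comm 1 sv) (sym eq))))
    ; from = λ y () }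

  unmarkedE : ∀ {it one} {usedE : ℕ → ℕ} → one ≡ 1 → (∀ i → usedE i ≤ it) → EdgeR (it + one) usedE []
  unmarkedE {it} refl bound = record
    { bound = λ i → ≤-trans (bound i) (m≤m+n it 1)
    ; to = λ u v eq → contradiction (bound (index u v)) (<⇒≱ (≤-reflexive (trans (+-comm 1 it) (sym eq))))
    ; from = λ u v () }

  module Checking (δ : ℕ → V) where
    X : List V
    X = firstDigits δ M
    open Following I M X δ

    usedBy : Log → List V
    usedBy []              = []
    usedBy ((c , rms) ∷ log) = rms ++ usedBy log

    trailBy : Log → List (V × V)
    sofarBy : Log → ℕ
    validBy : Log → Set

    trailBy []                = []
    trailBy ((c , rms) ∷ log) = trail (U₀ (usedBy log)) (trailBy log) c (sofarBy log) (validBy log) rms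
    sofarBy []                = 0
    sofarBy ((c , rms) ∷ log) = sofar (U₀ (usedBy log)) (trailBy log) c (sofarBy log) (validBy log) rms
    validBy []                = ⊤
    validBy ((c , rms) ∷ log) = (valid (U₀ (usedBy log)) (trailBy log) c (sofarBy log) (validBy log) rms ×
      top (U₀ (usedBy log)) (trailBy log) c (sofarBy log) (validBy log) rms ≡ c) × 3 ≤ length rms

    module _ (U : List V) (E : List (V × V)) (c₀ : V) (tot : ℕ) (OK : Set) where
      private
        topᶜ = top U E c₀ tot OK

      top-forced : ∀ {t c m rms} → Forced X t c m → topᶜ rms ≡ c → topᶜ (m ʳ++ rms) ≡ t
      top-forced stop           eq = eq
      top-forced {rms = rms} (hop {x = x} _ _ _ f) eq = top-forced {rms = x ∷ rms} f refl

      Pairing : ℕ → ℕ → State → Set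
      Pairing p j s = Env s × var s 10 ≡ toℕ c₀ × Σ[ rms ∈ List V ] SimP U E c₀ tot OK s rms ×
        (∀ {ds rest ms} → Reads δ p (ds ++ rest) → Pairs X c₀ ds M ms →
          Σ[ ds′ ∈ List V ] Σ[ r ∈ ℕ ] Σ[ ms′ ∈ List V ]
            Reads δ (var s 8) (ds′ ++ rest) × Pairs X (topᶜ rms) ds′ r ms′ × j + r ≡ M × ms′ ʳ++ rms ≡ ms ʳ++ [])

      run-pairing : ∀ {p j s} → j < M → Pairing p j s → Run pair s (pairCost I M) (Pairing p (suc j))
      run-pairing {p} {j} {s₀} j<M (env , start≡ , rms₀ , S , plan) =
        weaken ≤-refl (λ {s} → next {s}) (run-pair U E c₀ tot OK {rms₀} env S framed)
        where
        next : ∀ {s} → PairPost U E c₀ tot OK rms₀ (var s₀ 8) s × Kept pair s₀ s → Pairing p (suc j) s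
        next {s} ((env , rms , S , post) , kept) = env , trans (Kept.vars kept 10 refl) start≡ , rms , S , plan′
          where
          plan′ : ∀ {ds rest ms} → Reads δ p (ds ++ rest) → Pairs X c₀ ds M ms →
            Σ[ ds′ ∈ List V ] Σ[ r ∈ ℕ ] Σ[ ms′ ∈ List V ]
              Reads δ (var s 8) (ds′ ++ rest) × Pairs X (topᶜ rms) ds′ r ms′ × suc j + r ≡ M × ms′ ʳ++ rms ≡ ms ʳ++ []
          plan′ r ps with plan r ps
          ... | _ , _ , _ , _ , done , j≡ , _ = contradiction (trans (sym (+-identityʳ j)) j≡) (<⇒≢ j<M)
          ... | t₁ ∷ t₂ ∷ ds , suc r′ , _ , reads , step {m = m} {ms} f m≤n ps′ , j≡ , ms≡ with post reads f m≤n
          ...   | refl , reads′ = ds , r′ , ms , reads′ , subst (λ c → Pairs X c ds r′ ms) (sym at) ps′ , trans (sym (+-suc j r′)) j≡ ,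
                    trans (cong (ms ʳ++_) (++-ʳ++ (edgeMove (topᶜ rms₀) t₁)))
                      (trans (sym (trans (++-ʳ++ (edgeMove (topᶜ rms₀) t₁)) (++-ʳ++ m))) ms≡)
            where
            at : topᶜ ((edgeMove (topᶜ rms₀) t₁ ++ m) ʳ++ rms₀) ≡ t₂
            at = trans (cong topᶜ (++-ʳ++ (edgeMove (topᶜ rms₀) t₁))) (top-forced {rms = edgeMove (topᶜ rms₀) t₁ ʳ++ rms₀} f (top-edge U E c₀ tot OK t₁ rms₀))

    -- If the digits encode a packing, then the tours traced so far together with the tours still to
    -- be read are this packing. Quantifying over all encodings keeps the run independent of any
    -- particular one.
    Planned : Log → ℕ → State → Set
    Planned log j s = ∀ {F ds} → Encoding X F ds → length F ≡ k → Reads δ M ds →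
      Σ[ F′ ∈ Log ] Σ[ ds′ ∈ List V ] Encoding X F′ ds′ × Reads δ (var s 8) ds′ × F′ ⊳ log ≡ F ⊳ [] × length F′ + j ≡ k

    Logged : Log → State → Set
    Logged log s = EdgeR (var s 5) (arr s 5) (trailBy log) × FailR (var s 7) (validBy log) × wvar s 1 ≡ sofarBy log

    LogInv : ℕ → State → Set
    LogInv j s = Env s × Σ[ log ∈ Log ] length log ≡ j × UsedInv mode (var s 6) (arr s 4) (usedBy log) × Logged log s × Planned log j s

    run-bump : ∀ mode {s p log} → Env s → UsedInv mode (var s 6) (arr s 4) (usedBy log) → Logged log s → var s 8 ≡ p →
      Run (block (bump mode)) s 2 (λ s → Env s × UsedR (var s 6) (arr s 4) (carriedOver mode (usedBy log)) × Logged log s × var s 8 ≡ p)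
    run-bump vertexMode env used logged p≡ = weaken (s≤s z≤n) id (run-block [] (env , used , logged , p≡))
    run-bump edgeMode   env used logged p≡ = run-block (add! 6 6 2 ∷ []) (env , unmarked (CtxR.one≡ (proj₁ env)) used , logged , p≡)

    run-cycle : ∀ {j s} → j < k → LogInv j s → Run (cycle mode) s cycleCost (LogInv (suc j))
    run-cycle {j} {s₀} j<k (env , log , len≡ , used , logged , planned) =
      run-bump mode {s₀} {p} {log} env used logged refl
      then λ {s} (env , used , (traces , fails , tw≡) , p≡) →
      run-block openCycle {Q = λ s → Env s × var s 10 ≡ toℕ c₀ × SimP′ s [] × var s 8 ≡ suc p}
        (env , start≡ {s} env p≡ ,
         record { vertices = used ; traces = traces ; fails = fails ; cnt≡ = refl ; tw≡ = tw≡
                ; cur≡ = trans (cong₂ _+_ (start≡ {s} env p≡) (CtxR.zero≡ (proj₁ env))) (+-identityʳ (toℕ c₀)) } ,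
         trans (cong₂ _+_ p≡ (CtxR.one≡ (proj₁ env))) (+-comm p 1))
      then λ {s} (env , s≡ , S , p≡) →
      run-loop (Pairing U E c₀ tot OK (suc p)) refl refl refl (λ _ inv → inv) M
        (λ {_} {s} lt _ inv → run-pairing U E c₀ tot OK {suc p} {_} {s} lt inv)
        (CtxR.one≡ (proj₁ env)) (CtxR.zero≡ (proj₁ env)) (CtxR.M≡ (proj₁ env))
        (env , s≡ , [] , S , λ {ds} {rest} {ms} r ps → ds , M , ms , subst (λ q → Reads δ q (ds ++ rest)) (sym p≡) r , ps , refl , refl)
      then λ {s} (env , s≡ , rms , S , plan) →
      let module S = SimR S in
      run-block closeCycle {Q = λ s → Closed₁ rms s × (∀ {ds rest ms} → Reads δ (suc p) (ds ++ rest) → Pairs X c₀ ds M ms → rms ≡ ms ʳ++ [] × Reads δ (var s 8) rest)}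
        ((env , S.vertices , S.traces , S.cnt≡ , S.tw≡ ,
          add-check {d = (var s 9 ∸ var s 10) + (var s 10 ∸ var s 9)}
            (λ eq → Fin.toℕ-injective (trans (sym S.cur≡) (trans (distance≡0 (var s 9) (var s 10) eq) s≡)))
            (λ eq → subst (λ z → (var s 9 ∸ z) + (z ∸ var s 9) ≡ 0) (trans S.cur≡ (trans (cong toℕ eq) (sym s≡))) (distance-refl (var s 9))) S.fails) ,
         λ {ds} {rest} {ms} r ps → finished {s} {rms} {rest} {ms} (plan r ps))
      then λ {s} ((env , vertices , traces , cnt≡ , tw≡ , fails) , plan) →
      run-block countMoves
        (env , (c₀ , rms) ∷ log , cong suc len≡ , kept mode vertices ,
         (traces , add-check {d = 3 ∸ var s 11}
            (λ eq → subst (3 ≤_) cnt≡ (m∸n≡0⇒m≤n eq))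
            (λ le → m≤n⇒m∸n≡0 (subst (3 ≤_) (sym cnt≡) le)) fails , tw≡) ,
         λ {F} enc F≡k r → replan {s} {rms} {F} plan (planned enc F≡k r))
      where
      p : ℕ
      p = var s₀ 8
      c₀ : V
      c₀ = δ p
      U : List V
      U = U₀ (usedBy log)
      E : List (V × V)
      E = trailBy log
      tot : ℕ
      tot = sofarBy log
      OK : Set
      OK = validBy log
      SimP′ : State → List V → Set
      SimP′ = SimP U E c₀ tot OK
      start≡ : ∀ {s} → Env s → var s 8 ≡ p → arr s 2 (var s 8) ≡ toℕ c₀
      start≡ {s} env p≡ = trans (EnvR.digits (proj₂ env) (var s 8)) (cong (toℕ ∘ δ) p≡)
      Closed₁ : List V → State → Set
      Closed₁ rms s = Env s × UsedR (var s 6) (arr s 4) (rms ++ U) × EdgeR (var s 5) (arr s 5) (trail U E c₀ tot OK rms) ×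
        var s 11 ≡ length rms × wvar s 1 ≡ sofar U E c₀ tot OK rms × FailR (var s 7) (valid U E c₀ tot OK rms × top U E c₀ tot OK rms ≡ c₀)
      kept : ∀ mode {sv used rms us} → UsedR sv used (rms ++ carriedOver mode us) → UsedInv mode sv used (rms ++ us)
      kept vertexMode R = R
      kept edgeMode   R = UsedR.bound R
      finished : ∀ {s rms rest ms} → (Σ[ ds′ ∈ List V ] Σ[ r ∈ ℕ ] Σ[ ms′ ∈ List V ]
        Reads δ (var s 8) (ds′ ++ rest) × Pairs X (top U E c₀ tot OK rms) ds′ r ms′ × M + r ≡ M × ms′ ʳ++ rms ≡ ms ʳ++ []) →
        rms ≡ ms ʳ++ [] × Reads δ (var s 8) rest
      finished (_ , zero , _ , r , done , _ , eq) = eq , r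
      finished (_ , suc r , _ , _ , _ , M≡ , _) = contradiction (sym M≡) (<⇒≢ (m<m+n M (s≤s z≤n)))
      replan : ∀ {s rms F} →
        (∀ {ds rest ms} → Reads δ (suc p) (ds ++ rest) → Pairs X c₀ ds M ms → rms ≡ ms ʳ++ [] × Reads δ (var s 8) rest) →
        Σ[ F′ ∈ Log ] Σ[ ds′ ∈ List V ] Encoding X F′ ds′ × Reads δ p ds′ × F′ ⊳ log ≡ F ⊳ [] × length F′ + j ≡ k →
        Σ[ F′ ∈ Log ] Σ[ ds′ ∈ List V ] Encoding X F′ ds′ × Reads δ (var s 8) ds′ × F′ ⊳ ((c₀ , rms) ∷ log) ≡ F ⊳ [] × length F′ + suc j ≡ k
      replan plan (_ , _ , [] , _ , _ , j≡k) = contradiction j≡k (<⇒≢ j<k)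
      replan plan (_ ∷ F′ , _ , ps ∷ enc , refl ∷ r , eq , j≡) with plan r ps
      ... | refl , r′ = F′ , _ , enc , r′ , eq , trans (+-suc (length F′) j) j≡

  record GlobalR (v5 v6 v15 : ℕ) (a3 a4 a5 a6 a7 : ℕ → ℕ) : Set where
    field
      inX≤   : ∀ i → a3 i ≤ v5
      used≤  : ∀ i → a4 i ≤ v6
      usedE≤ : ∀ i → a5 i ≤ v5
      fin≤   : ∀ i → a6 i ≤ v15
      nx<    : ∀ i → a7 i < n

  Global : State → Set
  Global s = Ctx s × GlobalR (var s 5) (var s 6) (var s 15) (arr s 3) (arr s 4) (arr s 5) (arr s 6) (arr s 7)

  Digits : (ℕ → V) → State → Set
  Digits δ s = ∀ i → arr s 2 i ≡ toℕ (δ i)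

  module _ (δ : ℕ → V) where
    open Checking δ
    open Following I M X δ

    -- `fails` concerns the tours actually traced and yields soundness for an arbitrary guess. Only
    -- `planned` refers to an encoding, and it identifies the traced tours with the encoded ones.
    record Verdict (b : ℕ) : Set where
      field
        log     : Log
        length≡ : length log ≡ k
        fails   : FailR b (validBy log × sofarBy log ≤ ℓ)
        planned : ∀ {Y F ds} → length Y ≡ M → length F ≡ k → Encoding (Y ʳ++ []) F ds → Reads δ 0 (Y ++ ds) → log ≡ F ⊳ []

    ReadR : ℕ → (v5 v6 v7 v8 v15 : ℕ) (a2 a3 a4 a5 a6 a7 : ℕ → ℕ) (w1 : ℕ) → Set
    ReadR j v5 v6 v7 v8 v15 a2 a3 a4 a5 a6 a7 w1 =
      (∀ i → a2 i ≡ toℕ (δ i)) × UsedR v5 a3 (firstDigits δ j) × UsedR v6 a4 [] × EdgeR v5 a5 [] ×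
      (∀ i → a6 i ≤ v15) × (∀ i → a7 i < n) × v7 ≡ 0 × v8 ≡ j × w1 ≡ 0

    Reading : ℕ → State → Set
    Reading j s = Ctx s × ReadR j (var s 5) (var s 6) (var s 7) (var s 8) (var s 15)
                            (arr s 2) (arr s 3) (arr s 4) (arr s 5) (arr s 6) (arr s 7) (wvar s 1)

    run-readX : ∀ {j s} → Reading j s → Run readX s 4 (Reading (suc j))
    run-readX {j} (ctx , dig , inX , used , traces , fin , nx , bad , pos , tw) =
      run-block (nextDigit 13) {Q = λ s → Reading′ s × var s 13 ≡ toℕ (δ j)}
        ((ctx , dig , inX , used , traces , fin , nx , bad , trans (cong₂ _+_ pos (CtxR.one≡ ctx)) (+-comm j 1) , tw) ,
         trans (dig _) (cong (toℕ ∘ δ) pos))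
      then λ {s} ((ctx , dig , inX , used , traces , fin , nx , bad , pos , tw) , x≡) →
      run-instr (store! 5 3 13) (ctx , dig , mark-used (var s 13) x≡ inX , used , traces , fin , nx , bad , pos , tw)
      where
      Reading′ : State → Set
      Reading′ s = Ctx s × (∀ i → arr s 2 i ≡ toℕ (δ i)) × UsedR (var s 5) (arr s 3) (firstDigits δ j) × UsedR (var s 6) (arr s 4) [] ×
        EdgeR (var s 5) (arr s 5) [] × (∀ i → arr s 6 i ≤ var s 15) × (∀ i → arr s 7 i < n) × var s 7 ≡ 0 × var s 8 ≡ suc j × wvar s 1 ≡ 0

    Checked : State → Set
    Checked s = Global s × Digits δ s × Verdict (var s 7)

    run-checkGuess : ∀ {s} → Global s → Digits δ s → Run (checkGuess mode) s checkCost Checked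
    run-checkGuess (ctx , R) dig =
      run-block openGuess {Q = Reading 0}
        (ctx , dig , unmarked (CtxR.one≡ ctx) (GlobalR.inX≤ R) , unmarked (CtxR.one≡ ctx) (GlobalR.used≤ R) ,
         unmarkedE (CtxR.one≡ ctx) (GlobalR.usedE≤ R) , GlobalR.fin≤ R , GlobalR.nx< R , refl , refl , CtxR.wz≡ ctx)
      then λ inv@(ctx , _) →
      run-loop Reading refl refl refl (λ _ inv → inv) M (λ {_} {s} _ _ inv → run-readX {s = s} inv)
        (CtxR.one≡ ctx) (CtxR.zero≡ ctx) (CtxR.M≡ ctx) inv
      then λ {s} inv@(ctx , _) →
      run-loop {c = 21} LogInv (untouched₁ mode) refl (untouched₂ mode) (λ _ inv → inv) k (λ {_} {s} j<k _ inv → run-cycle {s = s} j<k inv)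
        (CtxR.one≡ ctx) (CtxR.zero≡ ctx) (CtxR.k≡ ctx) (ready {s} inv)
      then λ {s} ((ctx , env) , log , len≡ , used , (traces , fails , tw≡) , planned) →
      run-block closeGuess
        ((ctx , record { inX≤ = UsedR.bound (EnvR.inX env) ; used≤ = used-bound mode used ; usedE≤ = EdgeR.bound traces
                       ; fin≤ = EnvR.fin≤ env ; nx< = EnvR.nx< env }) ,
         EnvR.digits env ,
         record { log = log ; length≡ = len≡
                ; fails = let f , g = light (wvar s 1 ≤? wvar s 0) in
                    add-check {d = var s 2 ∸ bit (wvar s 1 ≤? wvar s 0)}
                      (λ eq → subst₂ _≤_ tw≡ (CtxR.ℓ≡ ctx) (f (trans (cong (_∸ bit (wvar s 1 ≤? wvar s 0)) (sym (CtxR.one≡ ctx))) eq)))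
                      (λ le → trans (cong (_∸ bit (wvar s 1 ≤? wvar s 0)) (CtxR.one≡ ctx)) (g (subst₂ _≤_ (sym tw≡) (sym (CtxR.ℓ≡ ctx)) le))) fails
                ; planned = complete {s} planned })
      where
      untouched₁ : ∀ mode → writes (cycle mode) 21 ≡ false
      untouched₁ vertexMode = refl
      untouched₁ edgeMode   = refl
      untouched₂ : ∀ mode → writes (cycle mode) 2 ≡ false
      untouched₂ vertexMode = refl
      untouched₂ edgeMode   = refl
      light : ∀ {a b} (d : Dec (a ≤ b)) → (1 ∸ bit d ≡ 0 → a ≤ b) × (a ≤ b → 1 ∸ bit d ≡ 0)
      light (yes le) = (λ _ → le) , λ _ → refl
      light (no ≰)   = (λ ()) , λ le → contradiction le ≰
      initially : ∀ mode {sv used} → UsedR sv used [] → UsedInv mode sv used []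
      initially vertexMode R = R
      initially edgeMode   R = UsedR.bound R
      ready : ∀ {s} → Reading M s → LogInv 0 s
      ready {s} (ctx , dig , inX , used , traces , fin , nx , bad , pos , tw) =
        (ctx , record { digits = dig ; inX = inX ; fin≤ = fin ; nx< = nx }) , [] , refl , initially mode used ,
        (traces , record { to = λ _ → tt ; from = λ _ → bad } , tw) ,
        λ {F} {ds} enc F≡k r → F , ds , enc , subst (λ q → Reads δ q ds) (sym pos) r , refl , trans (+-identityʳ (length F)) F≡k
      complete : ∀ {s log} → Planned log k s → ∀ {Y F ds} → length Y ≡ M → length F ≡ k → Encoding (Y ʳ++ []) F ds →
        Reads δ 0 (Y ++ ds) → log ≡ F ⊳ []
      complete planned {Y} {F} {ds} Y≡M F≡k enc r
        with planned (subst (λ Z → Encoding Z F ds) (sym (trans (cong (firstDigits δ) (sym Y≡M)) (Reads-reverse 0 Y r))) enc) F≡k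
               (subst (λ q → Reads δ q ds) Y≡M (Reads-++ Y r))
      ... | [] , _ , _ , _ , eq , _ = eq
      ... | _ ∷ F′ , _ , _ , _ , _ , eq = contradiction (sym eq) (<⇒≢ (s≤s (m≤n+m k (length F′))))

    Counted : ℕ → State → Set
    Counted r s = Global s × Digits δ s × Σ[ b ∈ ℕ ] Verdict b × var s 16 ≡ r + (1 ∸ b)

    run-guess : ∀ {s} → Global s → Digits δ s → Run (guess mode) s guessCost (Counted (var s 16))
    run-guess {s₀} glob dig =
      (run-checkGuess {s₀} glob dig framed)
      then λ {s} ((glob , dig , verdict) , kept) →
      run-block countGuess
        (glob , dig , var s 7 , verdict , cong₂ _+_ (Kept.vars kept 16 (untouched mode)) (cong (_∸ var s 7) (CtxR.one≡ (proj₁ glob))))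
      where
      untouched : ∀ mode → writes (checkGuess mode) 16 ≡ false
      untouched vertexMode = refl
      untouched edgeMode   = refl

-- Enumerating the guesses

tickDigit tickOdometer odometer offsets timesK setup : Program
tickDigit =
  block (load! 14 2 28 ∷ add! 14 14 2 ∷ monus! 19 0 14 ∷ []) ⨾
  ifnz 19 (block (store! 14 2 28 ∷ const! 18 0 ∷ [])) (block (store! 31 2 28 ∷ []))
tickOdometer = ifnz 18 tickDigit skip ⨾ instr (add! 28 28 2)
odometer = block (const! 18 1 ∷ const! 28 0 ∷ []) ⨾ loop 27 4 tickOdometer ⨾ instr (monus! 17 2 18)

-- Indices cannot be multiplied, so powers of `k` arise from repeated addition; for the same reason
-- `offsets` tabulates the row offsets once, by steps of `n`.
timesK  = instr (const! 14 0) ⨾ loop 24 1 (instr (add! 14 14 3))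
offsets = block (const! 14 0 ∷ const! 28 0 ∷ []) ⨾ loop 24 0 (block (store! 14 1 28 ∷ add! 14 14 0 ∷ add! 28 28 2 ∷ []))
setup   =
  block (const! 2 1 ∷ const! 3 16384 ∷ const! 17 1 ∷ const! 19 4 ∷ []) ⨾
  loop 25 19 (timesK ⨾ instr (add! 3 14 31)) ⨾
  timesK ⨾ block (add! 14 14 14 ∷ add! 4 14 14 ∷ []) ⨾ offsets

solver : Mode → Program
solver mode = ifnz 0 (setup ⨾ while 17 (guess mode ⨾ odometer) ⨾ instr (add! 0 16 31)) skip

module Odometer (I : Instance) (M : ℕ) (mode : Mode) (K : ℕ) where
  open Base I
  open Machine I M
  open Guessing I M mode

  val : (ℕ → V) → ℕ → ℕ
  val δ zero    = 0
  val δ (suc j) = val δ j + toℕ (δ j) * n ^ j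

  val-cong : ∀ {δ δ′ : ℕ → V} j → (∀ {i} → i < j → δ i ≡ δ′ i) → val δ j ≡ val δ′ j
  val-cong zero    eq = refl
  val-cong (suc j) eq = cong₂ _+_ (val-cong j (eq ∘ m<n⇒m<1+n)) (cong (λ v → toℕ v * n ^ j) (eq ≤-refl))

  val< : ∀ (δ : ℕ → V) j → val δ j < n ^ j
  val< δ zero    = s≤s z≤n
  val< δ (suc j) = ≤-trans (+-monoˡ-≤ (toℕ (δ j) * n ^ j) (val< δ j)) (*-monoˡ-≤ (n ^ j) (Fin.toℕ<n (δ j)))

  quotient-unique : ∀ N a b {x y} → x < N → y < N → x + a * N ≡ y + b * N → a ≡ b
  quotient-unique N zero    zero    x< y< eq = refl
  quotient-unique N zero    (suc b) {x} {y} x< y< eq = contradiction (subst (_< N) (trans (sym (+-identityʳ x)) eq) x<) (≤⇒≯ (≤-trans (m≤m+n N (b * N)) (m≤n+m _ y)))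
  quotient-unique N (suc a) zero    {x} {y} x< y< eq = contradiction (subst (_< N) (trans (sym (+-identityʳ y)) (sym eq)) y<) (≤⇒≯ (≤-trans (m≤m+n N (a * N)) (m≤n+m _ x)))
  quotient-unique N (suc a) (suc b) {x} {y} x< y< eq = cong suc (quotient-unique N a b x< y< (+-cancelˡ-≡ N _ _ (trans (sym (swap N x (a * N))) (trans eq (swap N y (b * N))))))
    where
    swap : ∀ N x a → x + (N + a) ≡ N + (x + a)
    swap = solve-∀

  val-injective : ∀ (δ δ′ : ℕ → V) j → val δ j ≡ val δ′ j → ∀ {i} → i < j → δ i ≡ δ′ i
  val-injective δ δ′ (suc j) eq i<j with Fin.toℕ-injective {i = δ j} {δ′ j} (quotient-unique (n ^ j) _ _ (val< δ j) (val< δ′ j) eq)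
  ... | δj≡ with m≤n⇒m<n∨m≡n (s≤s⁻¹ i<j)
  ...   | inj₂ refl = δj≡
  ...   | inj₁ i<j′ = val-injective δ δ′ j (+-cancelʳ-≡ (toℕ (δ j) * n ^ j) _ _ (trans eq (cong (λ v → val δ′ j + toℕ v * n ^ j) (sym δj≡)))) i<j′

  -- While the carry is 1, all `j` lowest digits were maximal and have rolled over to 0; otherwise
  -- the increment is complete. At `j ≡ 0` the carry 1 is the increment itself, as `n ^ 0` is 1.
  Carry : (ℕ → V) → ℕ → ℕ → (ℕ → V) → Set
  Carry δ j carry δ′ = (carry ≡ 1 × val δ′ j ≡ 0 × suc (val δ j) ≡ n ^ j) ⊎ (carry ≡ 0 × val δ′ j ≡ suc (val δ j))

  Ticking : (ℕ → V) → ℕ → State → Set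
  Ticking δ j s = Global s × var s 28 ≡ j ×
    Σ[ δ′ ∈ (ℕ → V) ] Digits δ′ s × (∀ i → j ≤ i → δ′ i ≡ δ i) × Carry δ j (var s 18) δ′

  tickCost odometerCost : ℕ
  tickCost     = suc (4 + suc (3 + 2) + 1) + 1
  odometerCost = 3 + (loopCost K tickCost + 1)

  digits-update : ∀ {δ′ : ℕ → V} {a2 : ℕ → ℕ} {i j d x} → i ≡ j → d ≡ toℕ x → (∀ i → a2 i ≡ toℕ (δ′ i)) →
    ∀ l → (a2 [ i ↦ d ]) l ≡ toℕ ((δ′ [ j ↦ x ]) l)
  digits-update {δ′} {a2} {i} {x = x} refl d≡ dig l with l ≟ i
  ... | yes eq = trans (update-here a2 eq) (trans d≡ (cong toℕ (sym (update-here δ′ {x = x} eq))))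
  ... | no ne  = trans (update-there a2 ne) (trans (dig l) (cong toℕ (sym (update-there δ′ {x = x} ne))))

  val-update : ∀ (δ′ : ℕ → V) j x → val (δ′ [ j ↦ x ]) (suc j) ≡ val δ′ j + toℕ x * n ^ j
  val-update δ′ j x = cong₂ _+_ (val-cong j λ i<j → update-there δ′ {x = x} (<⇒≢ i<j)) (cong (λ v → toℕ v * n ^ j) (update-here δ′ {j} {x} {j} refl))

  run-tick : ∀ {δ j s} → Ticking δ j s → Run tickOdometer s tickCost (Ticking δ (suc j))
  run-tick {δ} {j} {s₀} (glob , pos , δ′ , dig , later , carry) =
    run-ifnz {Q = λ s → Global s × var s 28 ≡ j × Σ[ δ″ ∈ (ℕ → V) ] Digits δ″ s × (∀ i → suc j ≤ i → δ″ i ≡ δ i) × Carry δ (suc j) (var s 18) δ″}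
      (λ ≢0 → ticked (carrying carry ≢0))
      (λ ≡0 → run-skip (glob , pos , δ′ , dig , (λ i lt → later i (<⇒≤ lt)) , inj₂ (≡0 , settled carry ≡0)))
    then λ {s} (glob , pos , rest) →
    run-instr (add! 28 28 2) (glob , trans (cong₂ _+_ pos (CtxR.one≡ (proj₁ glob))) (+-comm j 1) , rest)
    where
    settled : Carry δ j (var s₀ 18) δ′ → var s₀ 18 ≡ 0 → val δ′ (suc j) ≡ suc (val δ (suc j))
    settled (inj₁ (eq , _)) ≡0 = case trans (sym eq) ≡0 of λ ()
    settled (inj₂ (_ , eq)) _  = cong₂ _+_ eq (cong (λ v → toℕ v * n ^ j) (later j ≤-refl))
    carrying : Carry δ j (var s₀ 18) δ′ → var s₀ 18 ≢ 0 → val δ′ j ≡ 0 × suc (val δ j) ≡ n ^ j × var s₀ 18 ≡ 1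
    carrying (inj₁ (eq , z , full)) _ = z , full , eq
    carrying (inj₂ (eq , _)) ≢0 = contradiction eq ≢0
    digit : ∀ {s} → Digits δ′ s → var s 28 ≡ j → arr s 2 (var s 28) ≡ toℕ (δ j)
    digit {s} dig pos = trans (dig (var s 28)) (cong toℕ (trans (cong δ′ pos) (later j ≤-refl)))
    later′ : ∀ x i → suc j ≤ i → (δ′ [ j ↦ x ]) i ≡ δ i
    later′ x i lt = trans (update-there δ′ {x = x} (>⇒≢ lt)) (later i (<⇒≤ lt))
    ticked : val δ′ j ≡ 0 × suc (val δ j) ≡ n ^ j × var s₀ 18 ≡ 1 → Run tickDigit s₀ (4 + suc (3 + 2))
      (λ s → Global s × var s 28 ≡ j × Σ[ δ″ ∈ (ℕ → V) ] Digits δ″ s × (∀ i → suc j ≤ i → δ″ i ≡ δ i) × Carry δ (suc j) (var s 18) δ″)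
    ticked (z , full , c≡) =
      run-block _ {Q = λ s → Global s × var s 28 ≡ j × Digits δ′ s × var s 14 ≡ suc (toℕ (δ j)) × var s 19 ≡ n ∸ suc (toℕ (δ j)) × var s 18 ≡ 1}
        (glob , pos , dig , next , cong₂ _∸_ (CtxR.n≡ (proj₁ glob)) next , c≡)
      then λ {s} (glob , pos , dig , d≡ , room≡ , c≡) →
      run-ifnz
        (λ ≢0 → let d< = m∸n≢0⇒n<m (λ full → ≢0 (trans room≡ full)) in
          run-block _ (glob , pos , δ′ [ j ↦ fromℕ< d< ] ,
            digits-update {δ′} {arr s 2} pos (trans d≡ (sym (Fin.toℕ-fromℕ< d<))) dig , later′ _ ,
            inj₂ (refl , (begin
              val (δ′ [ j ↦ fromℕ< d< ]) (suc j)          ≡⟨ val-update δ′ j (fromℕ< d<) ⟩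
              val δ′ j + toℕ (fromℕ< d<) * n ^ j          ≡⟨ cong₂ _+_ z (cong (_* n ^ j) (Fin.toℕ-fromℕ< d<)) ⟩
              n ^ j + toℕ (δ j) * n ^ j                   ≡⟨ cong (_+ toℕ (δ j) * n ^ j) (sym full) ⟩
              suc (val δ (suc j))                         ∎))))
        (λ ≡0 → let full′ = ≤-antisym (Fin.toℕ<n (δ j)) (m∸n≡0⇒m≤n (trans (sym room≡) ≡0)) in
          run-block _ (glob , pos , δ′ [ j ↦ fromℕ< (0<n (δ j)) ] ,
            digits-update {δ′} {arr s 2} pos (trans (CtxR.zero≡ (proj₁ glob)) (sym (Fin.toℕ-fromℕ< (0<n (δ j))))) dig , later′ _ ,
            inj₁ (c≡ ,
              trans (val-update δ′ j _) (cong₂ _+_ z (cong (_* n ^ j) (Fin.toℕ-fromℕ< (0<n (δ j))))) ,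
              trans (cong (_+ toℕ (δ j) * n ^ j) full) (cong (_* n ^ j) full′))))
      where
      open ≡-Reasoning
      next : arr s₀ 2 (var s₀ 28) + var s₀ 2 ≡ suc (toℕ (δ j))
      next = trans (cong₂ _+_ (digit {s₀} dig pos) (CtxR.one≡ (proj₁ glob))) (+-comm (toℕ (δ j)) 1)
      0<n : V → 0 < n
      0<n u = ≤-<-trans z≤n (Fin.toℕ<n u)

  Ticked : (ℕ → V) → State → Set
  Ticked δ s = Global s × Σ[ δ′ ∈ (ℕ → V) ] Digits δ′ s ×
    ((var s 17 ≡ 0 × suc (val δ K) ≡ n ^ K) ⊎ (var s 17 ≡ 1 × val δ′ K ≡ suc (val δ K)))

  run-odometer : ∀ {δ s} → Global s → Digits δ s → var s 4 ≡ K → Run odometer s odometerCost (Ticked δ)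
  run-odometer {δ} glob dig K≡ =
    run-block _ {Q = λ s → Ticking δ 0 s × var s 4 ≡ K} ((glob , refl , δ , dig , (λ _ _ → refl) , inj₁ (refl , refl , refl)) , K≡)
    then λ {s} (inv@((ctx , _) , _) , K≡) →
    run-loop (Ticking δ) refl refl refl (λ _ inv → inv) K (λ {_} {s} _ _ inv → run-tick {s = s} inv) (CtxR.one≡ ctx) (CtxR.zero≡ ctx) K≡ inv
    then λ {s} (glob@(ctx , _) , _ , δ′ , dig , _ , carry) →
    run-instr (monus! 17 2 18) (glob , δ′ , dig , outcome {s} (CtxR.one≡ ctx) carry)
    where
    outcome : ∀ {s δ′} → var s 2 ≡ 1 → Carry δ K (var s 18) δ′ →
      (var s 2 ∸ var s 18 ≡ 0 × suc (val δ K) ≡ n ^ K) ⊎ (var s 2 ∸ var s 18 ≡ 1 × val δ′ K ≡ suc (val δ K))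
    outcome one (inj₁ (c , _ , full)) = inj₁ (cong₂ _∸_ one c , full)
    outcome one (inj₂ (c , eq))       = inj₂ (cong₂ _∸_ one c , eq)

  -- A list of digits that makes the machine check a good packing.
  record Plan : Set where
    field
      {Y}      : List V
      {F}      : Log
      {ds}     : List V
      Y≡       : length Y ≡ M
      F≡       : length F ≡ k
      encoding : Encoding (Y ʳ++ []) F ds
      good     : ∀ δ → Checking.validBy δ (F ⊳ []) × Checking.sofarBy δ (F ⊳ []) ≤ ℓ
      fits     : length (Y ++ ds) ≤ K

  Win : Set
  Win = Σ[ δ ∈ (ℕ → V) ] Σ[ log ∈ Log ] length log ≡ k × Checking.validBy δ log × Checking.sofarBy δ log ≤ ℓ

  Reads-cong : ∀ {δ δ′ : ℕ → V} {p} xs → (∀ {i} → i < p + length xs → δ i ≡ δ′ i) → Reads δ p xs → Reads δ′ p xs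
  Reads-cong []           eq []      = []
  Reads-cong {p = p} (x ∷ xs) eq (refl ∷ r) =
    sym (eq (m<m+n p (s≤s z≤n))) ∷ Reads-cong xs (λ {i} lt → eq (subst (i <_) (sym (+-suc p (length xs))) lt)) r

  -- Every guess of value below `v` has been checked. The plan is quantified inside the invariant
  -- because it exists only under double negation and cannot steer the run.
  Covered : ℕ → ℕ → Set
  Covered v res = ∀ (P : Plan) (δ : ℕ → V) → Reads δ 0 (Plan.Y P ++ Plan.ds P) → val δ K < v → res ≢ 0

  Searching : (ℕ → V) → ℕ → State → Set
  Searching δ v s = Global s × Digits δ s × var s 4 ≡ K × val δ K ≡ v × (var s 16 ≢ 0 → Win) × Covered v (var s 16)

  Searched : State → Set
  Searched s = Ctx s × (var s 16 ≢ 0 → Win) × Covered (n ^ K) (var s 16)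

  iterationCost searchCost : ℕ
  iterationCost = guessCost + odometerCost
  searchCost = n ^ K * suc iterationCost + 1

  soundly : ∀ {δ b r} → (r ≢ 0 → Win) → Verdict δ b → r + (1 ∸ b) ≢ 0 → Win
  soundly {δ} {zero}  {r} sound verdict ≢0 =
    let ok , le = FailR.to (Verdict.fails verdict) refl in δ , Verdict.log verdict , Verdict.length≡ verdict , ok , le
  soundly {δ} {suc b} {r} sound verdict ≢0 = sound λ r≡0 → ≢0 (cong₂ _+_ r≡0 (0∸n≡0 b))

  -- When the odometer shows the value of the plan, uniqueness of n-ary digits makes the first `K`
  -- digits agree, and the plan occupies no more than these.
  accepted : ∀ {δ b v} → val δ K ≡ v → Verdict δ b → (P : Plan) → ∀ δ* → Reads δ* 0 (Plan.Y P ++ Plan.ds P) → val δ* K ≡ v → b ≡ 0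
  accepted {δ} v≡ verdict P δ* reads eq = FailR.from (Verdict.fails verdict)
    (subst (λ log → Checking.validBy δ log × Checking.sofarBy δ log ≤ ℓ) (sym (Verdict.planned verdict P.Y≡ P.F≡ P.encoding reads′)) (P.good δ))
    where
    module P = Plan P
    reads′ : Reads δ 0 (P.Y ++ P.ds)
    reads′ = Reads-cong (P.Y ++ P.ds) (λ lt → val-injective δ* δ K (trans eq (sym v≡)) (≤-trans lt P.fits)) reads

  coverage : ∀ {δ v b r} → val δ K ≡ v → Covered v r → Verdict δ b → Covered (suc v) (r + (1 ∸ b))
  coverage {δ} {v} {b} {r} v≡ covered verdict P δ* reads lt ≡0 = case m≤n⇒m<n∨m≡n (s≤s⁻¹ lt) of λ
    { (inj₁ lt′) → covered P δ* reads lt′ (m+n≡0⇒m≡0 r ≡0)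
    ; (inj₂ eq)  → contradiction (subst (λ b → 1 ∸ b ≡ 0) (accepted v≡ verdict P δ* reads eq) (m+n≡0⇒n≡0 r ≡0)) λ () }

  Outcome : ℕ → State → Set
  Outcome v s = (var s 17 ≡ 0 × Searched s) ⊎ (var s 17 ≡ 1 × Σ[ δ ∈ (ℕ → V) ] Searching δ (suc v) s)

  conclude : ∀ {δ v s δ′} → val δ K ≡ v → Global s → Digits δ′ s → var s 4 ≡ K → (var s 16 ≢ 0 → Win) → Covered (suc v) (var s 16) →
    (var s 17 ≡ 0 × suc (val δ K) ≡ n ^ K) ⊎ (var s 17 ≡ 1 × val δ′ K ≡ suc (val δ K)) → Outcome v s
  conclude {s = s} v≡ glob dig K≡ sound covered (inj₁ (stop , full)) =
    inj₁ (stop , proj₁ glob , sound , subst (λ v → Covered v (var s 16)) (trans (cong suc (sym v≡)) full) covered)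
  conclude {δ′ = δ′} v≡ glob dig K≡ sound covered (inj₂ (go , val≡)) =
    inj₂ (go , δ′ , glob , dig , K≡ , trans val≡ (cong suc v≡) , sound , covered)

  untouched : ∀ mode → writes (guess mode) 4 ≡ false
  untouched vertexMode = refl
  untouched edgeMode   = refl

  run-iteration : ∀ {δ v s} → Searching δ v s → Run (guess mode ⨾ odometer) s iterationCost (Outcome v)
  run-iteration {δ} {v} {s₀} (glob , dig , K≡ , v≡ , sound , covered) =
    (run-guess δ {s₀} glob dig framed)
    then λ {s₁} ((glob , dig , b , verdict , res≡) , kept) →
    let K≡₁ = trans (Kept.vars kept 4 (untouched mode)) K≡ in
    weaken ≤-refl
      (λ {s₂} ((glob , δ′ , dig , out) , kept′) →
        let res₂ = trans (Kept.vars kept′ 16 refl) res≡ in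
        conclude {δ} {v} {s₂} v≡ glob dig (trans (Kept.vars kept′ 4 refl) K≡₁)
          (subst (λ r → r ≢ 0 → Win) (sym res₂) (soundly sound verdict))
          (subst (Covered (suc v)) (sym res₂) (coverage v≡ covered verdict)) out)
      (run-odometer {δ} {s₁} glob dig K≡₁ framed)

  Remaining : ℕ → State → Set
  Remaining r s = Σ[ v ∈ ℕ ] Σ[ δ ∈ (ℕ → V) ] v + suc r ≡ n ^ K × Searching δ v s

  next-round : ∀ {r v s} → v + suc r ≡ n ^ K → Outcome v s →
    (var s 17 ≡ 0 × Searched s) ⊎ (var s 17 ≢ 0 × Σ[ r′ ∈ ℕ ] r ≡ suc r′ × Remaining r′ s)
  next-round v≡ (inj₁ result) = inj₁ result
  next-round {zero} {v} v≡ (inj₂ (_ , δ , (_ , _ , _ , val≡ , _))) =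
    contradiction (val< δ K) (≤⇒≯ (≤-reflexive (trans (sym v≡) (trans (+-comm v 1) (sym val≡)))))
  next-round {suc r} {v} v≡ (inj₂ (go , δ , inv)) =
    inj₂ ((λ eq → contradiction (trans (sym go) eq) λ ()) , r , refl , suc v , δ , trans (sym (+-suc v (suc r))) v≡ , inv)

  run-search : ∀ r {s} → var s 17 ≢ 0 → Remaining r s → Run (while 17 (guess mode ⨾ odometer)) s (suc r * suc iterationCost + 1) Searched
  run-search = run-while Remaining λ {r} {s} (v , δ , v≡ , inv) →
    weaken ≤-refl (λ {s′} → next-round {r} {v} {s′} v≡) (run-iteration {δ} {v} {s} inv)

-- Setup and the complete run

flatten-index : ∀ n (A : Fin n → Fin n → ℕ) u v → flatten n A (toℕ u * n + toℕ v) ≡ A u v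
flatten-index n A u v with toℕ u * n + toℕ v <? n * n
... | no ≮ = contradiction (subst (_< n * n) code (Fin.toℕ<n (combine u v))) ≮
  where
  code : toℕ (combine u v) ≡ toℕ u * n + toℕ v
  code = trans (Fin.toℕ-combine u v) (cong (_+ toℕ v) (*-comm n (toℕ u)))
... | yes lt = cong (λ p → A (proj₁ p) (proj₂ p)) located
  where
  code : toℕ (combine u v) ≡ toℕ u * n + toℕ v
  code = trans (Fin.toℕ-combine u v) (cong (_+ toℕ v) (*-comm n (toℕ u)))
  located : remQuot {n} n (fromℕ< lt) ≡ (u , v)
  located = trans (cong (remQuot {n} n) (Fin.toℕ-injective (trans (Fin.toℕ-fromℕ< lt) (sym code)))) (Fin.remQuot-combine {n} u v)

-- The constant comes from enough-steps.
scaled : ℕ → ℕ → ℕ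
scaled k zero    = 16384
scaled k (suc j) = k * scaled k j

module Main (I : Instance) (mode : Mode) where
  open Base I

  -- A guess takes `M` digits for `X` and, for each of the `k` cycles, a start and `M` pairs. The
  -- total `M + k * suc (M + M)` is rounded up to four times `k * M`, which two doublings compute.
  M K : ℕ
  M = scaled k 4
  K = (k * M + k * M) + (k * M + k * M)

  open Machine I M
  open Guessing I M mode
  open Odometer I M mode K

  timesCost setupCost solverCost : ℕ
  timesCost  = 1 + loopCost k 1
  setupCost  = 5 + (loopCost 4 (timesCost + 1) + (timesCost + (3 + (3 + loopCost n 4))))
  solverCost = suc (setupCost + (searchCost + 1) + 1)

  Constants : State → Set
  Constants s = var s 0 ≡ n × var s 1 ≡ k × var s 2 ≡ 1 × var s 31 ≡ 0 × var s 17 ≡ 1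

  run-timesK : ∀ {s m} → Constants s → var s 3 ≡ m → Run timesK s timesCost (λ s → Constants s × var s 3 ≡ m × var s 14 ≡ k * m)
  run-timesK {m = m} C m≡ =
    run-instr (const! 14 0) {Q = λ s → Constants s × var s 3 ≡ m × var s 14 ≡ 0 * m} (C , m≡ , refl)
    then λ (C@(n≡ , k≡ , one≡ , zero≡ , _) , m≡ , z≡) →
    run-loop (λ j s → Constants s × var s 3 ≡ m × var s 14 ≡ j * m) refl refl refl (λ _ inv → inv) k
      (λ {j} _ _ (C , m≡ , sum≡) → run-instr (add! 14 14 3) (C , m≡ , trans (cong₂ _+_ sum≡ m≡) (+-comm (j * m) m)))
      one≡ zero≡ k≡ (C , m≡ , z≡)

  Ready : State → Set
  Ready s = Constants s × var s 3 ≡ M × var s 4 ≡ K × (∀ (u : V) → arr s 1 (toℕ u) ≡ toℕ u * n)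

  run-setup : Run setup (input I) setupCost Ready
  run-setup =
    run-block _ {Q = λ s → Constants s × var s 3 ≡ scaled k 0 × var s 19 ≡ 4} ((refl , refl , refl , refl , refl) , refl , refl)
    then λ (C@(_ , _ , one≡ , zero≡ , _) , m≡ , four≡) →
    run-loop (λ j s → Constants s × var s 3 ≡ scaled k j) refl refl refl (λ _ inv → inv) 4
      (λ {j} _ _ (C , m≡) → run-timesK C m≡
        then λ (C@(_ , _ , _ , zero≡ , _) , m≡ , p≡) → run-instr (add! 3 14 31) (C , trans (cong₂ _+_ p≡ zero≡) (+-identityʳ (k * scaled k j))))
      one≡ zero≡ four≡ (C , m≡)
    then λ (C , m≡) → run-timesK C m≡
    then λ (C , m≡ , p≡) →
    run-block _ {Q = λ s → Constants s × var s 3 ≡ M × var s 4 ≡ K} (C , m≡ , cong (λ p → (p + p) + (p + p)) p≡)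
    then λ (C , m≡ , K≡) →
    run-block _ {Q = Offsetting 0} (C , m≡ , K≡ , refl , refl , λ u ())
    then λ inv@((n≡ , _ , one≡ , zero≡ , _) , _) →
    weaken ≤-refl (λ (C , m≡ , K≡ , _ , _ , off) → C , m≡ , K≡ , λ u → off u (Fin.toℕ<n u))
      (run-loop Offsetting refl refl refl (λ _ inv → inv) n (λ {_} {s} _ _ inv → run-offset {s = s} inv) one≡ zero≡ n≡ inv)
    where
    Offsetting : ℕ → State → Set
    Offsetting j s = Constants s × var s 3 ≡ M × var s 4 ≡ K × var s 28 ≡ j × var s 14 ≡ j * n ×
      (∀ (u : V) → toℕ u < j → arr s 1 (toℕ u) ≡ toℕ u * n)
    run-offset : ∀ {j s} → Offsetting j s → Run (block (store! 14 1 28 ∷ add! 14 14 0 ∷ add! 28 28 2 ∷ [])) s 4 (Offsetting (suc j))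
    run-offset {j} {s} (C@(n≡ , _ , one≡ , _) , m≡ , K≡ , j≡ , o≡ , off) =
      run-block _ (C , m≡ , K≡ , trans (cong₂ _+_ j≡ one≡) (+-comm j 1) , trans (cong₂ _+_ o≡ n≡) (+-comm (j * n) n) , off′)
      where
      off′ : ∀ (u : V) → toℕ u < suc j → (arr s 1 [ var s 28 ↦ var s 14 ]) (toℕ u) ≡ toℕ u * n
      off′ u lt with m≤n⇒m<n∨m≡n (s≤s⁻¹ lt)
      ... | inj₁ lt′ = trans (update-there (arr s 1) (λ eq → <⇒≢ lt′ (trans eq j≡))) (off u lt′)
      ... | inj₂ eq  = trans (update-here (arr s 1) (trans eq (sym j≡))) (trans o≡ (cong (_* n) (sym eq)))

  nth : V → List V → ℕ → V
  nth v []       _       = v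
  nth v (x ∷ xs) zero    = x
  nth v (x ∷ xs) (suc i) = nth v xs i

  Reads-nth : ∀ {v δ} p xs → (∀ i → δ (p + i) ≡ nth v xs i) → Reads δ p xs
  Reads-nth p []       eq = []
  Reads-nth {δ = δ} p (x ∷ xs) eq = trans (cong δ (sym (+-identityʳ p))) (eq 0) ∷ Reads-nth (suc p) xs (λ i → trans (cong δ (sym (+-suc p i))) (eq (suc i)))

  module _ (0<n : 0 < n) where
    v₀ : V
    v₀ = fromℕ< 0<n

    val-zero : ∀ j → val (const v₀) j ≡ 0
    val-zero zero    = refl
    val-zero (suc j) = cong₂ _+_ (val-zero j) (cong (_* n ^ j) (Fin.toℕ-fromℕ< 0<n))

    Answer : State → Set
    Answer s = (accepts s → Win) × (Plan → accepts s)

    start-search : ∀ {s} → Ready s × Kept setup (input I) s → Searching (const v₀) 0 s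
    start-search {s} (((n≡ , k≡ , one≡ , zero≡ , _) , M≡ , K≡ , off) , kept) = (ctx , glob) , dig , K≡ , val-zero K ,
      (λ ≢0 → contradiction (vars 16 refl) ≢0) , λ _ _ _ ()
      where
      open Kept kept
      blank : ∀ a → stores setup a ≡ false → arr (input I) a ≡ const 0 → ∀ {b} i → arr s a i ≤ b
      blank a fresh z i = ≤-trans (≤-reflexive (trans (cong (λ f → f i) (arrs a fresh)) (cong (λ f → f i) z))) z≤n
      ctx : Ctx s
      ctx = record { n≡ = n≡ ; k≡ = k≡ ; one≡ = one≡ ; M≡ = M≡ ; zero≡ = zero≡ ; off≡ = off
                   ; adj≡ = λ u v → trans (cong (λ f → f (index u v)) (arrs 0 refl)) (flatten-index n (adjacencyMatrix I) u v)
                   ; ℓ≡ = wvars 0 refl ; wz≡ = wvars 4 refl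
                   ; wt≡ = λ u v → trans (cong (λ f → f (index u v)) (warrs 0 refl)) (flatten-index n (weightMatrix I) u v) }
      glob : GlobalR (var s 5) (var s 6) (var s 15) (arr s 3) (arr s 4) (arr s 5) (arr s 6) (arr s 7)
      glob = record { inX≤ = blank 3 refl refl ; used≤ = blank 4 refl refl ; usedE≤ = blank 5 refl refl ; fin≤ = blank 6 refl refl
                    ; nx< = λ i → ≤-<-trans (blank 7 refl refl i) 0<n }
      dig : Digits (const v₀) s
      dig i = trans (cong (λ f → f i) (arrs 2 refl)) (sym (Fin.toℕ-fromℕ< 0<n))

    run-solver : Run (solver mode) (input I) solverCost Answer
    run-solver = run-ifnz (λ _ → searching) (λ n≡0 → contradiction n≡0 (>⇒≢ 0<n))
      where
      n^K : ∃[ r ] n ^ K ≡ suc r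
      n^K with n ^ K | val< (const v₀) K
      ... | suc r | _ = r , refl
      searching : Run (setup ⨾ while 17 (guess mode ⨾ odometer) ⨾ instr (add! 0 16 31)) (input I) (setupCost + (searchCost + 1)) Answer
      searching =
        (run-setup framed)
        then λ {s} (R@((_ , _ , _ , _ , go) , _) , kept) →
        weaken (≤-reflexive (cong (λ N → N * suc iterationCost + 1) (sym (proj₂ n^K)))) id
          (run-search (proj₁ n^K) {s} (λ eq → contradiction (trans (sym go) eq) λ ()) (0 , const v₀ , sym (proj₂ n^K) , start-search {s} (R , kept)))
        then λ {s} (ctx , sound , covered) →
        run-instr (add! 0 16 31)
          ((λ ≢0 → sound (λ eq → ≢0 (cong₂ _+_ eq (CtxR.zero≡ ctx)))) ,
           λ P eq → covered P (nth v₀ (Plan.Y P ++ Plan.ds P)) (Reads-nth {v₀} 0 _ λ _ → refl) (val< _ K) (m+n≡0⇒m≡0 _ eq))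

-- Logs of valid moves

Unique-reverse : ∀ {A : Set} (xs : List A) → Unique xs → Unique (reverse xs)
Unique-reverse []       u = []
Unique-reverse (x ∷ xs) u = subst Unique (sym (unfold-reverse x xs))
  (Unique-++-comm [ x ] (∉-Unique (λ x∈ → Unique-∉ u (Any.reverse⁻ x∈)) (Unique-reverse xs (AllPairs.tail u))))

module Modes (I : Instance) where
  open Base I
  open Cycles I

  Dis : Mode → Rel (Cycle G) 0ℓ
  Dis vertexMode = VertexDisjoint
  Dis edgeMode   = EdgeDisjoint

  Dis-sym : ∀ mode {C D} → Dis mode C D → Dis mode D C
  Dis-sym vertexMode {C} {D} = vertexDisjoint-sym {C} {D}
  Dis-sym edgeMode   {C} {D} = edgeDisjoint-sym {C} {D}

  edgesOf : ATour → List (V × V)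
  edgesOf A = edges (start A) (path A)

  -- The machine checks edges in both modes, so vertex mode has to supply their disjointness too.
  Separate : Mode → ATour → ATour → Set
  Separate vertexMode A B = Disjoint (path A) (path B) × EdgesApart (edgesOf B) (edgesOf A)
  Separate edgeMode   A B = EdgesApart (edgesOf B) (edgesOf A)

  strip : ATour → V × List V
  strip (s , ms , _) = s , ms

module Logs (I : Instance) (M : ℕ) (mode : Mode) (δ : ℕ → Fin (Instance.n I)) where
  open Base I
  open Cycles I
  open Modes I
  open Machine I M
  open Guessing I M mode
  open Checking δ
  open Following I M X δ

  module _ (U : List V) (E : List (V × V)) (c : V) (tot : ℕ) (OK : Set) where
    private
      topᶜ = top U E c tot OK
      trailᶜ = trail U E c tot OK
      validᶜ = valid U E c tot OK
      sofarᶜ = sofar U E c tot OK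

    own : List V → List (V × V)
    own []        = []
    own (x ∷ rms) = (topᶜ rms , x) ∷ own rms

    own-∈ : ∀ {a b} rms → (a , b) ∈ own rms → b ∈ rms
    own-∈ (x ∷ rms) (here refl) = here refl
    own-∈ (x ∷ rms) (there e∈)  = there (own-∈ rms e∈)

    walk-top : ∀ {R : V → V → Set} {t} rms → Walk R c (reverse rms) t → t ≡ topᶜ rms
    walk-top []        nil = refl
    walk-top {R} {t} (x ∷ rms) p = walk-snoc⁻ (reverse rms) (subst (λ l → Walk R c l t) (unfold-reverse x rms) p)

    walk-snoc : ∀ {R : V → V → Set} {x} rms → Walk R c (reverse rms) (topᶜ rms) → R (topᶜ rms) x → Walk R c (reverse (x ∷ rms)) x
    walk-snoc {R} {x} rms p r = subst (λ l → Walk R c l x) (sym (unfold-reverse x rms)) (walk-++ p (cons r nil))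

    walk-unsnoc′ : ∀ {R : V → V → Set} {x t} rms → Walk R c (reverse (x ∷ rms)) t → Walk R c (reverse rms) (topᶜ rms) × R (topᶜ rms) x
    walk-unsnoc′ {R} {x} {t} rms p with walk-split (reverse rms) (subst (λ l → Walk R c l t) (unfold-reverse x rms) p)
    ... | m , p₁ , cons r nil with walk-top rms p₁
    ...   | refl = p₁ , r

    edges-reverse : ∀ x rms → Walk Adj c (reverse rms) (topᶜ rms) → edges c (reverse (x ∷ rms)) ≡ edges c (reverse rms) ++ [ (topᶜ rms , x) ]
    edges-reverse x rms p = trans (cong (edges c) (unfold-reverse x rms)) (edges-++ [ x ] p)

    own-edges : ∀ {e} rms → Walk Adj c (reverse rms) (topᶜ rms) → e ∈ own rms → e ∈ edges c (reverse rms)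
    own-edges (x ∷ rms) p e∈ with walk-unsnoc′ rms p
    ... | p₁ , _ = subst (_ ∈_) (sym (edges-reverse x rms p₁)) (case e∈ of λ
          { (here eq) → ∈-++⁺ʳ (edges c (reverse rms)) (here eq) ; (there e∈) → ∈-++⁺ˡ (own-edges rms p₁ e∈) })

    edges-trail : ∀ {e} rms → Walk Adj c (reverse rms) (topᶜ rms) → e ∈ edges c (reverse rms) → e ∈ trailᶜ rms
    edges-trail (x ∷ rms) p e∈ with walk-unsnoc′ rms p
    ... | p₁ , _ with ∈-++⁻ (edges c (reverse rms)) (subst (_ ∈_) (edges-reverse x rms p₁) e∈)
    ...   | inj₁ e∈′       = there (edges-trail rms p₁ e∈′)
    ...   | inj₂ (here eq) = here eq

    old-trail : ∀ {e} rms → e ∈ E → e ∈ trailᶜ rms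
    old-trail []        e∈ = e∈
    old-trail (x ∷ rms) e∈ = there (old-trail rms e∈)

    trail-cases : ∀ {P : V × V → Set} rms → Any P (trailᶜ rms) → Any P (own rms) ⊎ Any P E
    trail-cases []        p         = inj₂ p
    trail-cases (x ∷ rms) (here p)  = inj₁ (here p)
    trail-cases (x ∷ rms) (there p) = [ inj₁ ∘ there , inj₂ ]′ (trail-cases rms p)

    sofar-≡ : ∀ rms → Walk Adj c (reverse rms) (topᶜ rms) → sofarᶜ rms ≡ tot + len c (reverse rms)
    sofar-≡ []        p = sym (+-identityʳ tot)
    sofar-≡ (x ∷ rms) p with walk-unsnoc′ rms p
    ... | p₁ , _ = trans (cong (_+ wt (topᶜ rms) x) (sofar-≡ rms p₁)) (trans (+-assoc tot _ _) (cong (tot +_)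
          (sym (trans (cong (len c) (unfold-reverse x rms)) (trans (len-++ [ x ] p₁) (cong (len c (reverse rms) +_) (+-identityʳ _)))))))

    record Sound (rms : List V) : Set where
      field
        ok     : OK
        walk   : Walk Adj c (reverse rms) (topᶜ rms)
        unique : Unique rms
        off    : All (_∉ U) rms
        fresh  : ∀ {e} → e ∈ edges c (reverse rms) → ¬ Any (Same e) E

    valid⇒ : ∀ rms → validᶜ rms → Sound rms
    valid⇒ []        ok = record { ok = ok ; walk = nil ; unique = [] ; off = [] ; fresh = λ () }
    valid⇒ (x ∷ rms) (((v , e) , x∉) , new) = record
      { ok = S.ok ; walk = walk-snoc rms S.walk e ; unique = ∉-Unique (λ x∈ → x∉ (∈-++⁺ˡ x∈)) S.unique
      ; off = (λ x∈ → x∉ (∈-++⁺ʳ rms x∈)) ∷ S.off ; fresh = fresh }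
      where
      module S = Sound (valid⇒ rms v)
      fresh : ∀ {e} → e ∈ edges c (reverse (x ∷ rms)) → ¬ Any (Same e) E
      fresh e∈ same with ∈-++⁻ (edges c (reverse rms)) (subst (_ ∈_) (edges-reverse x rms S.walk) e∈)
      ... | inj₁ e∈′         = S.fresh e∈′ same
      ... | inj₂ (here refl) = new (let y , y∈ , s = find same in lose (old-trail rms y∈) s)

    -- An edge of the tour can repeat an earlier one of the same tour only by going straight back
    -- along it. This revisits a vertex unless it returns to the start, which is not marked in
    -- advance, right after the first move; `late` excludes that.
    valid⇐ : ∀ rms → (∀ xs {x rest} → rms ≡ xs ++ x ∷ rest → x ≡ c → 2 ≤ length rest) → Sound rms → validᶜ rms
    valid⇐ []        late S = Sound.ok S
    valid⇐ (x ∷ rms) late S with walk-unsnoc′ rms (Sound.walk S)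
    ... | p₁ , e = ((valid⇐ rms (λ xs eq → late (x ∷ xs) (cong (x ∷_) eq)) S₁ , e) , x∉) , new
      where
      module S = Sound S
      u : Unique rms
      u = AllPairs.tail S.unique
      S₁ : Sound rms
      S₁ = record { ok = S.ok ; walk = p₁ ; unique = u ; off = All.tail S.off
                  ; fresh = λ e∈ → S.fresh (subst (_ ∈_) (sym (edges-reverse x rms p₁)) (∈-++⁺ˡ e∈)) }
      x∉rms : x ∉ rms
      x∉rms = Unique-∉ S.unique
      x∉ : x ∉ rms ++ U
      x∉ x∈ = [ x∉rms , All.head S.off ]′ (∈-++⁻ rms x∈)
      unused : ∀ rms → x ∉ rms → Unique rms → (x ≡ c → 2 ≤ length rms) → ¬ Any (Same (topᶜ rms , x)) (own rms)
      unused (y ∷ rms)     x∉ u lt (here (inj₁ (_ , x≡y)))    = x∉ (here x≡y)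
      unused (y ∷ [])      x∉ u lt (here (inj₂ (_ , x≡c)))    = contradiction (lt x≡c) λ { (s≤s ()) }
      unused (y ∷ z ∷ rms) x∉ u lt (here (inj₂ (_ , x≡z)))    = x∉ (there (here x≡z))
      unused (y ∷ rms)     x∉ u lt (there same) with find same
      ... | (a , b) , ab∈ , inj₁ (_ , x≡b)  = x∉ (there (subst (_∈ rms) (sym x≡b) (own-∈ rms ab∈)))
      ... | (a , b) , ab∈ , inj₂ (y≡b , _)  = Unique-∉ u (subst (_∈ rms) (sym y≡b) (own-∈ rms ab∈))
      new : ¬ Any (Same (topᶜ rms , x)) (trailᶜ rms)
      new same with trail-cases rms same
      ... | inj₁ same′ = unused rms x∉rms u (late [] refl) same′
      ... | inj₂ same′ = S.fresh (subst (_ ∈_) (sym (edges-reverse x rms p₁)) (∈-++⁺ʳ (edges c (reverse rms)) (here refl))) same′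

  record Extracted (log : Log) : Set where
    field
      tours    : List ATour
      number   : length tours ≡ length log
      disjoint : AllPairs (λ A B → Dis mode (fromTour A) (fromTour B)) tours
      total    : totalLength tours ≡ sofarBy log
      inside   : All (λ A → All (_∈ usedBy log) (path A)) tours
      traced   : All (λ A → All (_∈ trailBy log) (edgesOf A)) tours

  -- `inside` and `traced` place the earlier tours within the blocked vertices and edges, so the
  -- checks made for the newest tour separate it from all of them at once.
  extract : ∀ log → validBy log → Extracted log
  extract [] _ = record { tours = [] ; number = refl ; disjoint = [] ; total = refl ; inside = [] ; traced = [] }
  extract ((c , rms) ∷ log) ((v , closed) , long) = record
    { tours = A ∷ R.tours ; number = cong suc R.number
    ; disjoint = All.zipWith (λ {B} (i , t) → separate mode {B} S.off i t) (R.inside , R.traced) ∷ R.disjoint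
    ; total = trans (cong (len c (reverse rms) +_) R.total) (trans (+-comm _ (sofarBy log)) (sym (sofar-≡ U E c tot OK rms S.walk)))
    ; inside = All.tabulate (λ x∈ → ∈-++⁺ˡ {xs = rms} (Any.reverse⁻ x∈)) ∷ All.map (All.map (∈-++⁺ʳ rms)) R.inside
    ; traced = All.tabulate (edges-trail U E c tot OK rms S.walk) ∷ All.map (All.map (old-trail U E c tot OK rms)) R.traced }
    where
    U = U₀ (usedBy log)
    E = trailBy log
    tot = sofarBy log
    OK = validBy log
    module S = Sound (valid⇒ U E c tot OK rms v)
    module R = Extracted (extract log S.ok)
    A : ATour
    A = c , reverse rms , tour (subst (Walk Adj c (reverse rms)) closed S.walk) (Unique-reverse rms S.unique)
                               (subst (3 ≤_) (sym (length-reverse rms)) long)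
    separate : ∀ mode {B} → All (_∉ carriedOver mode (usedBy log)) rms → All (_∈ usedBy log) (path B) → All (_∈ trailBy log) (edgesOf B) →
      Dis mode (fromTour A) (fromTour B)
    separate vertexMode {B} off i _ = fromTour-vertexDisjoint A B λ (x∈A , x∈B) → All.lookup off (Any.reverse⁻ x∈A) (All.lookup i x∈B)
    separate edgeMode {B} _ _ t = fromTour-edgeDisjoint A B λ e∈ e∈′ same → S.fresh e∈ (lose (All.lookup t e∈′) same)

  Compatible : Log → ATour → Set
  Compatible log A = All (_∉ U₀ (usedBy log)) (path A) × (∀ {e} → e ∈ edgesOf A → ¬ Any (Same e) (trailBy log))

  -- `Compatible` says that nothing traced so far blocks a tour still to come. Tracing one tour
  -- preserves this for the others because they are separate from it.
  extend-log : ∀ F log → validBy log → AllPairs (Separate mode) F → All (Compatible log) F →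
    validBy (map strip F ⊳ log) × sofarBy (map strip F ⊳ log) ≡ sofarBy log + totalLength F
  extend-log [] log ok _ _ = ok , sym (+-identityʳ _)
  extend-log (A@(s , ms , B) ∷ F) log ok (sep ∷ seps) ((off , fresh) ∷ compat) =
    let ok″ , total = extend-log F ((s , rms) ∷ log) ok′ seps (All.zipWith (λ {C} (sp , cp) → still mode {C} sp cp) (sep , compat))
    in ok″ , trans total (trans (cong (_+ totalLength F) (trans (sofar-≡ U E s tot OK rms walk′) (cong (λ l → tot + len s l) involutive))) (+-assoc tot _ _))
    where
    U = U₀ (usedBy log)
    E = trailBy log
    tot = sofarBy log
    OK = validBy log
    rms : List V
    rms = ms ʳ++ []
    involutive : reverse rms ≡ ms
    involutive = reverse-involutive ms
    walk₀ : Walk Adj s (reverse rms) s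
    walk₀ = subst (λ l → Walk Adj s l s) (sym involutive) (walk B)
    closed : s ≡ top U E s tot OK rms
    closed = walk-top U E s tot OK rms walk₀
    walk′ : Walk Adj s (reverse rms) (top U E s tot OK rms)
    walk′ = subst (Walk Adj s (reverse rms)) closed walk₀
    long′ : 3 ≤ length rms
    long′ = subst (3 ≤_) (sym (length-reverse ms)) (long B)
    sound : Sound U E s tot OK rms
    sound = record
      { ok = ok ; walk = walk′ ; unique = Unique-reverse ms (unique B)
      ; off = All.tabulate (λ x∈ → All.lookup off (Any.reverse⁻ x∈)) ; fresh = λ {e} e∈ → fresh (subst (λ l → e ∈ edges s l) involutive e∈) }
    late : ∀ xs {x rest} → rms ≡ xs ++ x ∷ rest → x ≡ s → 2 ≤ length rest
    late [] eq refl = s≤s⁻¹ (subst (3 ≤_) (cong length eq) long′)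
    late (y ∷ xs) eq refl = contradiction (∈-++⁺ʳ xs (here refl))
      (subst (_∉ xs ++ s ∷ _) (sym (trans closed (cong (top U E s tot OK) eq))) (Unique-∉ (subst Unique eq (Sound.unique sound))))
    ok′ : validBy ((s , rms) ∷ log)
    ok′ = (valid⇐ U E s tot OK rms late sound , sym closed) , long′
    traces : ∀ {C e} → EdgesApart (edgesOf C) (edgesOf A) → (e ∈ edgesOf C → ¬ Any (Same e) E) → e ∈ edgesOf C →
      ¬ Any (Same e) (trailBy ((s , rms) ∷ log))
    traces apart old e∈ same with trail-cases U E s tot OK rms same
    ... | inj₂ same′ = old e∈ same′
    ... | inj₁ same′ = let e′ , e′∈ , sm = find same′ in
            apart e∈ (subst (λ l → e′ ∈ edges s l) involutive (own-edges U E s tot OK rms walk′ e′∈)) sm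
    still : ∀ mode {C} → Separate mode A C → All (_∉ carriedOver mode (usedBy log)) (path C) × (∀ {e} → e ∈ edgesOf C → ¬ Any (Same e) E) →
      All (_∉ carriedOver mode (rms ++ usedBy log)) (path C) × (∀ {e} → e ∈ edgesOf C → ¬ Any (Same e) (trailBy ((s , rms) ∷ log)))
    still vertexMode {C} (disj , apart) (off , old) =
      All.tabulate (λ x∈ x∈′ → [ (λ x∈rms → disj (Any.reverse⁻ x∈rms , x∈)) , All.lookup off x∈ ]′ (∈-++⁻ rms x∈′)) , traces {C} apart old
    still edgeMode {C} apart (off , old) = All.tabulate (λ _ ()) , traces {C} apart old

-- Guesses for optimal packings

-- After this many ears there are k disjoint cycles; a piece is cut off at this many edge ends; and an optimal
-- packing weighs at most this many times the length of a short cycle.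
ears pieceSize ratio : ℕ → ℕ
ears k      = k * k * 1280
pieceSize k = k * 128
ratio k     = k * (ears k + ears k + (ears k + ears k) + 2)

-- From `2 * 1280 + 128 = 128 * 21` there are at most `k * 21` pieces. Their pairs and the edges
-- deleted in `k` rounds then number at most `21 * 21 + 6 * 128 = 1209` times `k * k`, which is
-- below 1280 times `k * k`.
few-pieces : ∀ k → 1 ≤ k → ∀ s → pieceSize k * s ≤ ears k + ears k + pieceSize k * k →
  s * s + k * (3 * pieceSize k + 3 * pieceSize k) < ears k
few-pieces k@(suc k′) _ s le = begin-strict
  s * s + k * (3 * (k * 128) + 3 * (k * 128))           ≤⟨ +-monoˡ-≤ _ (*-mono-≤ s≤ s≤) ⟩
  k * 21 * (k * 21) + k * (3 * (k * 128) + 3 * (k * 128)) ≡⟨ collect k ⟩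
  k * k * 1209                                           <⟨ *-monoʳ-< (k * k) (≤ᵇ⇒≤ 1210 1280 _) ⟩
  k * k * 1280                                           ∎
  where
  open ≤-Reasoning
  s≤ : s ≤ k * 21
  s≤ = *-cancelˡ-≤ (k * 128) {{m*n≢0 k 128}} (≤-trans le (≤-reflexive (total k)))
    where
    total : ∀ k → k * k * 1280 + k * k * 1280 + k * 128 * k ≡ k * 128 * (k * 21)
    total = solve-∀
  collect : ∀ k → k * 21 * (k * 21) + k * (3 * (k * 128) + 3 * (k * 128)) ≡ k * k * 1209
  collect = solve-∀

-- All powers of `k` are raised to the fourth. The coefficients `3 + 5120 + 10240 + 4 = 15367` are
-- rounded up to the power of two 16384. The list `X` enters with one extra vertex, the one used for
-- padding.
enough-steps : ∀ k → 1 ≤ k → 1 + (suc (ears k + ears k) + suc (ears k + ears k)) + (ratio k + ratio k) ≤ scaled k 4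
enough-steps k 1≤k = begin
  1 + (suc (ears k + ears k) + suc (ears k + ears k)) + (ratio k + ratio k) ≡⟨ expand k ⟩
  3 + (k * k * 5120 + (k * (k * k) * 10240 + k * 4))                        ≤⟨ +-mono-≤ (const≤ 3) (+-mono-≤ square≤ (+-mono-≤ cube≤ linear≤)) ⟩
  k⁴ * 3 + (k⁴ * 5120 + (k⁴ * 10240 + k⁴ * 4))                              ≡⟨ collect k⁴ ⟩
  k⁴ * 15367                                                                ≤⟨ *-monoʳ-≤ k⁴ (≤ᵇ⇒≤ 15367 16384 _) ⟩
  k⁴ * 16384                                                                ≡⟨ nest k 16384 ⟩
  scaled k 4                                                                ∎
  where
  open ≤-Reasoning
  k⁴ : ℕ
  k⁴ = k * (k * (k * k))
  up : ∀ m → m ≤ k * m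
  up m = ≤-trans (≤-reflexive (sym (*-identityˡ m))) (*-monoˡ-≤ m 1≤k)
  const≤ : ∀ c → c ≤ k⁴ * c
  const≤ c = ≤-trans (≤-reflexive (sym (*-identityˡ c))) (*-monoˡ-≤ c (≤-trans 1≤k (≤-trans (up k) (≤-trans (up (k * k)) (up (k * (k * k)))))))
  linear≤ : k * 4 ≤ k⁴ * 4
  linear≤ = *-monoˡ-≤ 4 (≤-trans (up k) (≤-trans (up (k * k)) (up (k * (k * k)))))
  square≤ : k * k * 5120 ≤ k⁴ * 5120
  square≤ = *-monoˡ-≤ 5120 (≤-trans (up (k * k)) (up (k * (k * k))))
  cube≤ : k * (k * k) * 10240 ≤ k⁴ * 10240
  cube≤ = *-monoˡ-≤ 10240 (up (k * (k * k)))
  expand : ∀ k → 1 + (suc (k * k * 1280 + k * k * 1280) + suc (k * k * 1280 + k * k * 1280)) +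
    (k * (k * k * 1280 + k * k * 1280 + (k * k * 1280 + k * k * 1280) + 2) + k * (k * k * 1280 + k * k * 1280 + (k * k * 1280 + k * k * 1280) + 2))
    ≡ 3 + (k * k * 5120 + (k * (k * k) * 10240 + k * 4))
  expand = solve-∀
  collect : ∀ x → x * 3 + (x * 5120 + (x * 10240 + x * 4)) ≡ x * 15367
  collect = solve-∀
  nest : ∀ k c → k * (k * (k * k)) * c ≡ k * (k * (k * (k * c)))
  nest = solve-∀

module Correctness (I : Instance) (mode : Mode) where
  open Base I
  open Cycles I
  open Routes I
  open Modes I
  open Main I mode using (M; K)
  open Guessing I M mode
  open Odometer I M mode K using (Plan; Win)

  extracted : Win → CyclePacking I (Dis mode)
  extracted (δ , log , length≡ , ok , le) =
    let C , disj , total = packing (Dis mode) (λ {C} {D} → Dis-sym mode {C} {D}) E.tours (trans E.number length≡) E.disjoint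
    in C , disj , ≤-trans (≤-reflexive (trans total E.total)) le
    where module E = Logs.Extracted (Logs.extract I M mode δ log ok)

  weightOf : (Fin k → Cycle G) → ℕ
  weightOf C = sum (λ i → cycleLength w (C i))

  Disjoint′ : (Fin k → Cycle G) → Set
  Disjoint′ C = ∀ i j → i ≢ j → Dis mode (C i) (C j)

  record Optimal : Set where
    field
      cycles   : Fin k → Cycle G
      disjoint : Disjoint′ cycles
      light    : weightOf cycles ≤ ℓ
      minimal  : ∀ C → Disjoint′ C → weightOf cycles ≤ weightOf C

  -- Minimality is proved by refutation: by recursion a lighter packing would contradict the
  -- assumption that there is no optimal one. The weight drops each time, so the fuel suffices.
  optimal : ∀ fuel C → Disjoint′ C → weightOf C ≤ ℓ → weightOf C ≤ fuel → ¬ ¬ Optimal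
  optimal zero C disj light W≤ κ = κ record
    { cycles = C ; disjoint = disj ; light = light ; minimal = λ C′ _ → ≤-trans W≤ z≤n }
  optimal (suc fuel) C disj light W≤ κ = κ record
    { cycles = C ; disjoint = disj ; light = light ; minimal = λ C′ disj′ → case weightOf C ≤? weightOf C′ of λ
      { (yes le) → le
      ; (no ≰) → ⊥-elim (optimal fuel C′ disj′ (≤-trans (<⇒≤ (≰⇒> ≰)) light) (s≤s⁻¹ (≤-trans (≰⇒> ≰) W≤)) κ) } }

  Dis-vertex : ∀ mode {C D} → VertexDisjoint C D → Dis mode C D
  Dis-vertex vertexMode         d = d
  Dis-vertex edgeMode {C} {D} d = vertex⇒edgeDisjoint {C} {D} d

  pairs-length : ∀ {X c ds j ms} → Pairs X c ds j ms → length ds ≡ j + j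
  pairs-length done         = refl
  pairs-length (step {j = j} _ _ p) = cong suc (trans (cong suc (pairs-length p)) (sym (+-suc j j)))

  0<length′ : ∀ A → 0 < length′ A
  0<length′ (s , x ∷ ms , tour (cons e p) _ _) = ≤-trans (wt-pos e) (m≤m+n _ _)
  0<length′ (s , [] , tour _ _ ())

  totalLength-tabulate : ∀ {m} (f : Fin m → ATour) → totalLength (tabulate f) ≡ sum (length′ ∘ f)
  totalLength-tabulate {zero}  f = refl
  totalLength-tabulate {suc m} f = cong (length′ (f zero) +_) (totalLength-tabulate (f ∘ suc))

  each≤ : ∀ F → All (λ A → length′ A ≤ totalLength F) F
  each≤ []      = []
  each≤ (A ∷ F) = m≤m+n _ _ ∷ All.map (λ le → ≤-trans le (m≤n+m _ (length′ A))) (each≤ F)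

  encode : ∀ {L X Z R} → Girth> L X → X ⊆ Z → 1 + (length Z + length Z) + (R + R) ≤ M →
    ∀ F → All (λ A → length′ A ≤ suc L * R) F → Σ[ ds ∈ List V ] Encoding X (map strip F) ds × length ds ≡ length F * suc (M + M)
  encode girth X⊆Z enough [] [] = [] , [] , refl
  encode girth X⊆Z enough ((s , ms , B) ∷ F) (le ∷ les) with tour-pairs girth B X⊆Z le enough | encode girth X⊆Z enough F les
  ... | ds , ps | rest , enc , len≡ = s ∷ ds ++ rest , ps ∷ enc ,
        cong suc (trans (length-++ ds) (cong₂ _+_ (pairs-length ps) len≡))

  module FromOptimal (O : Optimal) where
    module O = Optimal O

    W : ℕ
    W = weightOf O.cycles

    F : List ATour
    F = tabulate (toTour ∘ O.cycles)

    F≡ : length F ≡ k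
    F≡ = length-tabulate (toTour ∘ O.cycles)

    total : totalLength F ≡ W
    total = trans (totalLength-tabulate (toTour ∘ O.cycles)) (sum-cong-≗ (toTour-length ∘ O.cycles))

    separate : ∀ mode {C D} → Dis mode C D → Separate mode (toTour C) (toTour D)
    separate vertexMode {C} {D} d = meet , apart (vertex⇒edgeDisjoint {C} {D} d)
      where
      meet : Disjoint (path (toTour C)) (path (toTour D))
      meet (x∈ , x∈′) with toTour-vertex C x∈ | toTour-vertex D x∈′
      ... | i , refl | j , eq = d i j eq
      apart : EdgeDisjoint C D → EdgesApart (edgesOf (toTour D)) (edgesOf (toTour C))
      apart d e∈ e∈′ same with toTour-edge D e∈ | toTour-edge C e∈′
      ... | i , refl | j , refl = d j i (same-sym same)
    separate edgeMode {C} {D} d e∈ e∈′ same with toTour-edge D e∈ | toTour-edge C e∈′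
    ... | i , refl | j , refl = d j i (same-sym same)

    separated : AllPairs (Separate mode) F
    separated = AllPairs.tabulate⁺ λ {i} {j} i≢j → separate mode {O.cycles i} {O.cycles j} (O.disjoint i j i≢j)

    0<W : 0 < W
    0<W = subst (0 <_) total (positive F (≤-trans 1≤k (≤-reflexive (sym F≡))))
      where
      positive : ∀ F → 1 ≤ length F → 0 < totalLength F
      positive (A ∷ F) _ = ≤-trans (0<length′ A) (m≤m+n _ _)

    N q R : ℕ
    N = ears k
    q = pieceSize k
    R = ratio k

    instance
      R≢0 : NonZero R
      R≢0 = >-nonZero (*-mono-≤ 1≤k (≤-trans (s≤s z≤n) (m≤n+m 2 (N + N + (N + N)))))

    -- So that k D < W ≤ (L + 1) R, where D bounds the cycles found in the pieces.
    L D : ℕ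
    L = (W ∸ 1) / R
    D = N * L + N * L + (N * L + N * L) + (L + L)

    open Growth I L using (ShortTour; DisjointTours; moves)

    W-1<W : suc (W ∸ 1) ≡ W
    W-1<W = m+[n∸m]≡n 0<W

    kD<W : k * D < W
    kD<W = begin-strict
      k * D    ≡⟨ collect k N L ⟩
      L * R    ≤⟨ m/n*n≤m (W ∸ 1) R ⟩
      W ∸ 1    <⟨ ≤-reflexive W-1<W ⟩
      W        ∎
      where
      open ≤-Reasoning
      collect : ∀ k N L → k * (N * L + N * L + (N * L + N * L) + (L + L)) ≡ L * (k * (N + N + (N + N) + 2))
      collect = solve-∀

    W≤ : W ≤ suc L * R
    W≤ = begin
      W                            ≡⟨ sym W-1<W ⟩
      suc (W ∸ 1)                  ≡⟨ cong suc (m≡m%n+[m/n]*n (W ∸ 1) R) ⟩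
      suc ((W ∸ 1) % R + L * R)    ≤⟨ +-monoˡ-≤ (L * R) (m%n<n (W ∸ 1) R) ⟩
      suc L * R                    ∎
      where open ≤-Reasoning

    -- Such tours would form a packing of weight at most `k * D`, less than the minimum `W`; being
    -- vertex-disjoint, they compete in both problems.
    noPack : ∀ (F : List (ShortTour D)) → DisjointTours F → length F ≢ k
    noPack F disj len≡ =
      let C , dis , eq = packing (Dis mode) (λ {C} {D} → Dis-sym mode {C} {D}) (map forget F) (trans (length-map forget F) len≡)
                           (AllPairs.map⁺ (AllPairs.map (λ {A} {B} → apart A B) disj))
      in contradiction (≤-trans (O.minimal C dis) (≤-trans (≤-reflexive eq) (≤-trans (short F) (≤-reflexive (cong (_* D) len≡))))) (<⇒≱ kD<W)
      where
      forget : ShortTour D → ATour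
      forget (s , ms , B , _) = s , ms , B
      apart : ∀ A B → Disjoint (moves A) (moves B) → Dis mode (fromTour (forget A)) (fromTour (forget B))
      apart A B disj = Dis-vertex mode {fromTour (forget A)} {fromTour (forget B)} (fromTour-vertexDisjoint (forget A) (forget B) disj)
      short : ∀ F → totalLength (map forget F) ≤ length F * D
      short []                      = z≤n
      short ((_ , _ , _ , le) ∷ F) = +-mono-≤ le (short F)

    planFor : ∀ X → length X ≤ N + N → Girth> L X → Plan
    planFor X X≤ girth = record
      { Y = Y ; F = map strip F ; ds = ds ; Y≡ = Y≡ ; F≡ = trans (length-map strip F) F≡ ; encoding = enc
      ; good = λ δ → let ok , eq = Logs.extend-log I M mode δ F [] tt separated (All.tabulate λ _ → All.tabulate (λ _ → empty mode) , λ _ ())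
                     in ok , ≤-trans (≤-reflexive (trans eq total)) O.light
      ; fits = fits }
      where
      v : V
      v = Cycle.vertex (O.cycles (fromℕ< 1≤k)) zero
      Z Y X′ : List V
      Z = v ∷ X
      -- Repeating one vertex brings `X` to exactly `M` digits. An additional vertex only removes
      -- tours from those that avoid the set, so the bound on their lengths persists.
      Y = X ++ replicate (M ∸ length X) v
      X′ = Y ʳ++ []
      enough : 1 + (length Z + length Z) + (R + R) ≤ M
      enough = ≤-trans (+-monoˡ-≤ (R + R) (s≤s (+-mono-≤ (s≤s X≤) (s≤s X≤)))) (enough-steps k 1≤k)
      X≤M : length X ≤ M
      X≤M = ≤-trans (≤-trans (n≤1+n _) (≤-trans (m≤m+n _ _) (n≤1+n _))) (≤-trans (m≤m+n _ (R + R)) enough)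
      Y≡ : length Y ≡ M
      Y≡ = trans (length-++ X) (trans (cong (length X +_) (length-replicate (M ∸ length X))) (m+[n∸m]≡n X≤M))
      X′⊆Z : X′ ⊆ Z
      X′⊆Z x∈ with ∈-++⁻ X (Any.reverse⁻ {xs = Y} x∈)
      ... | inj₁ x∈X = there x∈X
      ... | inj₂ x∈v = here (All.lookup {P = _≡ v} (All.replicate⁺ (M ∸ length X) refl) x∈v)
      girth′ : Girth> L X′
      girth′ B av = girth B (All.map (λ x∉ x∈ → x∉ (Any.reverse⁺ (∈-++⁺ˡ x∈))) av)
      encoded = encode girth′ X′⊆Z enough F (All.map (λ le → ≤-trans le (≤-trans (≤-reflexive total) W≤)) (each≤ F))
      ds : List V
      ds = proj₁ encoded
      enc : Encoding X′ (map strip F) ds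
      enc = proj₁ (proj₂ encoded)
      empty : ∀ mode {x} → x ∉ carriedOver mode []
      empty vertexMode ()
      empty edgeMode ()
      1≤M : 1 ≤ M
      1≤M = ≤-trans (s≤s z≤n) enough
      fits : length (Y ++ ds) ≤ K
      fits = begin
        length (Y ++ ds)                             ≡⟨ trans (length-++ Y) (cong₂ _+_ Y≡ (trans (proj₂ (proj₂ encoded)) (cong (_* suc (M + M)) F≡))) ⟩
        M + k * suc (M + M)                          ≡⟨ expand k M ⟩
        (M + k) + (k * M + k * M)                    ≤⟨ +-monoˡ-≤ _ (+-mono-≤ (≤-trans (≤-reflexive (sym (*-identityˡ M))) (*-monoˡ-≤ M 1≤k))
                                                                              (≤-trans (≤-reflexive (sym (*-identityʳ k))) (*-monoʳ-≤ k 1≤M))) ⟩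
        K                                            ∎
        where
        open ≤-Reasoning
        expand : ∀ k m → m + k * suc (m + m) ≡ (m + k) + (k * m + k * m)
        expand = solve-∀

    plan : ¬ ¬ Plan
    plan κ = Hitting.hitting I L D N q (*-mono-≤ 1≤k (s≤s z≤n)) ≤-refl (few-pieces k 1≤k) noPack λ X X≤ girth → κ (planFor X X≤ girth)

  planned : CyclePacking I (Dis mode) → ¬ ¬ Plan
  planned (C , disj , light) κ = optimal ℓ C disj light light λ O → FromOptimal.plan O κ

-- Running time

m<2^m : ∀ m → m < 2 ^ m
m<2^m zero    = s≤s z≤n
m<2^m (suc m) = ≤-trans (s≤s (m<2^m m)) (≤-trans (+-monoˡ-≤ (2 ^ m) (≤-trans (s≤s z≤n) (m<2^m m))) (≤-reflexive (cong (2 ^ m +_) (sym (+-identityʳ (2 ^ m))))))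

module Powers (B : ℕ) (2≤B : 2 ≤ B) where

  instance
    B≢0 : NonZero B
    B≢0 = >-nonZero (≤-trans (s≤s z≤n) 2≤B)

  infix 4 _≼_

  -- Only a constant exponent has to come out in the end, so exponents are estimated generously: a
  -- sum costs one more than the larger exponent, because `2 ≤ B`.
  record _≼_ (x i : ℕ) : Set where
    constructor within
    field bound : x ≤ B ^ i

  raise : ∀ {x i j} → i ≤ j → x ≤ B ^ i → x ≤ B ^ j
  raise i≤j le = ≤-trans le (^-monoʳ-≤ B i≤j)

  plus : ∀ {x y i j} → x ≼ i → y ≼ j → (x + y) ≼ suc (i ⊔ j)
  plus {x} {y} {i} {j} (within x≤) (within y≤) = within (begin
    x + y                          ≤⟨ +-mono-≤ (raise (m≤m⊔n i j) x≤) (raise (m≤n⊔m i j) y≤) ⟩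
    B ^ (i ⊔ j) + B ^ (i ⊔ j)      ≡⟨ cong (B ^ (i ⊔ j) +_) (sym (+-identityʳ _)) ⟩
    2 * B ^ (i ⊔ j)                ≤⟨ *-monoˡ-≤ (B ^ (i ⊔ j)) 2≤B ⟩
    B ^ suc (i ⊔ j)                ∎)
    where open ≤-Reasoning

  times : ∀ {x y i j} → x ≼ i → y ≼ j → (x * y) ≼ (i + j)
  times {i = i} {j} (within x≤) (within y≤) = within (≤-trans (*-mono-≤ x≤ y≤) (≤-reflexive (sym (^-distribˡ-+-* B i j))))

  unit : ∀ {x} → x ≤ B → x ≼ 1
  unit x≤ = within (≤-trans x≤ (≤-reflexive (sym (*-identityʳ B))))

  looped : ∀ {m c i} → m ≼ 1 → c ≼ i → loopCost m c ≼ suc (1 ⊔ (1 + suc (1 ⊔ i)))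
  looped m≤ c≤ = plus (unit 2≤B) (times m≤ (plus (unit 2≤B) c≤))

module Time (I : Instance) (mode : Mode) where
  open Base I
  open Main I mode
  open Distances I M using (rowCost; roundCost; bfCost)
  open Guessing I M mode using (cycleCost; checkCost; guessCost)
  open Odometer I M mode K using (tickCost; odometerCost; iterationCost; searchCost)

  -- With `B` equal to `b ^ K`, each of `n`, `k`, `M`, `K`, `n ^ K` and the numeric constants is at
  -- most `B`. The total cost is then a fixed power of `B`, and the nesting of the loops gives 39.
  b B : ℕ
  b = 2 ⊔ n
  B = b ^ K

  instance
    b≢0 : NonZero b
    b≢0 = >-nonZero (≤-trans (s≤s z≤n) (m≤m⊔n 2 n))

  up : ∀ m → m ≤ k * m
  up m = ≤-trans (≤-reflexive (sym (*-identityˡ m))) (*-monoˡ-≤ m 1≤k)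

  16384≤M : 16384 ≤ M
  16384≤M = ≤-trans (up 16384) (≤-trans (up (scaled k 1)) (≤-trans (up (scaled k 2)) (up (scaled k 3))))

  M≤K : M ≤ K
  M≤K = ≤-trans (up M) (≤-trans (m≤m+n (k * M) (k * M)) (m≤m+n (k * M + k * M) (k * M + k * M)))

  K<B : K < B
  K<B = ≤-trans (m<2^m K) (^-monoˡ-≤ K (m≤m⊔n 2 n))

  16384≤B : 16384 ≤ B
  16384≤B = ≤-trans 16384≤M (≤-trans M≤K (<⇒≤ K<B))

  open Powers B (≤-trans (≤ᵇ⇒≤ 2 16384 _) 16384≤B)

  constant : ∀ c → {_ : Bool.T (c ≤ᵇ 16384)} → c ≼ 1
  constant c {t} = unit (≤-trans (≤ᵇ⇒≤ c 16384 t) 16384≤B)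

  n≤ : n ≼ 1
  n≤ = unit (≤-trans (m≤n⊔m 2 n) (≤-trans (≤-reflexive (sym (*-identityʳ b))) (^-monoʳ-≤ b (≤-trans (≤ᵇ⇒≤ 1 16384 _) (≤-trans 16384≤M M≤K)))))

  M≤ : M ≼ 1
  M≤ = unit (≤-trans M≤K (<⇒≤ K<B))

  K≤ : K ≼ 1
  K≤ = unit (<⇒≤ K<B)

  k≤ : k ≼ 1
  k≤ = unit (≤-trans (≤-trans (≤-reflexive (sym (*-identityʳ k))) (≤-trans (*-monoʳ-≤ k (≤-trans (≤ᵇ⇒≤ 1 16384 _) 16384≤M)) (≤-trans (m≤m+n (k * M) (k * M)) (m≤m+n (k * M + k * M) _)))) (<⇒≤ K<B))

  n^K≤ : n ^ K ≼ 1
  n^K≤ = unit (^-monoˡ-≤ K (m≤n⊔m 2 n))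

  row≤ : rowCost ≼ 6
  row≤ = plus (constant 1) (plus (looped n≤ (constant 101)) (constant 1))

  round≤ : roundCost ≼ 10
  round≤ = plus (constant 1) (looped n≤ row≤)

  bf≤ : bfCost ≼ 14
  bf≤ = plus (constant 4) (looped n≤ round≤)

  pair≤ : pairCost I M ≼ 18
  pair≤ = plus (constant 3) (plus (constant edgeCost) (plus (constant 3) (plus bf≤ (looped n≤ (constant hopCost)))))

  cycle≤ : cycleCost ≼ 24
  cycle≤ = plus (constant 2) (plus (constant 5) (plus (looped M≤ pair≤) (constant 9)))

  check≤ : checkCost ≼ 30
  check≤ = plus (constant 6) (plus (looped M≤ (constant 4)) (plus (looped k≤ cycle≤) (constant 4)))

  odometer≤ : odometerCost ≼ 6
  odometer≤ = plus (constant 3) (plus (looped K≤ (constant tickCost)) (constant 1))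

  iteration≤ : iterationCost ≼ 32
  iteration≤ = plus (plus check≤ (constant 3)) odometer≤

  search≤ : searchCost ≼ 35
  search≤ = plus (times n^K≤ (plus (constant 1) iteration≤)) (constant 1)

  times≤ : timesCost ≼ 5
  times≤ = plus (constant 1) (looped k≤ (constant 1))

  setup≤ : setupCost ≼ 11
  setup≤ = plus (constant 5) (plus (looped (constant 4) (plus times≤ (constant 1)))
    (plus times≤ (plus (constant 3) (plus (constant 3) (looped n≤ (constant 4))))))

  solver≤ : solverCost ≼ 39
  solver≤ = plus (constant 1) (plus (plus setup≤ (plus search≤ (constant 1))) (constant 1))

  -- `K * 39` equals `156 * 16384 * k ^ 5`: four factors `k` from `M` and one from the number of
  -- cycles. The step from `k ^ 5` to `k ^ 6` is slack.
  exponent : ∀ c → 156 * 16384 ≤ c → K * 39 ≤ c * k ^ 6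
  exponent c c≥ = begin
    K * 39                  ≡⟨ trans (four (k * M)) (nest k 16384) ⟩
    k ^ 5 * (156 * 16384)   ≤⟨ *-mono-≤ (^-monoʳ-≤ k {{>-nonZero 1≤k}} (n≤1+n 5)) c≥ ⟩
    k ^ 6 * c               ≡⟨ *-comm (k ^ 6) c ⟩
    c * k ^ 6               ∎
    where
    open ≤-Reasoning
    four : ∀ p → ((p + p) + (p + p)) * 39 ≡ 156 * p
    four = solve-∀
    nest : ∀ k m → 156 * (k * (k * (k * (k * (k * m))))) ≡ k * (k * (k * (k * (k * 1)))) * (156 * m)
    nest = solve-∀

  solves-within : ∀ c → 156 * 16384 ≤ c → solverCost ≤ b ^ (c * k ^ 6)
  solves-within c c≥ = ≤-trans (_≼_.bound solver≤) (≤-trans (≤-reflexive (^-*-assoc b K 39)) (^-monoʳ-≤ b (exponent c c≥)))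

module Decision (mode : Mode) (c : ℕ) (c≥ : 156 * 16384 ≤ c) where

  Problem : Instance → Set
  Problem I = CyclePacking I (Modes.Dis I mode)

  time : Instance → ℕ
  time I = (2 ⊔ Instance.n I) ^ (c * Instance.k I ^ 6)

  Decided : Instance → Set
  Decided I = ∃[ t ] ∃[ s ] ⟨ solver mode , input I ⟩⇓[ t ] s × t ≤ time I × (accepts s ⇔ Problem I)

  decided : ∀ I (0<n : 0 < Instance.n I) → Run (solver mode) (input I) (Main.solverCost I mode) (Main.Answer I mode 0<n) → Decided I
  decided I 0<n (run {t} {s} halts steps≤ (sound , complete)) =
    t , s , halts , ≤-trans steps≤ (Time.solves-within I mode c c≥) ,
    -- Acceptance is the negation of `var s 0 ≡ 0`, so a plan under double negation is enough to
    -- refute that equation.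
    mk⇔ (λ acc → Correctness.extracted I mode (sound acc)) (λ pack acc≡0 → Correctness.planned I mode pack λ P → complete P acc≡0)

  decided-empty : ∀ I → Instance.n I ≡ 0 → Decided I
  decided-empty I n≡0 = 2 , input I , ⇓else n≡0 ⇓skip , two ,
    mk⇔ (λ acc → contradiction n≡0 acc) (λ (C , _) → impossible n≡0 (Cycle.vertex (C (fromℕ< (Instance.1≤k I))) zero))
    where
    impossible : ∀ {n} {A : Set} → n ≡ 0 → Fin n → A
    impossible refl ()
    two : 2 ≤ time I
    two = ≤-trans (m≤m⊔n 2 (Instance.n I)) (≤-trans (≤-reflexive (sym (*-identityʳ _)))
      (^-monoʳ-≤ (2 ⊔ Instance.n I) {{Time.b≢0 I mode}}
        (*-mono-≤ (≤-trans (≤ᵇ⇒≤ 1 (156 * 16384) _) c≥) (≤-trans (≤-reflexive (sym (^-zeroˡ 6))) (^-monoˡ-≤ 6 (Instance.1≤k I))))))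

  decides : DecidesWithin (solver mode) Problem time
  decides I = by (Instance.n I ≟ 0)
    where
    by : Dec (Instance.n I ≡ 0) → Decided I
    by (yes n≡0) = decided-empty I n≡0
    by (no n≢0)  = decided I (n≢0⇒n>0 n≢0) (Main.run-solver I mode (n≢0⇒n>0 n≢0))

theorem1 : SolvableInTime-n^O[ (λ k → k ^ 6) ] MinSumCyclePacking ×
    SolvableInTime-n^O[ (λ k → k ^ 6) ] MinSumEdgeDisjointCyclePacking
theorem1 =
  (solver vertexMode , 156 * 16384 , Decision.decides vertexMode (156 * 16384) ≤-refl) ,
  (solver edgeMode , 156 * 16384 , Decision.decides edgeMode (156 * 16384) ≤-refl)
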